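{- There is a randomized algorithm which, for any matroid $\mathcal{M}=(E,\mathcal{I})$ on $n=|E|$ elements accessed through an independence oracle, makes polynomially many (in $n$) independence queries per round and, with high probability, outputs a basis of $\mathcal{M}$ within $\widetilde{O}(n^{3/7})$ rounds.
   Context: Independence oracle model: the algorithm may query any $S\subseteq E$ and learns whether $S\in\mathcal{I}$. Computation proceeds in adaptive rounds; in each round the algorithm submits polynomially many queries in parallel, and the queries of a round may depend only on the answers of previous rounds and the algorithm's internal randomness. A basis is a maximal independent set. $\widetilde{O}(\cdot)$ hides factors polylogarithmic in $n$. The round bound is the worst case over all matroids on $n$ elements. -}

module Defs where

open import Data.Nat using (ℕ; zero; suc; _+_; _*_; _∸_; _^_; _≤_)
open import Data.Nat.Logarithm using (⌊log₂_⌋)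
open import Data.Bool using (Bool; true; false)
open import Data.Fin using (Fin)
open import Data.Fin.Subset using (Subset; ⊥; _⊆_; _∪_; ⁅_⁆; _∈_; _∉_; ∣_∣)
open import Data.Vec using (Vec)
open import Data.List using (List; []; _∷_; length; map; _++_)
open import Data.List.Relation.Unary.All using (All)
open import Data.List.Relation.Unary.Unique.Propositional using (Unique)
open import Data.Maybe using (Maybe; just; nothing)
open import Data.Product using (Σ; ∃; _×_; _,_)
open import Relation.Binary.PropositionalEquality using (_≡_)
open import Data.Nat using (_<_)

record Matroid (n : ℕ) : Set where
  field
    indep     : Subset n → Bool
    indep-∅   : indep ⊥ ≡ true
    indep-⊆   : ∀ {A B} → A ⊆ B → indep B ≡ true → indep A ≡ true
    exchange  : ∀ {A B} → indep A ≡ true → indep B ≡ true → ∣ A ∣ < ∣ B ∣ →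
                Σ (Fin n) λ x → x ∈ B × x ∉ A × indep (A ∪ ⁅ x ⁆) ≡ true
open Matroid public

IsBasis : ∀ {n} → Matroid n → Subset n → Set
IsBasis M B = indep M B ≡ true × (∀ S → B ⊆ S → indep M S ≡ true → S ≡ B)

-- Adaptive-round independence-oracle algorithms.
-- A history is the list of completed rounds; each round is the list of
-- (query, answer) pairs. Given its random string and the history, the
-- algorithm either stops with an output set or submits the next round
-- of queries (in parallel).

Round : ℕ → Set
Round n = List (Subset n × Bool)

History : ℕ → Set
History n = List (Round n)

data Step (n : ℕ) : Set where
  output : Subset n → Step n
  query  : List (Subset n) → Step n

record Algorithm : Set where
  field
    randBits : ℕ → ℕ
    step     : ∀ n → Vec Bool (randBits n) → History n → Step n
open Algorithm public

answer : ∀ {n} → Matroid n → List (Subset n) → Round n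
answer M qs = map (λ S → S , indep M S) qs

run : ∀ {n} → (step : History n → Step n) → Matroid n → ℕ → History n → Maybe (Subset n)
run st M R h with st h
... | output B = just B
run st M zero    h | query qs = nothing
run st M (suc R) h | query qs = run st M R (h ++ (answer M qs ∷ []))

PolyQueries : Algorithm → Set
PolyQueries A = ∃ λ c → ∃ λ d → ∀ n r h qs → step A n r h ≡ query qs →
                length qs ≤ c * (suc n) ^ d

Succeeds : (A : Algorithm) → ∀ {n} → Matroid n → ℕ → Vec Bool (randBits A n) → Set
Succeeds A {n} M R r = ∃ λ B → run (step A n r) M R [] ≡ just B × IsBasis M B

-- with high probability: success on at least a (1 - 1/n) fraction of the
-- 2^(randBits n) equally likely random strings
WHP : (A : Algorithm) → ∀ {n} → Matroid n → ℕ → Set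
WHP A {n} M R = Σ (List (Vec Bool (randBits A n))) λ L →
  Unique L × All (Succeeds A M R) L × (n ∸ 1) * 2 ^ randBits A n ≤ n * length L

SoftO-n3/7 : (ℕ → ℕ) → Set
SoftO-n3/7 R = ∃ λ c → ∃ λ k → ∀ n → 2 ≤ n → R n ^ 7 ≤ c * n ^ 3 * ⌊log₂ n ⌋ ^ k

{-# OPTIONS --safe #-}
-- Draw a random set S by keeping every element with the same small probability p.  If S is usually
-- independent, contracting it settles many elements at once, so the task is to raise p as far as possible
-- in few rounds.  Raise the density of S in small windows, inserting the new elements one at a time, and
-- call an element detected if it is spanned at its turn.  A batch of J ~ 1/p samples detects a set H.
-- Either H is large: then a constant fraction of H avoids all samples and can be deleted, since it is spanned
-- by the samples.  Or H is small: then H is set aside until the next contraction, and by exchangeability of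
-- the samples few further elements can be detected.  Within a window of relative width 1/sqrt(p |H|)
-- the likelihood ratio between the two densities on H is essentially bounded, so that, if g is the
-- probability of dependence at the old density before and g' after setting H aside, the probability of
-- dependence at the new density is at most 2 g - g' plus a small error.  Iterating this for polylog(n) layers
-- shows that the probability of dependence does not grow across a window, up to a small additive error.
-- With about v^4 deletions per round and v windows up to density 1/v^2, where v = n^(1/7), each phase
-- contracts about n/v^2 = v^5 elements in v polylog(n) rounds, for a total of v^3 polylog(n) rounds.
module Submission where

open import Defs
open import Data.Bool using (Bool; true; false; not; _∧_; _∨_; if_then_else_; T)
import Data.Bool.Properties as Bool
open import Data.Empty using (⊥-elim)
open import Data.Fin using (Fin; zero; suc; toℕ)
open import Data.Fin.Properties using (any?; _≟_)
open import Data.Fin.Subset using (Subset; _∩_; _∪_; ⊥; ⊤; ⁅_⁆; _∈_; _∉_; _⊆_; ∣_∣)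
open import Data.Fin.Subset.Properties
open import Data.List as List using (List; []; _∷_; _++_; length; map; take; drop; filter; cartesianProductWith)
open import Data.List.Properties using (length-++; length-map; map-++; map-∘; ++-assoc)
open import Data.List.Relation.Unary.All as All using ([]; _∷_)
open import Data.List.Relation.Unary.All.Properties using (all-filter)
open import Data.List.Relation.Unary.AllPairs using ([]; _∷_)
open import Data.List.Relation.Unary.Unique.Propositional using (Unique)
open import Data.List.Relation.Unary.Unique.Propositional.Properties using (cartesianProductWith⁺; filter⁺)
open import Data.Maybe using (Maybe; just; nothing)
open import Data.Nat hiding (_≟_)
open import Data.Nat.DivMod using (m≡m%n+[m/n]*n; m%n<n; /-monoˡ-≤; m*n/n≡m; m/n*n≤m; m/n≡1+[m∸n]/n)
open import Data.Nat.Induction using (<-rec)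
open import Data.Nat.Logarithm using (⌊log₂_⌋; ⌊log₂⌋-mono-≤; ⌊log₂[2^n]⌋≡n; ⌊log₂⌊n/2⌋⌋≡⌊log₂n⌋∸1)
open import Data.Nat.Properties renaming (_≟_ to _≟ℕ_)
open import Data.Nat.Tactic.RingSolver using (solve-∀)
open import Data.Product using (Σ; ∃; _×_; _,_; proj₁; proj₂)
open import Data.Sum using (_⊎_; inj₁; inj₂; [_,_]′)
open import Data.Vec as Vec using (Vec; []; _∷_; lookup; tabulate; _[_]≔_)
open import Data.Vec.Properties using (lookup-zipWith; lookup∘tabulate; lookup⇒[]=; []=⇒lookup; lookup∘update′; lookup-map; ∷-injective)
open import Function using (_∘_; case_of_)
open import Relation.Binary.PropositionalEquality hiding (J)
open import Relation.Nullary using (yes; no; ¬_; Dec; ¬?; _×-dec_)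

-- Finite sums and samplers

-- Why iterating layers tames the risk, that is, the probability of dependence: let w be the risk at
-- the new density on the set where the window ends, and u, u' the risks at the old density before
-- and after a layer. The bound w + u' ≤ 2 u + s makes the excess w - s - u at least double in every
-- layer. No excess exceeds 1, so it was at most 2^-k before the first of k layers. Without the term
-- - g' every window would cost a factor 2, which v windows cannot afford; the term arises because
-- raising H inflates only the dependence that uses H.
--
-- A window of relative width proportional to 1/sqrt(p) advances sqrt(p) by a constant. This is why
-- the densities are consecutive squares over a common power of two.
--
-- The chance of further detections is not observable, so the algorithm cannot tell which small H is
-- typical. It sets aside every small one among k batches; with high probability one of them is
-- typical, and setting aside more than that does no harm.

infixr 9 ∑-syntax

∑ : ∀ {A : Set} → List A → (A → ℕ) → ℕ
∑ []       f = 0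
∑ (x ∷ xs) f = f x + ∑ xs f

∑-syntax : ∀ {A : Set} → List A → (A → ℕ) → ℕ
∑-syntax = ∑

syntax ∑-syntax xs (λ x → t) = ∑[ x ∈ xs ] t

𝟙 : Bool → ℕ
𝟙 true  = 1
𝟙 false = 0

𝟙≤1 : ∀ b → 𝟙 b ≤ 1
𝟙≤1 true  = ≤-refl
𝟙≤1 false = z≤n

+-swap-middle : ∀ a b c d → (a + b) + (c + d) ≡ (a + c) + (b + d)
+-swap-middle a b c d = begin
  (a + b) + (c + d) ≡⟨ +-assoc a b (c + d) ⟩
  a + (b + (c + d)) ≡⟨ cong (a +_) (sym (+-assoc b c d)) ⟩
  a + ((b + c) + d) ≡⟨ cong (λ t → a + (t + d)) (+-comm b c) ⟩
  a + ((c + b) + d) ≡⟨ cong (a +_) (+-assoc c b d) ⟩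
  a + (c + (b + d)) ≡⟨ sym (+-assoc a c (b + d)) ⟩
  (a + c) + (b + d) ∎
  where open ≡-Reasoning

∑-cong : ∀ {A : Set} (xs : List A) {f g : A → ℕ} → (∀ x → f x ≡ g x) → ∑ xs f ≡ ∑ xs g
∑-cong []       eq = refl
∑-cong (x ∷ xs) eq = cong₂ _+_ (eq x) (∑-cong xs eq)

∑-mono : ∀ {A : Set} (xs : List A) {f g : A → ℕ} → (∀ x → f x ≤ g x) → ∑ xs f ≤ ∑ xs g
∑-mono []       le = z≤n
∑-mono (x ∷ xs) le = +-mono-≤ (le x) (∑-mono xs le)

∑-+ : ∀ {A : Set} (xs : List A) (f g : A → ℕ) → ∑[ x ∈ xs ] (f x + g x) ≡ ∑ xs f + ∑ xs g
∑-+ []       f g = refl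
∑-+ (x ∷ xs) f g = trans (cong ((f x + g x) +_) (∑-+ xs f g)) (+-swap-middle (f x) (g x) (∑ xs f) (∑ xs g))

∑-*ˡ : ∀ {A : Set} (xs : List A) c (f : A → ℕ) → ∑[ x ∈ xs ] (c * f x) ≡ c * ∑ xs f
∑-*ˡ []       c f = sym (*-zeroʳ c)
∑-*ˡ (x ∷ xs) c f = trans (cong (c * f x +_) (∑-*ˡ xs c f)) (sym (*-distribˡ-+ c (f x) (∑ xs f)))

∑-*ʳ : ∀ {A : Set} (xs : List A) c (f : A → ℕ) → ∑[ x ∈ xs ] (f x * c) ≡ ∑ xs f * c
∑-*ʳ xs c f = trans (∑-cong xs (λ x → *-comm (f x) c)) (trans (∑-*ˡ xs c f) (*-comm c _))

∑-const : ∀ {A : Set} (xs : List A) c → ∑[ x ∈ xs ] c ≡ length xs * c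
∑-const []       c = refl
∑-const (x ∷ xs) c = cong (c +_) (∑-const xs c)

∑-0 : ∀ {A : Set} (xs : List A) → ∑[ x ∈ xs ] 0 ≡ 0
∑-0 []       = refl
∑-0 (x ∷ xs) = ∑-0 xs

∑-++ : ∀ {A : Set} (xs ys : List A) (f : A → ℕ) → ∑ (xs ++ ys) f ≡ ∑ xs f + ∑ ys f
∑-++ []       ys f = refl
∑-++ (x ∷ xs) ys f = trans (cong (f x +_) (∑-++ xs ys f)) (sym (+-assoc (f x) _ _))

∑-map : ∀ {A B : Set} (xs : List A) (h : A → B) (f : B → ℕ) → ∑ (List.map h xs) f ≡ ∑[ x ∈ xs ] f (h x)
∑-map []       h f = refl
∑-map (x ∷ xs) h f = cong (f (h x) +_) (∑-map xs h f)

∑-prod : ∀ {A B C : Set} (h : A → B → C) xs ys (f : C → ℕ) →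
         ∑ (cartesianProductWith h xs ys) f ≡ ∑[ x ∈ xs ] ∑[ y ∈ ys ] f (h x y)
∑-prod h []       ys f = refl
∑-prod h (x ∷ xs) ys f =
  trans (∑-++ (List.map (h x) ys) _ f) (cong₂ _+_ (∑-map ys (h x) f) (∑-prod h xs ys f))

length-prod : ∀ {A B C : Set} (h : A → B → C) xs ys → length (cartesianProductWith h xs ys) ≡ length xs * length ys
length-prod h []       ys = refl
length-prod h (x ∷ xs) ys =
  trans (length-++ (List.map (h x) ys)) (cong₂ _+_ (length-map (h x) ys) (length-prod h xs ys))

vecs : ∀ {A : Set} → List A → ∀ k → List (Vec A k)
vecs xs zero    = [] ∷ []
vecs xs (suc k) = cartesianProductWith _∷_ xs (vecs xs k)

length-vecs : ∀ {A : Set} (xs : List A) k → length (vecs xs k) ≡ length xs ^ k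
length-vecs xs zero    = refl
length-vecs xs (suc k) = trans (length-prod _∷_ xs (vecs xs k)) (cong (length xs *_) (length-vecs xs k))

∑-vecs-suc : ∀ {A : Set} (xs : List A) k (f : Vec A (suc k) → ℕ) →
             ∑ (vecs xs (suc k)) f ≡ ∑[ x ∈ xs ] ∑[ v ∈ vecs xs k ] f (x ∷ v)
∑-vecs-suc xs k f = ∑-prod _∷_ xs (vecs xs k) f

∑-vecs-+ : ∀ {A : Set} (xs : List A) m k (f : Vec A (m + k) → ℕ) →
           ∑ (vecs xs (m + k)) f ≡ ∑[ u ∈ vecs xs m ] ∑[ v ∈ vecs xs k ] f (u Vec.++ v)
∑-vecs-+ xs zero    k f = sym (+-identityʳ _)
∑-vecs-+ xs (suc m) k f = begin
  ∑ (vecs xs (suc m + k)) f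
    ≡⟨ ∑-vecs-suc xs (m + k) f ⟩
  ∑[ x ∈ xs ] ∑[ w ∈ vecs xs (m + k) ] f (x ∷ w)
    ≡⟨ ∑-cong xs (λ x → ∑-vecs-+ xs m k (λ w → f (x ∷ w))) ⟩
  ∑[ x ∈ xs ] ∑[ u ∈ vecs xs m ] ∑[ v ∈ vecs xs k ] f (x ∷ u Vec.++ v)
    ≡⟨ sym (∑-vecs-suc xs m _) ⟩
  ∑[ u ∈ vecs xs (suc m) ] ∑[ v ∈ vecs xs k ] f (u Vec.++ v) ∎
  where open ≡-Reasoning

bools : List Bool
bools = true ∷ false ∷ []

bitStrings : ∀ k → List (Vec Bool k)
bitStrings = vecs bools

length-bitStrings : ∀ k → length (bitStrings k) ≡ 2 ^ k
length-bitStrings = length-vecs bools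

∑-bits-suc : ∀ k (f : Vec Bool (suc k) → ℕ) →
             ∑ (bitStrings (suc k)) f ≡ ∑[ v ∈ bitStrings k ] f (true ∷ v) + ∑[ v ∈ bitStrings k ] f (false ∷ v)
∑-bits-suc k f = trans (∑-vecs-suc bools k f) (cong (∑[ v ∈ bitStrings k ] f (true ∷ v) +_) (+-identityʳ _))

take-++ : ∀ {A : Set} {m k} (u : Vec A m) (v : Vec A k) → Vec.take m (u Vec.++ v) ≡ u
take-++ []      v = refl
take-++ (x ∷ u) v = cong (x ∷_) (take-++ u v)

drop-++ : ∀ {A : Set} {m k} (u : Vec A m) (v : Vec A k) → Vec.drop m (u Vec.++ v) ≡ v
drop-++ []      v = refl
drop-++ (x ∷ u) v = drop-++ u v

-- A way to draw a uniform element of outcomes from fair coin tosses, up to the multiplicity of the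
-- unused coins.
record Sampler (A : Set) : Set where
  field
    bits     : ℕ
    unused   : ℕ
    decode   : Vec Bool bits → A
    outcomes : List A
    fair     : ∀ f → ∑[ v ∈ bitStrings bits ] f (decode v) ≡ 2 ^ unused * ∑ outcomes f
open Sampler public

bitSampler : ∀ k → Sampler (Vec Bool k)
bitSampler k = record
  { bits = k ; unused = 0 ; decode = λ v → v ; outcomes = bitStrings k ; fair = λ f → sym (*-identityˡ _) }

pairSampler : ∀ {A B C : Set} → (A → B → C) → Sampler A → Sampler B → Sampler C
pairSampler {A} {B} {C} h s t = record
  { bits = bits s + bits t ; unused = unused s + unused t ; decode = dec
  ; outcomes = cartesianProductWith h (outcomes s) (outcomes t) ; fair = law }
  where
  dec : Vec Bool (bits s + bits t) → C
  dec v = h (decode s (Vec.take (bits s) v)) (decode t (Vec.drop (bits s) v))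
  law : ∀ f → ∑[ v ∈ bitStrings (bits s + bits t) ] f (dec v)
            ≡ 2 ^ (unused s + unused t) * ∑ (cartesianProductWith h (outcomes s) (outcomes t)) f
  law f = begin
    ∑[ v ∈ bitStrings (bits s + bits t) ] f (dec v)
      ≡⟨ ∑-vecs-+ bools (bits s) (bits t) _ ⟩
    ∑[ u ∈ bitStrings (bits s) ] ∑[ v ∈ bitStrings (bits t) ] f (dec (u Vec.++ v))
      ≡⟨ ∑-cong (bitStrings (bits s)) (λ u → ∑-cong (bitStrings (bits t)) (λ v →
           cong₂ (λ p q → f (h (decode s p) (decode t q))) (take-++ u v) (drop-++ u v))) ⟩
    ∑[ u ∈ bitStrings (bits s) ] ∑[ v ∈ bitStrings (bits t) ] f (h (decode s u) (decode t v))
      ≡⟨ ∑-cong (bitStrings (bits s)) (λ u → fair t (λ b → f (h (decode s u) b))) ⟩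
    ∑[ u ∈ bitStrings (bits s) ] (2 ^ unused t * ∑[ b ∈ outcomes t ] f (h (decode s u) b))
      ≡⟨ fair s (λ a → 2 ^ unused t * ∑[ b ∈ outcomes t ] f (h a b)) ⟩
    2 ^ unused s * ∑[ a ∈ outcomes s ] (2 ^ unused t * ∑[ b ∈ outcomes t ] f (h a b))
      ≡⟨ cong (2 ^ unused s *_) (∑-*ˡ (outcomes s) (2 ^ unused t) _) ⟩
    2 ^ unused s * (2 ^ unused t * ∑[ a ∈ outcomes s ] ∑[ b ∈ outcomes t ] f (h a b))
      ≡⟨ sym (*-assoc (2 ^ unused s) _ _) ⟩
    2 ^ unused s * 2 ^ unused t * ∑[ a ∈ outcomes s ] ∑[ b ∈ outcomes t ] f (h a b)
      ≡⟨ cong₂ _*_ (sym (^-distribˡ-+-* 2 (unused s) (unused t))) (sym (∑-prod h (outcomes s) (outcomes t) f)) ⟩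
    2 ^ (unused s + unused t) * ∑ (cartesianProductWith h (outcomes s) (outcomes t)) f ∎
    where open ≡-Reasoning

vecSampler : ∀ {A : Set} → Sampler A → ∀ k → Sampler (Vec A k)
vecSampler s zero    = record
  { bits = 0 ; unused = 0 ; decode = λ _ → [] ; outcomes = [] ∷ [] ; fair = λ f → sym (*-identityˡ _) }
vecSampler s (suc k) = pairSampler _∷_ s (vecSampler s k)

-- Rounds at different scales need different numbers of coins. Padding gives all rounds the same
-- coin space, so a whole run is driven by a vector of equal blocks; the surplus coins multiply
-- every count by the same power of two.
padSampler : ∀ {A : Set} (s : Sampler A) {k} → bits s ≤ k → Vec Bool k → A
padSampler s {k} le v = decode s (Vec.take (bits s) (subst (Vec Bool) (sym (m+[n∸m]≡n le)) v))

outcomes-vec : ∀ {A : Set} (s : Sampler A) k → outcomes (vecSampler s k) ≡ vecs (outcomes s) k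
outcomes-vec s zero    = refl
outcomes-vec s (suc k) = cong (cartesianProductWith _∷_ (outcomes s)) (outcomes-vec s k)

∑-subst : ∀ {j k} (eq : k ≡ j) (f : Vec Bool j → ℕ) →
          ∑[ v ∈ bitStrings k ] f (subst (Vec Bool) eq v) ≡ ∑ (bitStrings j) f
∑-subst refl f = refl

padSampler-law : ∀ {A : Set} (s : Sampler A) {k} (le : bits s ≤ k) (f : A → ℕ) →
  ∑[ v ∈ bitStrings k ] f (padSampler s le v) ≡ 2 ^ (k ∸ bits s + unused s) * ∑ (outcomes s) f
padSampler-law s {k} le f = begin
  ∑[ v ∈ bitStrings k ] f (padSampler s le v)
    ≡⟨ ∑-subst (sym (m+[n∸m]≡n le)) (λ w → f (decode s (Vec.take (bits s) w))) ⟩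
  ∑[ w ∈ bitStrings (bits s + r) ] f (decode s (Vec.take (bits s) w))
    ≡⟨ ∑-vecs-+ bools (bits s) r _ ⟩
  ∑[ u ∈ bitStrings (bits s) ] ∑[ v ∈ bitStrings r ] f (decode s (Vec.take (bits s) (u Vec.++ v)))
    ≡⟨ ∑-cong (bitStrings (bits s)) (λ u → trans
         (∑-cong (bitStrings r) (λ v → cong (λ p → f (decode s p)) (take-++ u v)))
         (trans (∑-const (bitStrings r) _) (cong (_* f (decode s u)) (length-bitStrings r)))) ⟩
  ∑[ u ∈ bitStrings (bits s) ] (2 ^ r * f (decode s u))
    ≡⟨ ∑-*ˡ (bitStrings (bits s)) (2 ^ r) _ ⟩
  2 ^ r * ∑[ u ∈ bitStrings (bits s) ] f (decode s u)
    ≡⟨ cong (2 ^ r *_) (fair s f) ⟩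
  2 ^ r * (2 ^ unused s * ∑ (outcomes s) f)
    ≡⟨ sym (*-assoc (2 ^ r) _ _) ⟩
  2 ^ r * 2 ^ unused s * ∑ (outcomes s) f
    ≡⟨ cong (_* ∑ (outcomes s) f) (sym (^-distribˡ-+-* 2 r (unused s))) ⟩
  2 ^ (r + unused s) * ∑ (outcomes s) f ∎
  where
  open ≡-Reasoning
  r = k ∸ bits s

allᵇ : ∀ {A : Set} {k} → (A → Bool) → Vec A k → Bool
allᵇ p []      = true
allᵇ p (x ∷ v) = p x ∧ allᵇ p v

𝟙-∧ : ∀ a b → 𝟙 (a ∧ b) ≡ 𝟙 a * 𝟙 b
𝟙-∧ true  b = sym (+-identityʳ _)
𝟙-∧ false b = refl

𝟙-not : ∀ b → 𝟙 b + 𝟙 (not b) ≡ 1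
𝟙-not true  = refl
𝟙-not false = refl

∑-allᵇ : ∀ {A : Set} (xs : List A) (p : A → Bool) k →
         ∑[ v ∈ vecs xs k ] 𝟙 (allᵇ p v) ≡ (∑[ x ∈ xs ] 𝟙 (p x)) ^ k
∑-allᵇ xs p zero    = refl
∑-allᵇ xs p (suc k) = begin
  ∑[ v ∈ vecs xs (suc k) ] 𝟙 (allᵇ p v)
    ≡⟨ ∑-vecs-suc xs k _ ⟩
  ∑[ x ∈ xs ] ∑[ v ∈ vecs xs k ] 𝟙 (p x ∧ allᵇ p v)
    ≡⟨ ∑-cong xs (λ x → trans (∑-cong (vecs xs k) (λ v → 𝟙-∧ (p x) (allᵇ p v))) (∑-*ˡ (vecs xs k) (𝟙 (p x)) _)) ⟩
  ∑[ x ∈ xs ] (𝟙 (p x) * ∑[ v ∈ vecs xs k ] 𝟙 (allᵇ p v))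
    ≡⟨ ∑-*ʳ xs _ _ ⟩
  (∑[ x ∈ xs ] 𝟙 (p x)) * ∑[ v ∈ vecs xs k ] 𝟙 (allᵇ p v)
    ≡⟨ cong ((∑[ x ∈ xs ] 𝟙 (p x)) *_) (∑-allᵇ xs p k) ⟩
  (∑[ x ∈ xs ] 𝟙 (p x)) ^ suc k ∎
  where open ≡-Reasoning

∑ᶠ : ∀ n → (Fin n → ℕ) → ℕ
∑ᶠ zero    f = 0
∑ᶠ (suc n) f = f zero + ∑ᶠ n (f ∘ suc)

∑ᶠ-cong : ∀ n {f g : Fin n → ℕ} → (∀ i → f i ≡ g i) → ∑ᶠ n f ≡ ∑ᶠ n g
∑ᶠ-cong zero    eq = refl
∑ᶠ-cong (suc n) eq = cong₂ _+_ (eq zero) (∑ᶠ-cong n (eq ∘ suc))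

∑ᶠ-mono : ∀ n {f g : Fin n → ℕ} → (∀ i → f i ≤ g i) → ∑ᶠ n f ≤ ∑ᶠ n g
∑ᶠ-mono zero    le = z≤n
∑ᶠ-mono (suc n) le = +-mono-≤ (le zero) (∑ᶠ-mono n (le ∘ suc))

∑ᶠ-+ : ∀ n (f g : Fin n → ℕ) → ∑ᶠ n (λ i → f i + g i) ≡ ∑ᶠ n f + ∑ᶠ n g
∑ᶠ-+ zero    f g = refl
∑ᶠ-+ (suc n) f g = trans (cong (f zero + g zero +_) (∑ᶠ-+ n (f ∘ suc) (g ∘ suc)))
                         (+-swap-middle (f zero) (g zero) _ _)

∑ᶠ-*ˡ : ∀ n c (f : Fin n → ℕ) → ∑ᶠ n (λ i → c * f i) ≡ c * ∑ᶠ n f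
∑ᶠ-*ˡ zero    c f = sym (*-zeroʳ c)
∑ᶠ-*ˡ (suc n) c f = trans (cong (c * f zero +_) (∑ᶠ-*ˡ n c (f ∘ suc))) (sym (*-distribˡ-+ c (f zero) _))

∑ᶠ-const : ∀ n c → ∑ᶠ n (λ _ → c) ≡ n * c
∑ᶠ-const zero    c = refl
∑ᶠ-const (suc n) c = cong (c +_) (∑ᶠ-const n c)

∑-∑ᶠ-swap : ∀ {A : Set} (xs : List A) n (f : A → Fin n → ℕ) →
            ∑[ x ∈ xs ] ∑ᶠ n (f x) ≡ ∑ᶠ n (λ i → ∑[ x ∈ xs ] f x i)
∑-∑ᶠ-swap xs zero    f = ∑-0 xs
∑-∑ᶠ-swap xs (suc n) f =
  trans (∑-+ xs (λ x → f x zero) _) (cong (∑ xs (λ x → f x zero) +_) (∑-∑ᶠ-swap xs n (λ x → f x ∘ suc)))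

-- Weighted subsets

-- A product measure with unnormalised weights for membership and absence. The two are independent
-- parameters because the tilted weights of the likelihood-ratio argument do not add up to a
-- constant.
W : ∀ n → (a b : Fin n → ℕ) → (Subset n → ℕ) → ℕ
W zero    a b f = f []
W (suc n) a b f = a zero * W n (a ∘ suc) (b ∘ suc) (f ∘ (true ∷_))
                + b zero * W n (a ∘ suc) (b ∘ suc) (f ∘ (false ∷_))

W-cong : ∀ n {a b a' b' : Fin n → ℕ} {f g} → (∀ e → a e ≡ a' e) → (∀ e → b e ≡ b' e) →
         (∀ S → f S ≡ g S) → W n a b f ≡ W n a' b' g
W-cong zero    ea eb ef = ef []
W-cong (suc n) ea eb ef =
  cong₂ _+_ (cong₂ _*_ (ea zero) (W-cong n (ea ∘ suc) (eb ∘ suc) (ef ∘ (true ∷_))))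
            (cong₂ _*_ (eb zero) (W-cong n (ea ∘ suc) (eb ∘ suc) (ef ∘ (false ∷_))))

W-mono : ∀ n {a b : Fin n → ℕ} {f g} → (∀ S → f S ≤ g S) → W n a b f ≤ W n a b g
W-mono zero    le = le []
W-mono (suc n) {a} {b} le =
  +-mono-≤ (*-monoʳ-≤ (a zero) (W-mono n (le ∘ (true ∷_)))) (*-monoʳ-≤ (b zero) (W-mono n (le ∘ (false ∷_))))

interchange : ∀ a b p q r s → a * (p + q) + b * (r + s) ≡ (a * p + b * r) + (a * q + b * s)
interchange = solve-∀

W-+ : ∀ n (a b : Fin n → ℕ) f g → W n a b (λ S → f S + g S) ≡ W n a b f + W n a b g
W-+ zero    a b f g = refl
W-+ (suc n) a b f g = trans
  (cong₂ (λ x y → a zero * x + b zero * y)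
    (W-+ n (a ∘ suc) (b ∘ suc) (f ∘ (true ∷_)) (g ∘ (true ∷_)))
    (W-+ n (a ∘ suc) (b ∘ suc) (f ∘ (false ∷_)) (g ∘ (false ∷_))))
  (interchange (a zero) (b zero) _ _ _ _)

∏ : ∀ n → (Fin n → ℕ) → ℕ
∏ zero    f = 1
∏ (suc n) f = f zero * ∏ n (f ∘ suc)

∏-cong : ∀ n {f g : Fin n → ℕ} → (∀ e → f e ≡ g e) → ∏ n f ≡ ∏ n g
∏-cong zero    eq = refl
∏-cong (suc n) eq = cong₂ _*_ (eq zero) (∏-cong n (eq ∘ suc))

∏-mono : ∀ n {f g : Fin n → ℕ} → (∀ e → f e ≤ g e) → ∏ n f ≤ ∏ n g
∏-mono zero    le = ≤-refl
∏-mono (suc n) le = *-mono-≤ (le zero) (∏-mono n (le ∘ suc))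

∏-const : ∀ n c → ∏ n (λ _ → c) ≡ c ^ n
∏-const zero    c = refl
∏-const (suc n) c = cong (c *_) (∏-const n c)

*-swap-middle : ∀ a b c d → (a * b) * (c * d) ≡ (a * c) * (b * d)
*-swap-middle = solve-∀

∏-* : ∀ n (f g : Fin n → ℕ) → ∏ n (λ e → f e * g e) ≡ ∏ n f * ∏ n g
∏-* zero    f g = refl
∏-* (suc n) f g = trans (cong (f zero * g zero *_) (∏-* n (f ∘ suc) (g ∘ suc)))
                        (*-swap-middle (f zero) (g zero) _ _)

∏-pos : ∀ n {f : Fin n → ℕ} → (∀ e → 1 ≤ f e) → 1 ≤ ∏ n f
∏-pos zero    le = ≤-refl
∏-pos (suc n) le = *-mono-≤ (le zero) (∏-pos n (le ∘ suc))

W-one : ∀ n (a b : Fin n → ℕ) → W n a b (λ _ → 1) ≡ ∏ n (λ e → a e + b e)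
W-one zero    a b = refl
W-one (suc n) a b = trans (cong (λ x → a zero * x + b zero * x) (W-one n (a ∘ suc) (b ∘ suc)))
                          (sym (*-distribʳ-+ _ (a zero) (b zero)))

size : ∀ {n} → Subset n → ℕ
size {n} S = ∑ᶠ n (λ e → 𝟙 (lookup S e))

-- N ^ n times the expectation of f over the random set that contains each element e independently with
-- probability t e / N.
Wt : ∀ {n} → ℕ → (Fin n → ℕ) → (Subset n → ℕ) → ℕ
Wt {n} N t f = W n t (λ e → N ∸ t e) f

module _ {N : ℕ} where

  Wt-cong-t : ∀ {n} {t t' : Fin n → ℕ} f → (∀ e → t e ≡ t' e) → Wt N t f ≡ Wt N t' f
  Wt-cong-t {n} f eq = W-cong n eq (λ e → cong (N ∸_) (eq e)) (λ _ → refl)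

  Wt-total : ∀ {n} {t : Fin n → ℕ} → (∀ e → t e ≤ N) → Wt N t (λ _ → 1) ≡ N ^ n
  Wt-total {n} {t} le = trans (W-one n t _) (trans (∏-cong n (λ e → m+[n∸m]≡n (le e))) (∏-const n N))

  Wt≤ : ∀ {n} {t : Fin n → ℕ} {f} → (∀ e → t e ≤ N) → (∀ S → f S ≤ 1) → Wt N t f ≤ N ^ n
  Wt≤ {n} le f≤1 = ≤-trans (W-mono n f≤1) (≤-reflexive (Wt-total le))

-- Inclusion phrased through `lookup`, so that recursion over coordinates applies directly; `⊑⇒⊆`
-- converts it for the matroid axioms.
_⊑_ : ∀ {n} → Subset n → Subset n → Set
S ⊑ T = ∀ e → lookup S e ≡ true → lookup T e ≡ true

⊑-refl : ∀ {n} {S : Subset n} → S ⊑ S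
⊑-refl e p = p

⊑-trans : ∀ {n} {S T U : Subset n} → S ⊑ T → T ⊑ U → S ⊑ U
⊑-trans p q e = q e ∘ p e

⊑-cons : ∀ {n} {S T : Subset n} b → S ⊑ T → (b ∷ S) ⊑ (b ∷ T)
⊑-cons b le zero    p = p
⊑-cons b le (suc e) p = le e p

⊑-out : ∀ {n} {S : Subset n} → (false ∷ S) ⊑ (true ∷ S)
⊑-out zero    ()
⊑-out (suc e) p = p

-- Shifting weight `t' ∸ t` from the smaller value `y'` to the larger value `x'` can only raise a
-- weighted average. This is monotonicity in the density for a single coordinate.
convex-mono : ∀ N {t t'} {x y x' y'} → t ≤ t' → t' ≤ N → x ≤ x' → y ≤ y' → y' ≤ x' →
              t * x + (N ∸ t) * y ≤ t' * x' + (N ∸ t') * y'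
convex-mono N {t} {t'} {x} {y} {x'} {y'} t≤t' t'≤N x≤ y≤ y'≤x' = begin
  t * x + (N ∸ t) * y
    ≤⟨ +-mono-≤ (*-monoʳ-≤ t x≤) (*-monoʳ-≤ (N ∸ t) y≤) ⟩
  t * x' + (N ∸ t) * y'
    ≡⟨ cong (λ s → t * x' + s * y') split ⟩
  t * x' + ((t' ∸ t) + (N ∸ t')) * y'
    ≡⟨ cong (t * x' +_) (*-distribʳ-+ y' (t' ∸ t) (N ∸ t')) ⟩
  t * x' + ((t' ∸ t) * y' + (N ∸ t') * y')
    ≤⟨ +-monoʳ-≤ (t * x') (+-monoˡ-≤ _ (*-monoʳ-≤ (t' ∸ t) y'≤x')) ⟩
  t * x' + ((t' ∸ t) * x' + (N ∸ t') * y')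
    ≡⟨ sym (+-assoc (t * x') _ _) ⟩
  t * x' + (t' ∸ t) * x' + (N ∸ t') * y'
    ≡⟨ cong (_+ (N ∸ t') * y') (sym (*-distribʳ-+ x' t (t' ∸ t))) ⟩
  (t + (t' ∸ t)) * x' + (N ∸ t') * y'
    ≡⟨ cong (λ s → s * x' + (N ∸ t') * y') (m+[n∸m]≡n t≤t') ⟩
  t' * x' + (N ∸ t') * y' ∎
  where
  open ≤-Reasoning
  split : N ∸ t ≡ (t' ∸ t) + (N ∸ t')
  split = sym (trans (+-comm (t' ∸ t) (N ∸ t')) (trans (sym (+-∸-assoc (N ∸ t') t≤t')) (cong (_∸ t) (m∸n+n≡m t'≤N))))

Wt-mono-t : ∀ {N n} {t t' : Fin n → ℕ} {f} → (∀ {S T} → S ⊑ T → f S ≤ f T) →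
            (∀ e → t e ≤ t' e) → (∀ e → t' e ≤ N) → Wt N t f ≤ Wt N t' f
Wt-mono-t {n = zero}  mono le le' = ≤-refl
Wt-mono-t {N} {suc n} mono le le' = convex-mono N (le zero) (le' zero)
  (Wt-mono-t (λ p → mono (⊑-cons true p)) (le ∘ suc) (le' ∘ suc))
  (Wt-mono-t (λ p → mono (⊑-cons false p)) (le ∘ suc) (le' ∘ suc))
  (W-mono n (λ S → mono ⊑-out))

-- Random subsets from binary numbers compared with thresholds

num : ∀ {b} → Vec Bool b → ℕ
num []                = 0
num {suc b} (true ∷ v)  = 2 ^ b + num v
num {suc b} (false ∷ v) = num v

num<2^b : ∀ {b} (v : Vec Bool b) → num v < 2 ^ b
num<2^b []                = s≤s z≤n
num<2^b {suc b} (true ∷ v)  = +-monoʳ-< (2 ^ b) (≤-trans (num<2^b v) (≤-reflexive (sym (+-identityʳ _))))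
num<2^b {suc b} (false ∷ v) = ≤-trans (num<2^b v) (m≤m+n _ _)

<ᵇ-true : ∀ {m n} → m < n → (m <ᵇ n) ≡ true
<ᵇ-true {m} {n} lt with m <ᵇ n | <⇒<ᵇ lt
... | true | _ = refl

<ᵇ-false : ∀ {m n} → n ≤ m → (m <ᵇ n) ≡ false
<ᵇ-false {m} {n} le with m <ᵇ n in eq
... | false = refl
... | true  = ⊥-elim (<-irrefl refl (<-≤-trans (<ᵇ⇒< m n (subst T (sym eq) _)) le))

<ᵇ-sound : ∀ {m n} → (m <ᵇ n) ≡ true → m < n
<ᵇ-sound {m} {n} eq = <ᵇ⇒< m n (subst T (sym eq) _)

≤ᵇ-complete : ∀ {m n} → m ≤ n → (m ≤ᵇ n) ≡ true
≤ᵇ-complete {m} {n} le with m ≤ᵇ n | ≤⇒≤ᵇ le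
... | true | _ = refl

<ᵇ-+ : ∀ k m n → (k + m <ᵇ k + n) ≡ (m <ᵇ n)
<ᵇ-+ zero    m n = refl
<ᵇ-+ (suc k) m n = <ᵇ-+ k m n

count-num : ∀ b {t} → t ≤ 2 ^ b → ∑[ v ∈ bitStrings b ] 𝟙 (num v <ᵇ t) ≡ t
count-num zero {zero}        le = refl
count-num zero {suc zero}    le = refl
count-num zero {suc (suc t)} (s≤s ())
count-num (suc b) {t} le with ≤-total t (2 ^ b)
... | inj₁ t≤ = trans (∑-bits-suc b _) (cong₂ _+_
        (trans (∑-cong (bitStrings b) (λ v → cong 𝟙 (<ᵇ-false (≤-trans t≤ (m≤m+n _ (num v)))))) (∑-0 (bitStrings b)))
        (count-num b t≤))
... | inj₂ ≤t = trans (∑-bits-suc b _) (trans (cong₂ _+_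
        (trans (∑-cong (bitStrings b) (λ v → cong 𝟙 (trans (cong (2 ^ b + num v <ᵇ_) (sym (m+[n∸m]≡n ≤t)))
                                                        (<ᵇ-+ (2 ^ b) (num v) _))))
               (count-num b {t ∸ 2 ^ b} (m≤n+o⇒m∸n≤o t (2 ^ b) (≤-trans le (≤-reflexive (cong (2 ^ b +_) (+-identityʳ _)))))))
        (trans (∑-cong (bitStrings b) (λ v → cong 𝟙 (<ᵇ-true (<-≤-trans (num<2^b v) ≤t))))
               (trans (∑-const (bitStrings b) 1) (trans (*-identityʳ _) (length-bitStrings b)))))
        (m∸n+n≡m ≤t))

Sample : ℕ → ℕ → Set
Sample b n = Vec (Vec Bool b) n

samples : ∀ b n → List (Sample b n)
samples b n = vecs (bitStrings b) n

-- One number per element serves all thresholds at once, so the sets drawn from one sample at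
-- different densities are nested. `removable-spanned` rests on this coupling.
pick : ∀ {b n} → (Fin n → ℕ) → Sample b n → Subset n
pick t []      = []
pick t (v ∷ x) = (num v <ᵇ t zero) ∷ pick (t ∘ suc) x

lookup-pick : ∀ {b n} (t : Fin n → ℕ) (x : Sample b n) e → lookup (pick t x) e ≡ (num (lookup x e) <ᵇ t e)
lookup-pick t (v ∷ x) zero    = refl
lookup-pick t (v ∷ x) (suc e) = lookup-pick (t ∘ suc) x e

∑-threshold : ∀ b {t} → t ≤ 2 ^ b → (g : Bool → ℕ) →
              ∑[ v ∈ bitStrings b ] g (num v <ᵇ t) ≡ t * g true + (2 ^ b ∸ t) * g false
∑-threshold b {t} le g = begin
  ∑[ v ∈ bitStrings b ] g (num v <ᵇ t)
    ≡⟨ ∑-cong (bitStrings b) (λ v → expand (num v <ᵇ t)) ⟩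
  ∑[ v ∈ bitStrings b ] (𝟙 (num v <ᵇ t) * g true + 𝟙 (not (num v <ᵇ t)) * g false)
    ≡⟨ ∑-+ (bitStrings b) _ _ ⟩
  ∑[ v ∈ bitStrings b ] (𝟙 (num v <ᵇ t) * g true) + ∑[ v ∈ bitStrings b ] (𝟙 (not (num v <ᵇ t)) * g false)
    ≡⟨ cong₂ _+_ (∑-*ʳ (bitStrings b) _ _) (∑-*ʳ (bitStrings b) _ _) ⟩
  (∑[ v ∈ bitStrings b ] 𝟙 (num v <ᵇ t)) * g true + (∑[ v ∈ bitStrings b ] 𝟙 (not (num v <ᵇ t))) * g false
    ≡⟨ cong₂ (λ p q → p * g true + q * g false) (count-num b le) complement ⟩
  t * g true + (2 ^ b ∸ t) * g false ∎
  where
  open ≡-Reasoning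
  expand : ∀ c → g c ≡ 𝟙 c * g true + 𝟙 (not c) * g false
  expand true  = sym (trans (+-identityʳ _) (+-identityʳ _))
  expand false = sym (+-identityʳ _)
  total : ∑[ v ∈ bitStrings b ] 𝟙 (num v <ᵇ t) + ∑[ v ∈ bitStrings b ] 𝟙 (not (num v <ᵇ t)) ≡ 2 ^ b
  total = trans (sym (∑-+ (bitStrings b) _ _)) (trans (∑-cong (bitStrings b) (λ v → 𝟙-not (num v <ᵇ t)))
          (trans (∑-const (bitStrings b) 1) (trans (*-identityʳ _) (length-bitStrings b))))
  complement : ∑[ v ∈ bitStrings b ] 𝟙 (not (num v <ᵇ t)) ≡ 2 ^ b ∸ t
  complement = sym (trans (cong (_∸ t) (sym total)) (trans (cong (λ s → s + ∑[ v ∈ bitStrings b ] 𝟙 (not (num v <ᵇ t)) ∸ t) (count-num b le)) (m+n∸m≡n t _)))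

∑-pick : ∀ b {n} {t : Fin n → ℕ} → (∀ e → t e ≤ 2 ^ b) → ∀ f →
         ∑[ x ∈ samples b n ] f (pick t x) ≡ Wt (2 ^ b) t f
∑-pick b {zero}  le f = +-identityʳ _
∑-pick b {suc n} {t} le f = begin
  ∑[ x ∈ samples b (suc n) ] f (pick t x)
    ≡⟨ ∑-vecs-suc (bitStrings b) n _ ⟩
  ∑[ v ∈ bitStrings b ] ∑[ x ∈ samples b n ] f ((num v <ᵇ t zero) ∷ pick (t ∘ suc) x)
    ≡⟨ ∑-cong (bitStrings b) (λ v → ∑-pick b (le ∘ suc) (λ S → f ((num v <ᵇ t zero) ∷ S))) ⟩
  ∑[ v ∈ bitStrings b ] Wt (2 ^ b) (t ∘ suc) (λ S → f ((num v <ᵇ t zero) ∷ S))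
    ≡⟨ ∑-threshold b (le zero) (λ c → Wt (2 ^ b) (t ∘ suc) (λ S → f (c ∷ S))) ⟩
  Wt (2 ^ b) t f ∎
  where open ≡-Reasoning

omit : ∀ {n} → Fin n → (Fin n → ℕ) → Fin n → ℕ
omit zero    t zero    = 0
omit zero    t (suc e) = t (suc e)
omit (suc i) t zero    = t zero
omit (suc i) t (suc e) = omit i (t ∘ suc) e

omit-≤ : ∀ {n} (i : Fin n) t e → omit i t e ≤ t e
omit-≤ zero    t zero    = z≤n
omit-≤ zero    t (suc e) = ≤-refl
omit-≤ (suc i) t zero    = ≤-refl
omit-≤ (suc i) t (suc e) = omit-≤ i (t ∘ suc) e

-- The coordinate i is independent of a set that omits i.
∑-omit : ∀ b {n} (i : Fin n) {t : Fin n → ℕ} (h : Vec Bool b → ℕ) (f : Subset n → ℕ) →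
  2 ^ b * ∑[ x ∈ samples b n ] (h (lookup x i) * f (pick (omit i t) x))
    ≡ ∑ (bitStrings b) h * ∑[ x ∈ samples b n ] f (pick (omit i t) x)
∑-omit b {suc n} zero {t} h f = begin
  2 ^ b * ∑[ x ∈ samples b (suc n) ] (h (lookup x zero) * f (pick (omit zero t) x))
    ≡⟨ cong (2 ^ b *_) (∑-vecs-suc (bitStrings b) n _) ⟩
  2 ^ b * ∑[ v ∈ bitStrings b ] ∑[ x ∈ samples b n ] (h v * f (false ∷ pick (t ∘ suc) x))
    ≡⟨ cong (2 ^ b *_) (∑-cong (bitStrings b) (λ v → ∑-*ˡ (samples b n) (h v) _)) ⟩
  2 ^ b * ∑[ v ∈ bitStrings b ] (h v * F)
    ≡⟨ cong (2 ^ b *_) (∑-*ʳ (bitStrings b) F h) ⟩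
  2 ^ b * (∑ (bitStrings b) h * F)
    ≡⟨ rearrange (2 ^ b) (∑ (bitStrings b) h) F ⟩
  ∑ (bitStrings b) h * (2 ^ b * F)
    ≡⟨ cong (∑ (bitStrings b) h *_) (sym (trans (∑-vecs-suc (bitStrings b) n _)
         (trans (∑-const (bitStrings b) F) (cong (_* F) (length-bitStrings b))))) ⟩
  ∑ (bitStrings b) h * ∑[ x ∈ samples b (suc n) ] f (pick (omit zero t) x) ∎
  where
  open ≡-Reasoning
  F = ∑[ x ∈ samples b n ] f (false ∷ pick (t ∘ suc) x)
  rearrange : ∀ x y z → x * (y * z) ≡ y * (x * z)
  rearrange = solve-∀
∑-omit b {suc n} (suc i) {t} h f = begin
  2 ^ b * ∑[ x ∈ samples b (suc n) ] (h (lookup x (suc i)) * f (pick (omit (suc i) t) x))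
    ≡⟨ cong (2 ^ b *_) (∑-vecs-suc (bitStrings b) n _) ⟩
  2 ^ b * ∑[ v ∈ bitStrings b ] ∑[ x ∈ samples b n ] (h (lookup x i) * f ((num v <ᵇ t zero) ∷ pick (omit i (t ∘ suc)) x))
    ≡⟨ sym (∑-*ˡ (bitStrings b) (2 ^ b) _) ⟩
  ∑[ v ∈ bitStrings b ] (2 ^ b * ∑[ x ∈ samples b n ] (h (lookup x i) * f ((num v <ᵇ t zero) ∷ pick (omit i (t ∘ suc)) x)))
    ≡⟨ ∑-cong (bitStrings b) (λ v → ∑-omit b i h (λ S → f ((num v <ᵇ t zero) ∷ S))) ⟩
  ∑[ v ∈ bitStrings b ] (∑ (bitStrings b) h * ∑[ x ∈ samples b n ] f ((num v <ᵇ t zero) ∷ pick (omit i (t ∘ suc)) x))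
    ≡⟨ ∑-*ˡ (bitStrings b) (∑ (bitStrings b) h)
         (λ v → ∑[ x ∈ samples b n ] f ((num v <ᵇ t zero) ∷ pick (omit i (t ∘ suc)) x)) ⟩
  ∑ (bitStrings b) h * ∑[ v ∈ bitStrings b ] ∑[ x ∈ samples b n ] f ((num v <ᵇ t zero) ∷ pick (omit i (t ∘ suc)) x)
    ≡⟨ cong (∑ (bitStrings b) h *_) (sym (∑-vecs-suc (bitStrings b) n _)) ⟩
  ∑ (bitStrings b) h * ∑[ x ∈ samples b (suc n) ] f (pick (omit (suc i) t) x) ∎
  where open ≡-Reasoning

hybrid : ∀ {n} → ℕ → (lo hi : Fin n → ℕ) → Fin n → ℕ
hybrid k lo hi e = if toℕ e <ᵇ k then hi e else lo e

-- The thresholds are raised from lo to hi one element at a time, in index order; φ e bounds the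
-- increase of f caused by inserting e.
telescope : ∀ {n N} {lo hi : Fin n → ℕ} → (∀ e → lo e ≤ hi e) → (∀ e → hi e ≤ N) →
  (f : Subset n → ℕ) (φ : Fin n → Subset n → ℕ) →
  (∀ e S → lookup S e ≡ false → f (S [ e ]≔ true) ≤ f S + φ e S) →
  N * Wt N hi f ≤ N * Wt N lo f + ∑ᶠ n (λ e → (hi e ∸ lo e) * Wt N (omit e (hybrid (toℕ e) lo hi)) (φ e))
telescope {zero} lo≤hi hi≤N f φ step = m≤m+n _ _
telescope {suc n} {N} {lo} {hi} lo≤hi hi≤N f φ step = begin
  N * (H * α true + H' * α false)
    ≡⟨ r₁ N H H' (α true) (α false) ⟩
  H * (N * α true) + H' * (N * α false)
    ≤⟨ +-mono-≤ (*-monoʳ-≤ H (tail true)) (*-monoʳ-≤ H' (tail false)) ⟩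
  H * (N * β true + Σ' true) + H' * (N * β false + Σ' false)
    ≡⟨ r₂ N H H' (β true) (β false) (Σ' true) (Σ' false) ⟩
  N * (H * β true + H' * β false) + (H * Σ' true + H' * Σ' false)
    -- The tail raises the later elements with the first coordinate already high. What remains is to
    -- raise that coordinate while all others are still low, at the price `(H ∸ L) * γ`.
    ≤⟨ +-mono-≤ (*-monoʳ-≤ N first) (≤-reflexive merge) ⟩
  N * (L * β true + (N ∸ L) * β false + (H ∸ L) * γ) + Σsuc
    ≡⟨ r₃ N (L * β true + (N ∸ L) * β false) (H ∸ L) γ Σsuc ⟩
  N * (L * β true + (N ∸ L) * β false) + ((H ∸ L) * (N * γ) + Σsuc) ∎
  where
  open ≤-Reasoning
  H  = hi zero
  L  = lo zero
  H' = N ∸ H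
  lo' = lo ∘ suc
  hi' = hi ∘ suc
  α β Σ' : Bool → ℕ
  α c = Wt N hi' (λ S → f (c ∷ S))
  β c = Wt N lo' (λ S → f (c ∷ S))
  Σ' c = ∑ᶠ n (λ e → (hi' e ∸ lo' e) * Wt N (omit e (hybrid (toℕ e) lo' hi')) (λ S → φ (suc e) (c ∷ S)))
  γ = Wt N lo' (λ S → φ zero (false ∷ S))
  Σsuc = ∑ᶠ n (λ e → (hi (suc e) ∸ lo (suc e)) * Wt N (omit (suc e) (hybrid (suc (toℕ e)) lo hi)) (φ (suc e)))
  r₁ : ∀ N H H' a b → N * (H * a + H' * b) ≡ H * (N * a) + H' * (N * b)
  r₁ = solve-∀
  r₂ : ∀ N H H' a b c d → H * (N * a + c) + H' * (N * b + d) ≡ N * (H * a + H' * b) + (H * c + H' * d)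
  r₂ = solve-∀
  r₃ : ∀ N x d g s → N * (x + d * g) + s ≡ N * x + (d * (N * g) + s)
  r₃ = solve-∀
  tail : ∀ c → N * α c ≤ N * β c + Σ' c
  tail c = telescope (lo≤hi ∘ suc) (hi≤N ∘ suc) (λ S → f (c ∷ S)) (λ e S → φ (suc e) (c ∷ S))
             (λ e S out → step (suc e) (c ∷ S) out)
  merge : H * Σ' true + H' * Σ' false ≡ Σsuc
  merge = trans (cong₂ _+_ (sym (∑ᶠ-*ˡ n H _)) (sym (∑ᶠ-*ˡ n H' _)))
         (trans (sym (∑ᶠ-+ n _ _)) (∑ᶠ-cong n (λ e → r₄ H H' (hi' e ∸ lo' e) _ _)))
    where
    r₄ : ∀ H H' d a b → H * (d * a) + H' * (d * b) ≡ d * (H * a + H' * b)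
    r₄ = solve-∀
  β-step : β true ≤ β false + γ
  β-step = ≤-trans (W-mono n (λ S → step zero (false ∷ S) refl)) (≤-reflexive (W-+ n lo' _ _ _))
  first : H * β true + H' * β false ≤ L * β true + (N ∸ L) * β false + (H ∸ L) * γ
  first = begin
    H * β true + H' * β false
      ≡⟨ cong (λ h → h * β true + H' * β false) (sym (m+[n∸m]≡n (lo≤hi zero))) ⟩
    (L + (H ∸ L)) * β true + H' * β false
      ≡⟨ r₅ L (H ∸ L) H' (β true) (β false) ⟩
    L * β true + H' * β false + (H ∸ L) * β true
      ≤⟨ +-monoʳ-≤ (L * β true + H' * β false) (*-monoʳ-≤ (H ∸ L) β-step) ⟩
    L * β true + H' * β false + (H ∸ L) * (β false + γ)
      ≡⟨ r₆ L (H ∸ L) H' (β true) (β false) γ ⟩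
    L * β true + (H' + (H ∸ L)) * β false + (H ∸ L) * γ
      ≡⟨ cong (λ h → L * β true + h * β false + (H ∸ L) * γ)
           (trans (sym (+-∸-assoc H' (lo≤hi zero))) (cong (_∸ L) (m∸n+n≡m (hi≤N zero)))) ⟩
    L * β true + (N ∸ L) * β false + (H ∸ L) * γ ∎
    where
    r₅ : ∀ L d h a b → (L + d) * a + h * b ≡ L * a + h * b + d * a
    r₅ = solve-∀
    r₆ : ∀ L d h a b g → L * a + h * b + d * (b + g) ≡ L * a + (h + d) * b + d * g
    r₆ = solve-∀

on : ∀ {n} → Subset n → (Fin n → ℕ) → Fin n → ℕ
on Y t e = if lookup Y e then t e else 0

-- The coordinates outside Y integrate out, since their two weights add up to N; threshold 0 has the
-- same effect.
Wt-∩ : ∀ {n N} {t : Fin n → ℕ} → (∀ e → t e ≤ N) → (Y : Subset n) → ∀ f →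
       Wt N t (λ S → f (S ∩ Y)) ≡ Wt N (on Y t) f
Wt-∩ le [] f = refl
Wt-∩ {suc n} {N} {t} le (true ∷ Y) f =
  cong₂ (λ x y → t zero * x + (N ∸ t zero) * y) (Wt-∩ (le ∘ suc) Y (f ∘ (true ∷_))) (Wt-∩ (le ∘ suc) Y (f ∘ (false ∷_)))
Wt-∩ {suc n} {N} {t} le (false ∷ Y) f = trans
  (cong₂ (λ x y → t zero * x + (N ∸ t zero) * y) (Wt-∩ (le ∘ suc) Y (f ∘ (false ∷_))) (Wt-∩ (le ∘ suc) Y (f ∘ (false ∷_))))
  (trans (sym (*-distribʳ-+ w (t zero) (N ∸ t zero))) (cong (_* w) (m+[n∸m]≡n (le zero))))
  where w = Wt N (on Y (t ∘ suc)) (f ∘ (false ∷_))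

-- Conditioning on the event that no element of A is drawn.
Wt-avoid : ∀ {n N P} {t₁ t₂ : Fin n → ℕ} (A : Subset n) → (∀ e → t₂ e ≤ N) →
  (∀ e → lookup A e ≡ true → t₁ e ≡ 0 × t₂ e ≤ P) → (∀ e → lookup A e ≡ false → t₁ e ≡ t₂ e) →
  ∀ f → (N ∸ P) ^ size A * Wt N t₁ f ≤ N ^ size A * Wt N t₂ f
Wt-avoid [] t≤N out eq f = ≤-refl
Wt-avoid {suc n} {N} {P} {t₁} {t₂} (true ∷ A) t≤N out eq f = begin
  (N ∸ P) * c * (t₁ zero * W₁ true + (N ∸ t₁ zero) * W₁ false)
    ≡⟨ cong (λ z → (N ∸ P) * c * (z * W₁ true + (N ∸ z) * W₁ false)) (proj₁ (out zero refl)) ⟩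
  (N ∸ P) * c * (N * W₁ false)
    ≡⟨ r₁ (N ∸ P) c N (W₁ false) ⟩
  (N ∸ P) * N * (c * W₁ false)
    ≤⟨ *-mono-≤ (*-monoˡ-≤ N (∸-monoʳ-≤ N (proj₂ (out zero refl)))) (IH false) ⟩
  (N ∸ t₂ zero) * N * (C * W₂ false)
    ≡⟨ r₂ (N ∸ t₂ zero) N C (W₂ false) ⟩
  N * C * ((N ∸ t₂ zero) * W₂ false)
    ≤⟨ *-monoʳ-≤ (N * C) (m≤n+m _ (t₂ zero * W₂ true)) ⟩
  N * C * (t₂ zero * W₂ true + (N ∸ t₂ zero) * W₂ false) ∎
  where
  open ≤-Reasoning
  W₁ W₂ : Bool → ℕ
  W₁ x = Wt N (t₁ ∘ suc) (λ S → f (x ∷ S))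
  W₂ x = Wt N (t₂ ∘ suc) (λ S → f (x ∷ S))
  c = (N ∸ P) ^ size A
  C = N ^ size A
  IH : ∀ x → c * W₁ x ≤ C * W₂ x
  IH x = Wt-avoid A (t≤N ∘ suc) (λ e → out (suc e)) (λ e → eq (suc e)) (λ S → f (x ∷ S))
  r₁ : ∀ p c N w → p * c * (N * w) ≡ p * N * (c * w)
  r₁ = solve-∀
  r₂ : ∀ p N c w → p * N * (c * w) ≡ N * c * (p * w)
  r₂ = solve-∀
Wt-avoid {suc n} {N} {P} {t₁} {t₂} (false ∷ A) t≤N out eq f = begin
  c * (t₁ zero * W₁ true + (N ∸ t₁ zero) * W₁ false)
    ≡⟨ cong (λ z → c * (z * W₁ true + (N ∸ z) * W₁ false)) (eq zero refl) ⟩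
  c * (t₂ zero * W₁ true + (N ∸ t₂ zero) * W₁ false)
    ≡⟨ r₁ c (t₂ zero) (N ∸ t₂ zero) (W₁ true) (W₁ false) ⟩
  t₂ zero * (c * W₁ true) + (N ∸ t₂ zero) * (c * W₁ false)
    ≤⟨ +-mono-≤ (*-monoʳ-≤ (t₂ zero) (IH true)) (*-monoʳ-≤ (N ∸ t₂ zero) (IH false)) ⟩
  t₂ zero * (C * W₂ true) + (N ∸ t₂ zero) * (C * W₂ false)
    ≡⟨ sym (r₁ C (t₂ zero) (N ∸ t₂ zero) (W₂ true) (W₂ false)) ⟩
  C * (t₂ zero * W₂ true + (N ∸ t₂ zero) * W₂ false) ∎
  where
  open ≤-Reasoning
  W₁ W₂ : Bool → ℕ
  W₁ x = Wt N (t₁ ∘ suc) (λ S → f (x ∷ S))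
  W₂ x = Wt N (t₂ ∘ suc) (λ S → f (x ∷ S))
  c = (N ∸ P) ^ size A
  C = N ^ size A
  IH : ∀ x → c * W₁ x ≤ C * W₂ x
  IH x = Wt-avoid A (t≤N ∘ suc) (λ e → out (suc e)) (λ e → eq (suc e)) (λ S → f (x ∷ S))
  r₁ : ∀ c a b x y → c * (a * x + b * y) ≡ a * (c * x) + b * (c * y)
  r₁ = solve-∀

-- Likelihood ratios

power-* : ∀ m n k → (m * n) ^ k ≡ m ^ k * n ^ k
power-* m n zero    = refl
power-* m n (suc k) = trans (cong (m * n *_) (power-* m n k)) (*-swap-middle m n (m ^ k) (n ^ k))

pow-pos : ∀ {m} k → 1 ≤ m → 1 ≤ m ^ k
pow-pos zero    le = ≤-refl
pow-pos (suc k) le = *-mono-≤ le (pow-pos k le)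

cancelˡ : ∀ {o} m n → 1 ≤ o → o * m ≤ o * n → m ≤ n
cancelˡ {suc o} m n pos le = *-cancelˡ-≤ (suc o) le

-- For a likelihood ratio L = u₁ / u₂ one has L ≤ 2 + L ^ (k + 1) / 2 ^ k.
ratio-split : ∀ k {u₁ u₂ u₃ c} → u₃ * u₂ ^ k ≡ u₁ ^ suc k * c → (u₂ ≡ 0 → u₁ ≡ 0) →
              2 ^ k * c * u₁ ≤ 2 ^ suc k * c * u₂ + u₃
ratio-split k {u₁} {u₂} {u₃} {c} rel null with ≤-total u₁ (2 * u₂)
... | inj₁ le = begin
  2 ^ k * c * u₁         ≤⟨ *-monoʳ-≤ (2 ^ k * c) le ⟩
  2 ^ k * c * (2 * u₂)   ≡⟨ r (2 ^ k) c u₂ ⟩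
  2 ^ suc k * c * u₂     ≤⟨ m≤m+n _ u₃ ⟩
  2 ^ suc k * c * u₂ + u₃ ∎
  where
  open ≤-Reasoning
  r : ∀ x c u → x * c * (2 * u) ≡ 2 * x * c * u
  r = solve-∀
... | inj₂ ge = ≤-trans (by-cases (u₂ ≟ℕ 0)) (m≤n+m u₃ _)
  where
  open ≤-Reasoning
  r₁ : ∀ x c u v → v * (x * c * u) ≡ c * u * (x * v)
  r₁ = solve-∀
  r₂ : ∀ c u v → c * u * v ≡ u * v * c
  r₂ = solve-∀
  by-cases : _ → 2 ^ k * c * u₁ ≤ u₃
  by-cases (yes u₂≡0) = ≤-trans (≤-reflexive (trans (cong (2 ^ k * c *_) (null u₂≡0)) (*-zeroʳ (2 ^ k * c)))) z≤n
  by-cases (no u₂≢0) = cancelˡ _ _ (pow-pos k (n≢0⇒n>0 u₂≢0)) (begin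
    u₂ ^ k * (2 ^ k * c * u₁)  ≡⟨ r₁ (2 ^ k) c u₁ (u₂ ^ k) ⟩
    c * u₁ * (2 ^ k * u₂ ^ k)  ≡⟨ cong (c * u₁ *_) (sym (power-* 2 u₂ k)) ⟩
    c * u₁ * (2 * u₂) ^ k      ≤⟨ *-monoʳ-≤ (c * u₁) (^-monoˡ-≤ k ge) ⟩
    c * u₁ * u₁ ^ k            ≡⟨ r₂ c u₁ (u₁ ^ k) ⟩
    u₁ ^ suc k * c             ≡⟨ sym rel ⟩
    u₃ * u₂ ^ k                ≡⟨ *-comm u₃ _ ⟩
    u₂ ^ k * u₃                ∎)

-- Induction over coordinates down to `ratio-split`. `u₁`, `u₂`, `u₃` are the products of the
-- weights fixed so far, and c collects the factors `D`. The third weight stands for `u₁` times the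
-- k-th power of the likelihood ratio, cleared of denominators; the relation that defines it is
-- multiplicative and so survives every coordinate. The conditions on zeros are absolute continuity
-- of the first measure with respect to the second.
W-ratio : ∀ k n {a₁ b₁ a₂ b₂ a₃ b₃ D : Fin n → ℕ} →
  (∀ e → a₃ e * a₂ e ^ k ≡ a₁ e ^ suc k * D e) → (∀ e → b₃ e * b₂ e ^ k ≡ b₁ e ^ suc k * D e) →
  (∀ e → a₂ e ≡ 0 → a₁ e ≡ 0) → (∀ e → b₂ e ≡ 0 → b₁ e ≡ 0) → ∀ f {u₁ u₂ u₃ c} →
  u₃ * u₂ ^ k ≡ u₁ ^ suc k * c → (u₂ ≡ 0 → u₁ ≡ 0) →
  2 ^ k * (c * ∏ n D) * (u₁ * W n a₁ b₁ f) ≤ 2 ^ suc k * (c * ∏ n D) * (u₂ * W n a₂ b₂ f) + u₃ * W n a₃ b₃ f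
W-ratio k zero _ _ _ _ f {u₁} {u₂} {u₃} {c} rel null = begin
  2 ^ k * (c * 1) * (u₁ * f [])    ≡⟨ r₁ (2 ^ k) c u₁ (f []) ⟩
  2 ^ k * c * u₁ * f []            ≤⟨ *-monoˡ-≤ (f []) (ratio-split k rel null) ⟩
  (2 ^ suc k * c * u₂ + u₃) * f [] ≡⟨ r₂ (2 ^ suc k) c u₂ u₃ (f []) ⟩
  2 ^ suc k * (c * 1) * (u₂ * f []) + u₃ * f [] ∎
  where
  open ≤-Reasoning
  r₁ : ∀ x c u g → x * (c * 1) * (u * g) ≡ x * c * u * g
  r₁ = solve-∀
  r₂ : ∀ x c u v g → (x * c * u + v) * g ≡ x * (c * 1) * (u * g) + v * g
  r₂ = solve-∀
W-ratio k (suc n) {a₁} {b₁} {a₂} {b₂} {a₃} {b₃} {D} ra rb na nb f {u₁} {u₂} {u₃} {c} rel null = begin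
  2 ^ k * (c * (D zero * Π)) * (u₁ * (a₁ zero * W₁ true + b₁ zero * W₁ false))
    ≡⟨ r₁ (2 ^ k) c (D zero) Π u₁ (a₁ zero) (b₁ zero) _ _ ⟩
  2 ^ k * (c * D zero * Π) * (u₁ * a₁ zero * W₁ true) + 2 ^ k * (c * D zero * Π) * (u₁ * b₁ zero * W₁ false)
    ≤⟨ +-mono-≤
         (W-ratio k n {a₃ = a₃ ∘ suc} {b₃ ∘ suc} (ra ∘ suc) (rb ∘ suc) (na ∘ suc) (nb ∘ suc) (f ∘ (true ∷_))
            {u₃ = u₃ * a₃ zero} (mix {a₁ zero} {a₂ zero} {a₃ zero} (ra zero)) (nul (na zero)))
         (W-ratio k n {a₃ = a₃ ∘ suc} {b₃ ∘ suc} (ra ∘ suc) (rb ∘ suc) (na ∘ suc) (nb ∘ suc) (f ∘ (false ∷_))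
            {u₃ = u₃ * b₃ zero} (mix {b₁ zero} {b₂ zero} {b₃ zero} (rb zero)) (nul (nb zero))) ⟩
  (2 ^ suc k * (c * D zero * Π) * (u₂ * a₂ zero * W₂ true) + u₃ * a₃ zero * W₃ true)
    + (2 ^ suc k * (c * D zero * Π) * (u₂ * b₂ zero * W₂ false) + u₃ * b₃ zero * W₃ false)
    ≡⟨ r₂ (2 ^ suc k) c (D zero) Π u₂ (a₂ zero) (b₂ zero) _ _ u₃ (a₃ zero) (b₃ zero) _ _ ⟩
  2 ^ suc k * (c * (D zero * Π)) * (u₂ * (a₂ zero * W₂ true + b₂ zero * W₂ false))
    + u₃ * (a₃ zero * W₃ true + b₃ zero * W₃ false) ∎
  where
  open ≤-Reasoning
  Π = ∏ n (D ∘ suc)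
  W₁ W₂ W₃ : Bool → ℕ
  W₁ x = W n (a₁ ∘ suc) (b₁ ∘ suc) (f ∘ (x ∷_))
  W₂ x = W n (a₂ ∘ suc) (b₂ ∘ suc) (f ∘ (x ∷_))
  W₃ x = W n (a₃ ∘ suc) (b₃ ∘ suc) (f ∘ (x ∷_))
  r₁ : ∀ x c d p u a b y z →
       x * (c * (d * p)) * (u * (a * y + b * z)) ≡ x * (c * d * p) * (u * a * y) + x * (c * d * p) * (u * b * z)
  r₁ = solve-∀
  r₂ : ∀ x c d p u a b y z v a' b' y' z' →
       (x * (c * d * p) * (u * a * y) + v * a' * y') + (x * (c * d * p) * (u * b * z) + v * b' * z')
         ≡ x * (c * (d * p)) * (u * (a * y + b * z)) + v * (a' * y' + b' * z')
  r₂ = solve-∀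
  mix : ∀ {x₁ x₂ x₃ d} → x₃ * x₂ ^ k ≡ x₁ ^ suc k * d →
        u₃ * x₃ * (u₂ * x₂) ^ k ≡ (u₁ * x₁) ^ suc k * (c * d)
  mix {x₁} {x₂} {x₃} {d} e = ≡-begin
    where
    ≡-begin : u₃ * x₃ * (u₂ * x₂) ^ k ≡ (u₁ * x₁) ^ suc k * (c * d)
    ≡-begin = trans (cong (u₃ * x₃ *_) (power-* u₂ x₂ k))
      (trans (*-swap-middle u₃ x₃ (u₂ ^ k) (x₂ ^ k))
      (trans (cong₂ _*_ rel e)
      (trans (*-swap-middle (u₁ ^ suc k) c (x₁ ^ suc k) d)
             (cong (_* (c * d)) (sym (power-* u₁ x₁ (suc k)))))))
  nul : ∀ {x₁ x₂} → (x₂ ≡ 0 → x₁ ≡ 0) → u₂ * x₂ ≡ 0 → u₁ * x₁ ≡ 0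
  nul {x₁} {x₂} h eq with m*n≡0⇒m≡0∨n≡0 u₂ eq
  ... | inj₁ p = cong (_* x₁) (null p)
  ... | inj₂ p = trans (cong (u₁ *_) (h p)) (*-zeroʳ u₁)

-- (1 + d/P) ^ j ≤ 1 + j d/P + (j d/P) ^ 2, valid while j d ≤ P.
expand-up : ∀ P d j → j * d ≤ P → (P + d) ^ j * (P * P) ≤ P ^ j * (P * P + j * d * P + j * d * (j * d))
expand-up P d zero    le = ≤-reflexive (r P)
  where
  r : ∀ P → 1 * (P * P) ≡ 1 * (P * P + 0 + 0)
  r = solve-∀
expand-up P d (suc j) le = begin
  (P + d) * (P + d) ^ j * (P * P)
    ≡⟨ *-assoc (P + d) _ _ ⟩
  (P + d) * ((P + d) ^ j * (P * P))
    ≤⟨ *-monoʳ-≤ (P + d) (expand-up P d j jd≤P) ⟩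
  (P + d) * (P ^ j * (P * P + x * P + x * x))
    ≡⟨ r₁ P d x (P ^ j) ⟩
  P ^ j * (P * (P * P + (d + x) * P + (d * x + x * x)) + d * x * x)
    ≤⟨ *-monoʳ-≤ (P ^ j) (+-monoʳ-≤ (P * (P * P + (d + x) * P + (d * x + x * x))) (*-monoʳ-≤ (d * x) jd≤P)) ⟩
  P ^ j * (P * (P * P + (d + x) * P + (d * x + x * x)) + d * x * P)
    ≤⟨ *-monoʳ-≤ (P ^ j) (m≤m+n _ (P * (d * d))) ⟩
  P ^ j * (P * (P * P + (d + x) * P + (d * x + x * x)) + d * x * P + P * (d * d))
    ≡⟨ r₂ P d x (P ^ j) ⟩
  P * P ^ j * (P * P + (d + x) * P + (d + x) * (d + x)) ∎
  where
  open ≤-Reasoning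
  x = j * d
  jd≤P : x ≤ P
  jd≤P = ≤-trans (m≤n+m x d) le
  r₁ : ∀ P d x p → (P + d) * (p * (P * P + x * P + x * x))
       ≡ p * (P * (P * P + (d + x) * P + (d * x + x * x)) + d * x * x)
  r₁ = solve-∀
  r₂ : ∀ P d x p → p * (P * (P * P + (d + x) * P + (d * x + x * x)) + d * x * P + P * (d * d))
       ≡ P * p * (P * P + (d + x) * P + (d + x) * (d + x))
  r₂ = solve-∀

-- (1 - d/Q) ^ j ≤ 1 - j d/Q + (j d/Q) ^ 2, where Q = R + d.
expand-down : ∀ R d j → let Q = R + d in
  R ^ j * (Q * Q) + j * d * Q * Q ^ j ≤ Q ^ j * (Q * Q + j * d * (j * d))
expand-down R d zero    = ≤-reflexive (r (R + d))
  where
  r : ∀ Q → 1 * (Q * Q) + 0 ≡ 1 * (Q * Q + 0)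
  r = solve-∀
expand-down R d (suc j) = begin
  R * R ^ j * (Q * Q) + (d + x) * Q * (Q * Q ^ j)
    ≡⟨ r₁ R d x (R ^ j) (Q ^ j) ⟩
  R * (R ^ j * (Q * Q) + x * Q * Q ^ j) + (d * Q * Q + d * x * Q) * Q ^ j
    ≤⟨ +-monoˡ-≤ _ (*-monoʳ-≤ R (expand-down R d j)) ⟩
  R * (Q ^ j * (Q * Q + x * x)) + (d * Q * Q + d * x * Q) * Q ^ j
    ≤⟨ m≤m+n _ (Q ^ j * (d * x * x + Q * (d * x + d * d))) ⟩
  R * (Q ^ j * (Q * Q + x * x)) + (d * Q * Q + d * x * Q) * Q ^ j + Q ^ j * (d * x * x + Q * (d * x + d * d))
    ≡⟨ r₂ R d x (Q ^ j) ⟩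
  Q * Q ^ j * (Q * Q + (d + x) * (d + x)) ∎
  where
  open ≤-Reasoning
  Q = R + d
  x = j * d
  r₁ : ∀ R d x r q → R * r * ((R + d) * (R + d)) + (d + x) * (R + d) * ((R + d) * q)
       ≡ R * (r * ((R + d) * (R + d)) + x * (R + d) * q) + (d * (R + d) * (R + d) + d * x * (R + d)) * q
  r₁ = solve-∀
  r₂ : ∀ R d x q → let Q = R + d in
       R * (q * (Q * Q + x * x)) + (d * Q * Q + d * x * Q) * q + q * (d * x * x + Q * (d * x + d * d))
       ≡ Q * q * (Q * Q + (d + x) * (d + x))
  r₂ = solve-∀

-- The first-order terms of the two expansions cancel, since P + Q = N.
coordinate-moment : ∀ k {P d R M} → 1 ≤ P → 1 ≤ R + d → suc k * d ≤ P →
  M * (suc k * d * (suc k * d)) ≤ P * (R + d) →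
  M * ((P + d) ^ suc k * (R + d) ^ k + R ^ suc k * P ^ k) ≤ (P * (R + d)) ^ k * (P + (R + d)) * suc M
coordinate-moment k {P} {d} {R} {M} P>0 Q>0 small win = cancelˡ _ _ (*-mono-≤ (*-mono-≤ P>0 P>0) (*-mono-≤ Q>0 Q>0)) (+-cancelʳ-≤ (M * extra) _ _ (begin
  P * P * (Q * Q) * (M * (A * q + B * p)) + M * extra
    ≡⟨ r₁ M P Q A q B p x ⟩
  M * (q * (Q * Q) * (A * (P * P)) + p * (P * P) * (B * (Q * Q) + x * Q * (Q * q)))
    ≤⟨ *-monoʳ-≤ M (+-mono-≤ (*-monoʳ-≤ (q * (Q * Q)) (expand-up P d (suc k) small))
                             (*-monoʳ-≤ (p * (P * P)) (expand-down R d (suc k)))) ⟩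
  M * (q * (Q * Q) * (P * p * (P * P + x * P + x * x)) + p * (P * P) * (Q * q * (Q * Q + x * x)))
    ≡⟨ r₂ M P Q p q x ⟩
  p * q * (P * Q) * (P + Q) * (M * (P * Q) + M * (x * x)) + M * extra
    ≤⟨ +-monoˡ-≤ (M * extra) (*-monoʳ-≤ (p * q * (P * Q) * (P + Q)) (+-monoʳ-≤ (M * (P * Q)) win)) ⟩
  p * q * (P * Q) * (P + Q) * (M * (P * Q) + P * Q) + M * extra
    ≡⟨ cong (_+ M * extra) (trans (r₃ M P Q (p * q)) (cong (λ t → P * P * (Q * Q) * (t * (P + Q) * suc M)) (sym (power-* P Q k)))) ⟩
  P * P * (Q * Q) * ((P * Q) ^ k * (P + Q) * suc M) + M * extra ∎))
  where
  open ≤-Reasoning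
  Q = R + d
  x = suc k * d
  A = (P + d) ^ suc k
  B = R ^ suc k
  q = Q ^ k
  p = P ^ k
  extra = p * (P * P) * (x * Q * (Q * q))
  r₁ : ∀ M P Q A q B p x → P * P * (Q * Q) * (M * (A * q + B * p)) + M * (p * (P * P) * (x * Q * (Q * q)))
       ≡ M * (q * (Q * Q) * (A * (P * P)) + p * (P * P) * (B * (Q * Q) + x * Q * (Q * q)))
  r₁ = solve-∀
  r₂ : ∀ M P Q p q x → M * (q * (Q * Q) * (P * p * (P * P + x * P + x * x)) + p * (P * P) * (Q * q * (Q * Q + x * x)))
       ≡ p * q * (P * Q) * (P + Q) * (M * (P * Q) + M * (x * x)) + M * (p * (P * P) * (x * Q * (Q * q)))
  r₂ = solve-∀
  r₃ : ∀ M P Q t → t * (P * Q) * (P + Q) * (M * (P * Q) + P * Q) ≡ P * P * (Q * Q) * (t * (P + Q) * suc M)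
  r₃ = solve-∀

-- This is (1 + 1/M)^c (1 - c/M) ≤ 1. The induction step rests on (M + 1)(M - c - 1) ≤ M (M - c).
sucM^ : ∀ M c → c ≤ M → suc M ^ c * (M ∸ c) ≤ M ^ c * M
sucM^ M zero    le = ≤-refl
sucM^ M (suc c) le = begin
  suc M * suc M ^ c * (M ∸ suc c)        ≡⟨ r₁ (suc M) (suc M ^ c) (M ∸ suc c) ⟩
  suc M ^ c * (suc M * (M ∸ suc c))      ≤⟨ *-monoʳ-≤ (suc M ^ c) base ⟩
  suc M ^ c * (M * (M ∸ c))              ≡⟨ r₂ (suc M ^ c) M (M ∸ c) ⟩
  M * (suc M ^ c * (M ∸ c))              ≤⟨ *-monoʳ-≤ M (sucM^ M c (<⇒≤ le)) ⟩
  M * (M ^ c * M)                        ≡⟨ sym (*-assoc M (M ^ c) M) ⟩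
  M * M ^ c * M ∎
  where
  open ≤-Reasoning
  r₁ : ∀ a b c → a * b * c ≡ b * (a * c)
  r₁ = solve-∀
  r₂ : ∀ a b c → a * (b * c) ≡ b * (a * c)
  r₂ = solve-∀
  base : suc M * (M ∸ suc c) ≤ M * (M ∸ c)
  base = begin
    suc M * (M ∸ suc c)          ≤⟨ +-monoˡ-≤ (M * (M ∸ suc c)) (m∸n≤m M (suc c)) ⟩
    M + M * (M ∸ suc c)          ≡⟨ sym (*-suc M _) ⟩
    M * suc (M ∸ suc c)          ≡⟨ cong (M *_) (sym (+-∸-assoc 1 le)) ⟩
    M * (M ∸ c) ∎

-- For c ≤ M/2 the factor 1 - c/M in `sucM^` is at least 1/2. This caps a product of at most M/2
-- coordinate moments 1 + 1/M by 2.
sucM^≤2M^ : ∀ M c → 1 ≤ M → 2 * c ≤ M → suc M ^ c ≤ 2 * M ^ c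
sucM^≤2M^ M c M>0 le = cancelˡ _ _ M>0 (begin
  M * suc M ^ c                 ≤⟨ *-monoˡ-≤ (suc M ^ c) half ⟩
  2 * (M ∸ c) * suc M ^ c       ≡⟨ r₁ (M ∸ c) (suc M ^ c) ⟩
  2 * (suc M ^ c * (M ∸ c))     ≤⟨ *-monoʳ-≤ 2 (sucM^ M c (≤-trans (m≤m+n c _) le)) ⟩
  2 * (M ^ c * M)               ≡⟨ r₂ M (M ^ c) ⟩
  M * (2 * M ^ c) ∎)
  where
  open ≤-Reasoning
  half : M ≤ 2 * (M ∸ c)
  half = begin
    M                    ≡⟨ sym (m+n∸n≡m M (2 * c)) ⟩
    M + 2 * c ∸ 2 * c    ≤⟨ ∸-monoˡ-≤ (2 * c) (+-monoʳ-≤ M le) ⟩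
    M + M ∸ 2 * c        ≡⟨ cong (_∸ 2 * c) (cong (M +_) (sym (+-identityʳ M))) ⟩
    2 * M ∸ 2 * c        ≡⟨ sym (*-distribˡ-∸ 2 M c) ⟩
    2 * (M ∸ c) ∎
  r₁ : ∀ x y → 2 * x * y ≡ 2 * (y * x)
  r₁ = solve-∀
  r₂ : ∀ x y → 2 * (y * x) ≡ x * (2 * y)
  r₂ = solve-∀

∏-if : ∀ {n} (A : Subset n) m → ∏ n (λ e → if lookup A e then m else 1) ≡ m ^ size A
∏-if []          m = refl
∏-if (true ∷ A)  m = cong (m *_) (∏-if A m)
∏-if (false ∷ A) m = trans (+-identityʳ _) (∏-if A m)

-- Raising the density from P / N to (P + d) / N on the small set A at most doubles the probability
-- of any event, up to an error of 2 ^ -k; the moment of order k + 1 of the likelihood ratio is at most 2.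
module _ (k : ℕ) {n N P d M : ℕ} (A : Subset n) {t₁ t₂ : Fin n → ℕ}
  (P>0 : 1 ≤ P) (P+d≤N : P + d ≤ N) (P<N : P < N) (small : suc k * d ≤ P)
  (M>0 : 1 ≤ M) (A≤M : 2 * size A ≤ M) (window : M * (suc k * d * (suc k * d)) ≤ P * (N ∸ P))
  (raise : ∀ e → (t₁ e ≡ t₂ e) ⊎ (lookup A e ≡ true × t₁ e ≡ P + d × t₂ e ≡ P))
  (t≤N : ∀ e → t₁ e ≤ N) where

  private
    R Q : ℕ
    R = N ∸ (P + d)
    Q = N ∸ P

    R+d≡Q : R + d ≡ Q
    R+d≡Q = trans (cong (_+ d) (sym (∸-+-assoc N P d))) (m∸n+n≡m (m+n≤o⇒n≤o∸m P P+d≤N))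
      where
      m+n≤o⇒n≤o∸m : ∀ m {n o} → m + n ≤ o → n ≤ o ∸ m
      m+n≤o⇒n≤o∸m m {n} le = subst (_≤ _) (m+n∸m≡n m n) (∸-monoˡ-≤ m le)

    P+Q≡N : P + Q ≡ N
    P+Q≡N = m+[n∸m]≡n (<⇒≤ P<N)

    Q>0 : 1 ≤ Q
    Q>0 = m<n⇒0<n∸m P<N

    pickBy : ∀ {X Y : Set} → X ⊎ Y → ℕ → ℕ → ℕ
    pickBy (inj₁ _) a b = a
    pickBy (inj₂ _) a b = b

    -- On a raised coordinate the likelihood ratio is (P + d)/P if the element is drawn and R/Q if
    -- not. `a₃` and `b₃` are the first weights times the k-th power of this ratio, and `D` = (P
    -- Q)^k clears the denominators. Where the two measures agree the weights stay as they are.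
    a₃ b₃ D : Fin n → ℕ
    a₃ e = pickBy (raise e) (t₁ e) ((P + d) ^ suc k * Q ^ k)
    b₃ e = pickBy (raise e) (N ∸ t₁ e) (R ^ suc k * P ^ k)
    D e = pickBy (raise e) 1 ((P * Q) ^ k)

    D>0 : ∀ e → 1 ≤ D e
    D>0 e with raise e
    ... | inj₁ _ = ≤-refl
    ... | inj₂ _ = pow-pos k (*-mono-≤ P>0 Q>0)

    a-rel : ∀ e → a₃ e * t₂ e ^ k ≡ t₁ e ^ suc k * D e
    a-rel e with raise e
    ... | inj₁ p           = trans (cong (λ t → t₁ e * t ^ k) (sym p)) (sym (*-identityʳ _))
    ... | inj₂ (_ , p , q) rewrite p | q =
      trans (*-assoc ((P + d) ^ suc k) (Q ^ k) (P ^ k))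
            (cong ((P + d) ^ suc k *_) (trans (*-comm (Q ^ k) (P ^ k)) (sym (power-* P Q k))))

    b-rel : ∀ e → b₃ e * (N ∸ t₂ e) ^ k ≡ (N ∸ t₁ e) ^ suc k * D e
    b-rel e with raise e
    ... | inj₁ p           = trans (cong (λ t → (N ∸ t₁ e) * (N ∸ t) ^ k) (sym p)) (sym (*-identityʳ _))
    ... | inj₂ (_ , p , q) rewrite p | q =
      trans (*-assoc (R ^ suc k) (P ^ k) (Q ^ k)) (cong (R ^ suc k *_) (sym (power-* P Q k)))

    a-null : ∀ e → t₂ e ≡ 0 → t₁ e ≡ 0
    a-null e z with raise e
    ... | inj₁ p           = trans p z
    ... | inj₂ (_ , _ , q) = ⊥-elim (<-irrefl (sym (trans (sym q) z)) P>0)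

    b-null : ∀ e → N ∸ t₂ e ≡ 0 → N ∸ t₁ e ≡ 0
    b-null e z with raise e
    ... | inj₁ p           = trans (cong (N ∸_) p) z
    ... | inj₂ (_ , _ , q) = ⊥-elim (<-irrefl (sym (trans (cong (N ∸_) (sym q)) z)) Q>0)

    m m' : Fin n → ℕ
    m  e = if lookup A e then M else 1
    m' e = if lookup A e then suc M else 1

    moment : ∀ e → m e * (a₃ e + b₃ e) ≤ D e * N * m' e
    moment e with raise e
    ... | inj₂ (a , _ , _) rewrite a =
      subst (λ q → M * ((P + d) ^ suc k * q ^ k + R ^ suc k * P ^ k) ≤ (P * q) ^ k * N * suc M) R+d≡Q
      (subst (λ z → M * ((P + d) ^ suc k * (R + d) ^ k + R ^ suc k * P ^ k) ≤ (P * (R + d)) ^ k * z * suc M)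
         (trans (cong (P +_) R+d≡Q) P+Q≡N)
         (coordinate-moment k {P} {d} {R} {M} P>0 (subst (1 ≤_) (sym R+d≡Q) Q>0) small
            (subst (λ q → M * (suc k * d * (suc k * d)) ≤ P * q) (sym R+d≡Q) window)))
    ... | inj₁ _ with lookup A e
    ... | true  = ≤-trans (≤-reflexive (cong (M *_) (m+[n∸m]≡n (t≤N e))))
                          (≤-trans (*-monoˡ-≤ N (n≤1+n M)) (≤-reflexive (r (suc M) N)))
      where
      r : ∀ x y → x * y ≡ 1 * y * x
      r = solve-∀
    ... | false = ≤-reflexive (trans (cong (1 *_) (m+[n∸m]≡n (t≤N e))) (r N))
      where
      r : ∀ y → 1 * y ≡ 1 * y * 1
      r = solve-∀

    -- The tilted measure has as total mass the moment of order k + 1 of the likelihood ratio. Each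
    -- element of A contributes a factor at most 1 + 1/M, and there are at most M/2 of them; the
    -- factor `M ^ size A` keeps the computation in integers.
    certificate-total : W n a₃ b₃ (λ _ → 1) ≤ ∏ n D * N ^ n * 2
    certificate-total = cancelˡ _ _ (pow-pos (size A) M>0) (begin
      M ^ size A * W n a₃ b₃ (λ _ → 1)
        ≡⟨ cong₂ _*_ (sym (∏-if A M)) (W-one n a₃ b₃) ⟩
      ∏ n m * ∏ n (λ e → a₃ e + b₃ e)
        ≡⟨ sym (∏-* n m _) ⟩
      ∏ n (λ e → m e * (a₃ e + b₃ e))
        ≤⟨ ∏-mono n moment ⟩
      ∏ n (λ e → D e * N * m' e)
        ≡⟨ trans (∏-* n _ m') (cong₂ _*_ (∏-* n D _) (∏-if A (suc M))) ⟩
      ∏ n D * ∏ n (λ _ → N) * suc M ^ size A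
        ≡⟨ cong (λ z → ∏ n D * z * suc M ^ size A) (∏-const n N) ⟩
      ∏ n D * N ^ n * suc M ^ size A
        ≤⟨ *-monoʳ-≤ (∏ n D * N ^ n) (sucM^≤2M^ M (size A) M>0 A≤M) ⟩
      ∏ n D * N ^ n * (2 * M ^ size A)
        ≡⟨ r (∏ n D * N ^ n) (M ^ size A) ⟩
      M ^ size A * (∏ n D * N ^ n * 2) ∎)
      where
      open ≤-Reasoning
      r : ∀ x y → x * (2 * y) ≡ y * (x * 2)
      r = solve-∀

  Wt-raise : ∀ f → (∀ S → f S ≤ 1) → 2 ^ k * Wt N t₁ f ≤ 2 ^ suc k * Wt N t₂ f + 2 * N ^ n
  Wt-raise f f≤1 = cancelˡ _ _ (∏-pos n D>0) (begin
    Π * (2 ^ k * Wt N t₁ f)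
      ≡⟨ r₁ Π (2 ^ k) (Wt N t₁ f) ⟩
    2 ^ k * (1 * Π) * (1 * Wt N t₁ f)
      ≤⟨ W-ratio k n {a₃ = a₃} {b₃} {D} a-rel b-rel a-null b-null f {1} {1} {1} {1} (sym (*-identityʳ _)) (λ ()) ⟩
    2 ^ suc k * (1 * Π) * (1 * Wt N t₂ f) + 1 * W n a₃ b₃ f
      ≤⟨ +-monoʳ-≤ (2 ^ suc k * (1 * Π) * (1 * Wt N t₂ f)) (*-monoʳ-≤ 1 (≤-trans (W-mono n f≤1) certificate-total)) ⟩
    2 ^ suc k * (1 * Π) * (1 * Wt N t₂ f) + 1 * (Π * N ^ n * 2)
      ≡⟨ r₂ Π (2 ^ suc k) (Wt N t₂ f) (N ^ n) ⟩
    Π * (2 ^ suc k * Wt N t₂ f + 2 * N ^ n) ∎)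
    where
    open ≤-Reasoning
    Π = ∏ n D
    r₁ : ∀ p x w → p * (x * w) ≡ x * (1 * p) * (1 * w)
    r₁ = solve-∀
    r₂ : ∀ p x w z → x * (1 * p) * (1 * w) + 1 * (p * z * 2) ≡ p * (x * w + 2 * z)
    r₂ = solve-∀

-- Layers

-- Bernoulli's inequality (1 - p/N)^c ≥ 1 - c p/N, multiplied by N^(c+1).
bernoulli : ∀ N p c → p ≤ N → N * N ^ c ≤ N * (N ∸ p) ^ c + c * p * N ^ c
bernoulli N p zero    le = m≤m+n _ _
bernoulli N p (suc c) le = begin
  N * (N * N ^ c)
    ≤⟨ *-monoʳ-≤ N (bernoulli N p c le) ⟩
  N * (N * R ^ c + c * p * N ^ c)
    ≡⟨ r₁ N (R ^ c) (c * p) (N ^ c) ⟩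
  N * R ^ c * N + c * p * (N * N ^ c)
    ≡⟨ cong (λ z → N * R ^ c * z + c * p * (N * N ^ c)) (sym (m∸n+n≡m le)) ⟩
  N * R ^ c * (R + p) + c * p * (N * N ^ c)
    ≡⟨ r₂ N R p (R ^ c) (c * p * (N * N ^ c)) ⟩
  N * (R * R ^ c) + p * (N * R ^ c) + c * p * (N * N ^ c)
    ≤⟨ +-monoˡ-≤ _ (+-monoʳ-≤ (N * (R * R ^ c)) (*-monoʳ-≤ p (*-monoʳ-≤ N (^-monoˡ-≤ c (m∸n≤m N p))))) ⟩
  N * (R * R ^ c) + p * (N * N ^ c) + c * p * (N * N ^ c)
    ≡⟨ r₃ (N * (R * R ^ c)) p (c * p) (N * N ^ c) ⟩
  N * (R * R ^ c) + (p + c * p) * (N * N ^ c) ∎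
  where
  open ≤-Reasoning
  R = N ∸ p
  r₁ : ∀ N r x n → N * (N * r + x * n) ≡ N * r * N + x * (N * n)
  r₁ = solve-∀
  r₂ : ∀ N R p r z → N * r * (R + p) + z ≡ N * (R * r) + p * (N * r) + z
  r₂ = solve-∀
  r₃ : ∀ a p x n → a + p * n + x * n ≡ a + (p + x) * n
  r₃ = solve-∀

bernoulli-half : ∀ N p c → 1 ≤ N → p ≤ N → 2 * (c * p) ≤ N → N ^ c ≤ 2 * (N ∸ p) ^ c
bernoulli-half N p c N>0 p≤N half = cancelˡ _ _ N>0 (+-cancelʳ-≤ (N * N ^ c) _ _ (begin
  N * N ^ c + N * N ^ c
    ≤⟨ +-mono-≤ (bernoulli N p c p≤N) (bernoulli N p c p≤N) ⟩
  (N * R + c * p * N ^ c) + (N * R + c * p * N ^ c)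
    ≡⟨ r N R (c * p) (N ^ c) ⟩
  N * (2 * R) + 2 * (c * p) * N ^ c
    ≤⟨ +-monoʳ-≤ (N * (2 * R)) (*-monoˡ-≤ (N ^ c) half) ⟩
  N * (2 * R) + N * N ^ c ∎))
  where
  open ≤-Reasoning
  R = (N ∸ p) ^ c
  r : ∀ N R x n → (N * R + x * n) + (N * R + x * n) ≡ N * (2 * R) + 2 * x * n
  r = solve-∀

omit-rel : ∀ {n} (R : ℕ → ℕ → Set) {t₁ t₂ : Fin n → ℕ} i e → R 0 0 → R (t₁ e) (t₂ e) →
           R (omit i t₁ e) (omit i t₂ e)
omit-rel R zero    zero    r₀ r = r₀
omit-rel R zero    (suc e) r₀ r = r
omit-rel R (suc i) zero    r₀ r = r
omit-rel R (suc i) (suc e) r₀ r = omit-rel R i e r₀ r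

hybrid-≤ : ∀ {n N} {lo hi : Fin n → ℕ} k → (∀ e → lo e ≤ N) → (∀ e → hi e ≤ N) → ∀ e → hybrid k lo hi e ≤ N
hybrid-≤ k l h e with toℕ e <ᵇ k
... | true  = h e
... | false = l e

on-≤ : ∀ {n N} (U : Subset n) {t : Fin n → ℕ} → (∀ e → t e ≤ N) → ∀ e → on U t e ≤ N
on-≤ U le e with lookup U e
... | true  = le e
... | false = z≤n

Wt-0 : ∀ {n N} {t : Fin n → ℕ} (f : Subset n → ℕ) → (∀ e → t e ≡ 0) → f (Vec.replicate n false) ≡ 0 → Wt N t f ≡ 0
Wt-0 {zero}  f z f0 = f0
Wt-0 {suc n} {N} {t} f z f0 = cong₂ (λ x y → x * Wt N (t ∘ suc) (f ∘ (true ∷_)) + y) (z zero)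
  (trans (cong ((N ∸ t zero) *_) (Wt-0 (f ∘ (false ∷_)) (z ∘ suc) f0)) (*-zeroʳ (N ∸ t zero)))

_∖_ : ∀ {n} → Subset n → Subset n → Subset n
U ∖ V = tabulate (λ e → lookup U e ∧ not (lookup V e))

lookup-∖ : ∀ {n} (U V : Subset n) e → lookup (U ∖ V) e ≡ lookup U e ∧ not (lookup V e)
lookup-∖ U V e = lookup∘tabulate _ e

const : ∀ {n} → ℕ → Fin n → ℕ
const P _ = P

true≢false : ∀ {b} → b ≡ true → b ≡ false → ∀ {X : Set} → X
true≢false refl ()

-- The thresholds in force when e gets its turn: earlier elements of U are already at `P'`, later
-- ones still at P, and e itself is undecided. The resulting law does not involve the coordinate e.
chain : ∀ {n} → ℕ → ℕ → Subset n → Fin n → Fin n → ℕ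
chain P P' U e = omit e (hybrid (toℕ e) (on U (const P)) (on U (const P')))

chain-≤ : ∀ {n N P P'} → P ≤ N → P' ≤ N → ∀ (U : Subset n) e i → chain P P' U e i ≤ N
chain-≤ P≤N P'≤N U e i = ≤-trans (omit-≤ e _ i)
  (hybrid-≤ (toℕ e) (on-≤ U (λ _ → P≤N)) (on-≤ U (λ _ → P'≤N)) i)

-- dep is an arbitrary monotone property of subsets; it will be dependence over a contracted set.
module Layer {n : ℕ} (dep : Subset n → Bool)
             (dep-mono : ∀ {S T} → S ⊑ T → dep S ≡ true → dep T ≡ true) where

  δ : Subset n → ℕ
  δ S = 𝟙 (dep S)

  spans : Fin n → Subset n → Bool
  spans e S = not (dep S) ∧ dep (S [ e ]≔ true)

  spanProb : ℕ → ℕ → ℕ → Subset n → Fin n → ℕ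
  spanProb N P P' U e = Wt N (chain P P' U e) (λ S → 𝟙 (spans e S))

  δ-mono : ∀ {S T} → S ⊑ T → δ S ≤ δ T
  δ-mono {S} {T} le with dep S in eq
  ... | false = z≤n
  ... | true rewrite dep-mono {S} {T} le eq = ≤-refl

  δ-step : ∀ e S → lookup S e ≡ false → δ (S [ e ]≔ true) ≤ δ S + 𝟙 (spans e S)
  δ-step e S _ with dep S
  ... | true  = ≤-trans (𝟙≤1 _) (m≤m+n 1 _)
  ... | false = ≤-refl

  risk : ℕ → ℕ → Subset n → ℕ
  risk N P U = Wt N (on U (const P)) δ

  risk-mono : ∀ {N P U V} → P ≤ N → U ⊑ V → risk N P U ≤ risk N P V
  risk-mono {N} {P} {U} {V} P≤N le = Wt-mono-t δ-mono below (on-≤ V (λ _ → P≤N))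
    where
    below : ∀ e → on U (const P) e ≤ on V (const P) e
    below e with lookup U e in eq
    ... | false = z≤n
    ... | true rewrite le e eq = ≤-refl

  module _ (k : ℕ) {N P d : ℕ} (U U' : Subset n) (U'⊑U : U' ⊑ U) (P+d≤N : P + d ≤ N) where

    private
      P' = P + d
      Z = N ^ n
      P≤N : P ≤ N
      P≤N = m+n≤o⇒m≤o P P+d≤N

      total : ℕ
      total = ∑ᶠ n (λ e → 𝟙 (lookup U' e) * spanProb N P P' U e)

    -- Divided by 2^k N Z, with g the probability of dependence, this reads g(P', U') + g(P, U') ≤ 2
    -- g(P, U) + error. The error consists of 2/2^k, the tail of the likelihood ratio, and of d/N
    -- times twice the spanning probability (plus again 2/2^k) for each inserted element.
    LayerBound : Set
    LayerBound = 2 ^ k * (N * (risk N P' U' + risk N P U'))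
      ≤ 2 ^ suc k * (N * risk N P U) + (2 * N * Z + d * (2 ^ suc k * total + 2 * n * Z))

    module _ {M : ℕ} (P>0 : 1 ≤ P) (P<N : P < N) (small : suc k * d ≤ P)
             (M>0 : 1 ≤ M) (A≤M : 2 * size (U ∖ U') ≤ M)
             (window : M * (suc k * d * (suc k * d)) ≤ P * (N ∸ P)) where

      private
        A = U ∖ U'

        -- A is already at the higher density, U' still at the lower one
        mixed : Fin n → ℕ
        mixed e = if lookup U' e then P else on A (const P') e

        Raised : ℕ → ℕ → Bool → Set
        Raised t₁ t₂ b = (t₁ ≡ t₂) ⊎ (b ≡ true × t₁ ≡ P' × t₂ ≡ P)

        mixed-raised : ∀ e → Raised (mixed e) (on U (const P) e) (lookup A e)
        mixed-raised e rewrite lookup-∖ U U' e with lookup U' e in u'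
        ... | true rewrite U'⊑U e u' = inj₁ refl
        ... | false with lookup U e
        ...   | true  = inj₂ (refl , refl , refl)
        ...   | false = inj₁ refl

        mixed≤P' : ∀ e → mixed e ≤ P'
        mixed≤P' e with lookup U' e
        ... | true  = m≤m+n P d
        ... | false = on-≤ A (λ _ → ≤-refl) e

        mixed≤hi : ∀ e → mixed e ≤ on U (const P') e
        mixed≤hi e rewrite lookup-∖ U U' e with lookup U' e in u'
        ... | true rewrite U'⊑U e u' = m≤m+n P d
        ... | false with lookup U e
        ...   | true  = ≤-refl
        ...   | false = ≤-refl

        gap : ∀ e → on U (const P') e ∸ mixed e ≡ 𝟙 (lookup U' e) * d
        gap e rewrite lookup-∖ U U' e with lookup U' e in u'
        ... | true rewrite U'⊑U e u' = trans (m+n∸m≡n P d) (sym (+-identityʳ d))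
        ... | false with lookup U e
        ...   | true  = n∸n≡0 P'
        ...   | false = refl

        hybrid-raised : ∀ j e → Raised (hybrid j mixed (on U (const P')) e)
                                       (hybrid j (on U (const P)) (on U (const P')) e) (lookup A e)
        hybrid-raised j e with toℕ e <ᵇ j
        ... | true  = inj₁ refl
        ... | false = mixed-raised e

        -- The dependence that needs A. Raising A at most doubles this part and leaves `δ (S ∩ U')`
        -- alone; so g becomes at most g' + 2 (g - g') = 2 g - g', where g' is the risk on U'.
        φ : Subset n → ℕ
        φ S = 𝟙 (dep S ∧ not (dep (S ∩ U')))

        δ-split : ∀ S → δ S ≡ δ (S ∩ U') + φ S
        δ-split S with dep S in s | dep (S ∩ U') in s'
        ... | true  | true  = refl
        ... | true  | false = refl
        ... | false | false = refl
        ... | false | true  = true≢false (dep-mono {S ∩ U'} {S} inter s') s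
          where
          inter : (S ∩ U') ⊑ S
          inter e p rewrite lookup-zipWith _∧_ e S U' with lookup S e
          ... | true = refl

        split : ∀ {t} → (∀ e → t e ≤ N) → (∀ e → lookup U' e ≡ true → t e ≡ P) →
                Wt N t δ ≡ risk N P U' + Wt N t φ
        split {t} t≤N t≡P = trans (W-cong n (λ _ → refl) (λ _ → refl) δ-split)
          (trans (W-+ n t _ (λ S → δ (S ∩ U')) φ) (cong (_+ Wt N t φ)
            (trans (Wt-∩ t≤N U' δ) (Wt-cong-t δ same))))
          where
          same : ∀ e → on U' t e ≡ on U' (const P) e
          same e with lookup U' e in u'
          ... | true  = t≡P e u'
          ... | false = refl

        raise-φ : 2 ^ k * Wt N mixed φ ≤ 2 ^ suc k * Wt N (on U (const P)) φ + 2 * Z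
        raise-φ = Wt-raise k A P>0 P+d≤N P<N small M>0 A≤M window mixed-raised
          (λ e → ≤-trans (mixed≤P' e) P+d≤N) φ (λ S → 𝟙≤1 _)

        first-half : 2 ^ k * (Wt N mixed δ + risk N P U') ≤ 2 ^ suc k * risk N P U + 2 * Z
        first-half = begin
          2 ^ k * (Wt N mixed δ + risk N P U')
            ≡⟨ cong (λ w → 2 ^ k * (w + risk N P U'))
                 (split (λ e → ≤-trans (mixed≤P' e) P+d≤N) (λ e u' → cong (λ b → if b then P else on A (const P') e) u')) ⟩
          2 ^ k * (risk N P U' + Wt N mixed φ + risk N P U')
            ≡⟨ r₁ (2 ^ k) (risk N P U') (Wt N mixed φ) ⟩
          2 ^ suc k * risk N P U' + 2 ^ k * Wt N mixed φ
            ≤⟨ +-monoʳ-≤ (2 ^ suc k * risk N P U') raise-φ ⟩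
          2 ^ suc k * risk N P U' + (2 ^ suc k * Wt N (on U (const P)) φ + 2 * Z)
            ≡⟨ r₂ (2 ^ suc k) (risk N P U') (Wt N (on U (const P)) φ) (2 * Z) ⟩
          2 ^ suc k * (risk N P U' + Wt N (on U (const P)) φ) + 2 * Z
            ≡⟨ cong (λ w → 2 ^ suc k * w + 2 * Z) (sym (split (on-≤ U (λ _ → P≤N))
                 (λ e u' → cong (λ b → if b then P else 0) (U'⊑U e u')))) ⟩
          2 ^ suc k * risk N P U + 2 * Z ∎
          where
          open ≤-Reasoning
          r₁ : ∀ x a b → x * (a + b + a) ≡ 2 * x * a + x * b
          r₁ = solve-∀
          r₂ : ∀ x a b z → x * a + (x * b + z) ≡ x * (a + b) + z
          r₂ = solve-∀

        term : Fin n → ℕ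
        term e = Wt N (omit e (hybrid (toℕ e) mixed (on U (const P')))) (λ S → 𝟙 (spans e S))

        term-bound : ∀ e → 2 ^ k * term e ≤ 2 ^ suc k * spanProb N P P' U e + 2 * Z
        term-bound e = Wt-raise k A P>0 P+d≤N P<N small M>0 A≤M window
          (λ i → omit-rel (λ x y → Raised x y (lookup A i)) {hybrid (toℕ e) mixed (on U (const P'))} e i
                   (inj₁ refl) (hybrid-raised (toℕ e) i))
          (λ i → ≤-trans (omit-≤ e (hybrid (toℕ e) mixed (on U (const P'))) i)
                   (hybrid-≤ (toℕ e) (λ i → ≤-trans (mixed≤P' i) P+d≤N) (on-≤ U (λ _ → P+d≤N)) i))
          (λ S → 𝟙 (spans e S)) (λ S → 𝟙≤1 _)

        sum-bound : 2 ^ k * ∑ᶠ n (λ e → (on U (const P') e ∸ mixed e) * term e) ≤ d * (2 ^ suc k * total + 2 * n * Z)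
        sum-bound = begin
          2 ^ k * ∑ᶠ n (λ e → (on U (const P') e ∸ mixed e) * term e)
            ≡⟨ trans (sym (∑ᶠ-*ˡ n (2 ^ k) _)) (∑ᶠ-cong n (λ e → trans (cong (λ g → 2 ^ k * (g * term e)) (gap e))
                 (r₁ (2 ^ k) (𝟙 (lookup U' e)) d (term e)))) ⟩
          ∑ᶠ n (λ e → d * (𝟙 (lookup U' e) * (2 ^ k * term e)))
            ≤⟨ ∑ᶠ-mono n (λ e → *-monoʳ-≤ d (weaken e)) ⟩
          ∑ᶠ n (λ e → d * (2 ^ suc k * (𝟙 (lookup U' e) * spanProb N P P' U e) + 2 * Z))
            ≡⟨ trans (∑ᶠ-*ˡ n d _) (cong (d *_) (trans (∑ᶠ-+ n _ _)
                 (cong₂ _+_ (∑ᶠ-*ˡ n (2 ^ suc k) _) (trans (∑ᶠ-const n (2 * Z)) (r₂ n Z))))) ⟩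
          d * (2 ^ suc k * total + 2 * n * Z) ∎
          where
          open ≤-Reasoning
          r₁ : ∀ x b d t → x * (b * d * t) ≡ d * (b * (x * t))
          r₁ = solve-∀
          r₂ : ∀ n z → n * (2 * z) ≡ 2 * n * z
          r₂ = solve-∀
          weaken : ∀ e → 𝟙 (lookup U' e) * (2 ^ k * term e)
                   ≤ 2 ^ suc k * (𝟙 (lookup U' e) * spanProb N P P' U e) + 2 * Z
          weaken e with lookup U' e
          ... | false = z≤n
          ... | true  = ≤-trans (≤-reflexive (*-identityˡ (2 ^ k * term e))) (≤-trans (term-bound e)
                          (≤-reflexive (cong (λ w → 2 ^ suc k * w + 2 * Z) (sym (*-identityˡ (spanProb N P P' U e))))))

      layer-raise : LayerBound
      layer-raise = begin
        2 ^ k * (N * (risk N P' U' + risk N P U'))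
          ≤⟨ *-monoʳ-≤ (2 ^ k) (*-monoʳ-≤ N (+-monoˡ-≤ _ (risk-mono {U = U'} {U} P+d≤N U'⊑U))) ⟩
        2 ^ k * (N * (risk N P' U + risk N P U'))
          ≡⟨ cong (2 ^ k *_) (*-distribˡ-+ N (risk N P' U) _) ⟩
        2 ^ k * (N * risk N P' U + N * risk N P U')
          -- A is raised before any element of U' is. Every intermediate law of the telescope then
          -- differs from that of `spanProb` on A only, where `Wt-raise` compares the two.
          ≤⟨ *-monoʳ-≤ (2 ^ k) (+-monoˡ-≤ _ (telescope mixed≤hi (on-≤ U (λ _ → P+d≤N)) δ (λ e S → 𝟙 (spans e S)) δ-step)) ⟩
        2 ^ k * (N * Wt N mixed δ + Σt + N * risk N P U')
          ≡⟨ r (2 ^ k) N (Wt N mixed δ) Σt (risk N P U') ⟩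
        N * (2 ^ k * (Wt N mixed δ + risk N P U')) + 2 ^ k * Σt
          ≤⟨ +-mono-≤ (*-monoʳ-≤ N first-half) sum-bound ⟩
        N * (2 ^ suc k * risk N P U + 2 * Z) + d * (2 ^ suc k * total + 2 * n * Z)
          ≡⟨ r' (2 ^ suc k) N (risk N P U) Z _ ⟩
        2 ^ suc k * (N * risk N P U) + (2 * N * Z + d * (2 ^ suc k * total + 2 * n * Z)) ∎
        where
        open ≤-Reasoning
        Σt = ∑ᶠ n (λ e → (on U (const P') e ∸ mixed e) * term e)
        r : ∀ x N w s g → x * (N * w + s + N * g) ≡ N * (x * (w + g)) + x * s
        r = solve-∀
        r' : ∀ x N g z t → N * (x * g + 2 * z) + t ≡ x * (N * g) + (2 * N * z + t)
        r' = solve-∀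

    module _ (P≡0 : P ≡ 0) (dep-∅ : dep (Vec.replicate n false) ≡ false) (N>0 : 1 ≤ N)
             (A≤N : 2 * (size (U ∖ U') * P') ≤ N) where

      private
        A = U ∖ U'

        on-zero : ∀ V (e : Fin n) → on V (const P) e ≡ 0
        on-zero V e with lookup V e
        ... | true  = P≡0
        ... | false = refl

        risk≡0 : ∀ V → risk N P V ≡ 0
        risk≡0 V = Wt-0 δ (on-zero V) (cong 𝟙 dep-∅)

        lo≤hi : ∀ e → on U' (const P) e ≤ on U' (const P') e
        lo≤hi e = ≤-trans (≤-reflexive (on-zero U' e)) z≤n

        gap : ∀ e → on U' (const P') e ∸ on U' (const P) e ≡ 𝟙 (lookup U' e) * d
        gap e with lookup U' e
        ... | true  = trans (m+n∸m≡n P d) (sym (+-identityʳ d))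
        ... | false = refl

        spanProb-avoid : ∀ e → spanProb N P P' U' e ≤ 2 * spanProb N P P' U e
        spanProb-avoid e = cancelˡ _ _ (pow-pos c N>0) (begin
          N ^ c * w
            ≤⟨ *-monoˡ-≤ w (bernoulli-half N P' c N>0 P+d≤N A≤N) ⟩
          2 * (N ∸ P') ^ c * w
            ≡⟨ *-assoc 2 ((N ∸ P') ^ c) w ⟩
          2 * ((N ∸ P') ^ c * w)
            ≤⟨ *-monoʳ-≤ 2 (Wt-avoid A (chain-≤ P≤N P+d≤N U e) out same _) ⟩
          2 * (N ^ c * spanProb N P P' U e)
            ≡⟨ r (N ^ c) (spanProb N P P' U e) ⟩
          N ^ c * (2 * spanProb N P P' U e) ∎)
          where
          open ≤-Reasoning
          c = size A
          w = spanProb N P P' U' e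
          r : ∀ x y → 2 * (x * y) ≡ x * (2 * y)
          r = solve-∀
          ≤P' : ∀ {V} i → hybrid (toℕ e) (on V (const P)) (on V (const P')) i ≤ P'
          ≤P' {V} = hybrid-≤ (toℕ e) (on-≤ V (λ _ → m≤m+n P d)) (on-≤ V (λ _ → ≤-refl))
          outside : ∀ i → lookup U' i ≡ false → hybrid (toℕ e) (on U' (const P)) (on U' (const P')) i ≡ 0
          outside i u' with toℕ i <ᵇ toℕ e
          ... | true  rewrite u' = refl
          ... | false rewrite u' = refl
          out : ∀ i → lookup A i ≡ true → chain P P' U' e i ≡ 0 × chain P P' U e i ≤ P'
          out i a = omit-rel (λ x _ → x ≡ 0) {t₂ = const 0} e i refl (outside i (u'∉ a))
                  , ≤-trans (omit-≤ e _ i) (≤P' {U} i)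
            where
            u'∉ : lookup A i ≡ true → lookup U' i ≡ false
            u'∉ a rewrite lookup-∖ U U' i with lookup U i | lookup U' i
            ... | true | false = refl
          same-lookup : ∀ i → lookup A i ≡ false → lookup U' i ≡ lookup U i
          same-lookup i a rewrite lookup-∖ U U' i with lookup U' i in u'
          ... | true = sym (U'⊑U i u')
          ... | false with lookup U i
          ...   | false = refl
          same : ∀ i → lookup A i ≡ false → chain P P' U' e i ≡ chain P P' U e i
          same i a = omit-rel _≡_ e i refl (cong (λ b → if toℕ i <ᵇ toℕ e then (if b then P' else 0) else (if b then P else 0))
                                                 (same-lookup i a))

      -- From density 0 the likelihood ratio is unbounded, so the first level conditions instead: A
      -- avoids the sample with probability at least 1/2, which costs the same factor 2. Nothing is
      -- dependent at density 0, hence only detections contribute.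
      layer-start : LayerBound
      layer-start = begin
        2 ^ k * (N * (risk N P' U' + risk N P U'))
          ≡⟨ cong (λ g → 2 ^ k * (N * g)) (trans (cong (risk N P' U' +_) (risk≡0 U')) (+-identityʳ _)) ⟩
        2 ^ k * (N * risk N P' U')
          ≤⟨ *-monoʳ-≤ (2 ^ k) (telescope lo≤hi (on-≤ U' (λ _ → P+d≤N)) δ (λ e S → 𝟙 (spans e S)) δ-step) ⟩
        2 ^ k * (N * risk N P U' + Σt)
          ≡⟨ cong (λ g → 2 ^ k * (g + Σt)) (trans (cong (N *_) (risk≡0 U')) (*-zeroʳ N)) ⟩
        2 ^ k * Σt
          ≤⟨ *-monoʳ-≤ (2 ^ k) (∑ᶠ-mono n bound) ⟩
        2 ^ k * ∑ᶠ n (λ e → d * 2 * (𝟙 (lookup U' e) * spanProb N P P' U e))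
          ≡⟨ trans (cong (2 ^ k *_) (∑ᶠ-*ˡ n (d * 2) _)) (r₂ (2 ^ k) d total) ⟩
        d * (2 ^ suc k * total)
          ≤⟨ *-monoʳ-≤ d (m≤m+n _ (2 * n * Z)) ⟩
        d * (2 ^ suc k * total + 2 * n * Z)
          ≤⟨ ≤-trans (m≤n+m _ (2 * N * Z)) (m≤n+m _ (2 ^ suc k * (N * risk N P U))) ⟩
        2 ^ suc k * (N * risk N P U) + (2 * N * Z + d * (2 ^ suc k * total + 2 * n * Z)) ∎
        where
        open ≤-Reasoning
        Σt = ∑ᶠ n (λ e → (on U' (const P') e ∸ on U' (const P) e) * spanProb N P P' U' e)
        r₁ : ∀ b d w → b * d * (2 * w) ≡ d * 2 * (b * w)
        r₁ = solve-∀
        r₂ : ∀ x d t → x * (d * 2 * t) ≡ d * (2 * x * t)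
        r₂ = solve-∀
        bound : ∀ e → (on U' (const P') e ∸ on U' (const P) e) * spanProb N P P' U' e
                ≤ d * 2 * (𝟙 (lookup U' e) * spanProb N P P' U e)
        bound e = ≤-trans (≤-reflexive (cong (_* spanProb N P P' U' e) (gap e)))
          (≤-trans (*-monoʳ-≤ (𝟙 (lookup U' e) * d) (spanProb-avoid e))
                   (≤-reflexive (r₁ (𝟙 (lookup U' e)) d (spanProb N P P' U e))))

-- Repeated samples

∑-not : ∀ {A : Set} (xs : List A) (p : A → Bool) → ∑[ x ∈ xs ] 𝟙 (p x) + ∑[ x ∈ xs ] 𝟙 (not (p x)) ≡ length xs
∑-not xs p = trans (sym (∑-+ xs _ _)) (trans (∑-cong xs (λ x → 𝟙-not (p x))) (trans (∑-const xs 1) (*-identityʳ _)))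

-- Bernoulli's inequality (1 + 1/m)^j ≥ 1 + j/m, multiplied by m^(j+1).
power-lower : ∀ m j → m ^ j * (m + j) ≤ m * suc m ^ j
power-lower m zero    = ≤-reflexive (r m)
  where
  r : ∀ m → 1 * (m + 0) ≡ m * 1
  r = solve-∀
power-lower m (suc j) = begin
  m * m ^ j * (m + suc j)                ≡⟨ r₁ m (m ^ j) j ⟩
  m * (m ^ j * (m + j)) + m * m ^ j      ≤⟨ +-mono-≤ (*-monoʳ-≤ m (power-lower m j)) (*-monoʳ-≤ m (^-monoˡ-≤ j (n≤1+n m))) ⟩
  m * (m * suc m ^ j) + m * suc m ^ j    ≡⟨ r₂ m (suc m ^ j) ⟩
  m * (suc m * suc m ^ j) ∎
  where
  open ≤-Reasoning
  r₁ : ∀ m x j → m * x * (m + suc j) ≡ m * (x * (m + j)) + m * x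
  r₁ = solve-∀
  r₂ : ∀ m x → m * (m * x) + m * x ≡ m * (suc m * x)
  r₂ = solve-∀

halving-power : ∀ m → 2 * m ^ suc m ≤ suc m ^ suc m
halving-power zero      = z≤n
halving-power m@(suc _) = cancelˡ {m} _ _ (s≤s z≤n) (begin
  m * (2 * m ^ suc m)          ≡⟨ r m (m ^ suc m) ⟩
  m ^ suc m * (m + m)          ≤⟨ *-monoʳ-≤ (m ^ suc m) (+-monoʳ-≤ m (n≤1+n m)) ⟩
  m ^ suc m * (m + suc m)      ≤⟨ power-lower m (suc m) ⟩
  m * suc m ^ suc m ∎)
  where
  open ≤-Reasoning
  r : ∀ m x → m * (2 * x) ≡ x * (m + m)
  r = solve-∀

miss-half : ∀ {c z} k → 2 * c ≤ z → 2 ^ k * c ^ k ≤ z ^ k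
miss-half {c} {z} k le = ≤-trans (≤-reflexive (sym (power-* 2 c k))) (^-monoˡ-≤ k le)

-- An event of probability at least 1/n is missed n times in a row with probability at most (1 -
-- 1/n)^n ≤ 1/2; k blocks of n tries bring this down to 2^-k.
miss-rare : ∀ {c h z} n k → 1 ≤ n → h + c ≡ z → z ≤ n * h → 2 ^ k * c ^ (n * k) ≤ z ^ (n * k)
miss-rare {c} {h} {z} (suc m) k _ eq le = begin
  2 ^ k * c ^ (suc m * k)         ≡⟨ cong (2 ^ k *_) (sym (^-*-assoc c (suc m) k)) ⟩
  2 ^ k * (c ^ suc m) ^ k         ≤⟨ miss-half {c ^ suc m} k once ⟩
  (z ^ suc m) ^ k                 ≡⟨ ^-*-assoc z (suc m) k ⟩
  z ^ (suc m * k) ∎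
  where
  open ≤-Reasoning
  n = suc m
  nc≤mz : n * c ≤ m * z
  nc≤mz = +-cancelˡ-≤ z _ _ (begin
    z + n * c       ≤⟨ +-monoˡ-≤ (n * c) le ⟩
    n * h + n * c   ≡⟨ sym (*-distribˡ-+ n h c) ⟩
    n * (h + c)     ≡⟨ cong (n *_) eq ⟩
    z + m * z ∎)
  once : 2 * c ^ n ≤ z ^ n
  once = cancelˡ _ _ (pow-pos {n} n (s≤s z≤n)) (begin
    n ^ n * (2 * c ^ n)     ≡⟨ r (n ^ n) (c ^ n) ⟩
    2 * (n ^ n * c ^ n)     ≡⟨ cong (2 *_) (sym (power-* n c n)) ⟩
    2 * (n * c) ^ n         ≤⟨ *-monoʳ-≤ 2 (^-monoˡ-≤ n nc≤mz) ⟩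
    2 * (m * z) ^ n         ≡⟨ cong (2 *_) (power-* m z n) ⟩
    2 * (m ^ n * z ^ n)     ≡⟨ sym (*-assoc 2 (m ^ n) (z ^ n)) ⟩
    2 * m ^ n * z ^ n       ≤⟨ *-monoˡ-≤ (z ^ n) (halving-power m) ⟩
    n ^ n * z ^ n ∎)
    where
    r : ∀ x y → x * (2 * y) ≡ 2 * (x * y)
    r = solve-∀

-- If an outcome is missed in each of J draws, the chance of meeting it in the next draw is at most
-- 1 / J times the chance of having met it before.
fresh-hit : ∀ q r J → J * q * r ^ J + (q + r) * r ^ J ≤ (q + r) * (q + r) ^ J
fresh-hit q r zero    = ≤-refl
fresh-hit q r (suc J) = begin
  suc J * q * (r * r ^ J) + z * (r * r ^ J)
    ≡⟨ r₁ q r J (r ^ J) ⟩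
  r * (J * q * r ^ J + z * r ^ J) + q * (r * r ^ J)
    ≤⟨ +-mono-≤ (*-monoʳ-≤ r (fresh-hit q r J)) (*-monoʳ-≤ q (*-mono-≤ r≤z (^-monoˡ-≤ J r≤z))) ⟩
  r * (z * z ^ J) + q * (z * z ^ J)
    ≡⟨ r₂ q r (z ^ J) ⟩
  z * (z * z ^ J) ∎
  where
  open ≤-Reasoning
  z = q + r
  r≤z : r ≤ z
  r≤z = m≤n+m r q
  r₁ : ∀ q r J x → suc J * q * (r * x) + (q + r) * (r * x) ≡ r * (J * q * x + (q + r) * x) + q * (r * x)
  r₁ = solve-∀
  r₂ : ∀ q r x → r * ((q + r) * x) + q * ((q + r) * x) ≡ (q + r) * ((q + r) * x)
  r₂ = solve-∀

hits : ∀ {n J} → Vec (Subset n) J → Subset n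
hits rows = tabulate (λ e → not (allᵇ (λ row → not (lookup row e)) rows))

drawn : ∀ {b n} → ℕ → Subset n → Sample b n → Subset n
drawn P' U x = pick (on U (const P')) x

untouched : ∀ {b n J} → ℕ → Subset n → Vec (Sample b n) J → Fin n → Bool
untouched P' U ω e = allᵇ (λ x → not (lookup (drawn P' U x) e)) ω

-- A detected element is not safe to delete on its own account, as the set that spans it may contain
-- other detected elements. Elements drawn in no sample lie in none of these sets, so all of them
-- can be deleted together.
removable : ∀ {b n J} → ℕ → Subset n → Vec (Sample b n) J → Vec (Subset n) J → Subset n
removable P' U ω rows = tabulate (λ e → lookup (hits rows) e ∧ untouched P' U ω e)

allᵇ-∧ : ∀ {A : Set} {k} (p q : A → Bool) (v : Vec A k) → allᵇ (λ x → p x ∧ q x) v ≡ allᵇ p v ∧ allᵇ q v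
allᵇ-∧ p q []      = refl
allᵇ-∧ p q (x ∷ v) rewrite allᵇ-∧ p q v with p x | q x | allᵇ p v
... | true  | true  | _     = refl
... | true  | false | true  = refl
... | true  | false | false = refl
... | false | _     | _     = refl

allᵇ-map : ∀ {A B : Set} {k} (p : B → Bool) (g : A → B) (v : Vec A k) → allᵇ p (Vec.map g v) ≡ allᵇ (p ∘ g) v
allᵇ-map p g []      = refl
allᵇ-map p g (x ∷ v) = cong (p (g x) ∧_) (allᵇ-map p g v)

module Repetition {n : ℕ} (dep : Subset n → Bool)
                  (dep-mono : ∀ {S T} → S ⊑ T → dep S ≡ true → dep T ≡ true) where

  open Layer dep dep-mono

  row : ∀ {b} → ℕ → ℕ → Subset n → Sample b n → Subset n
  row P P' U x = tabulate (λ e → lookup U e ∧ spans e (pick (chain P P' U e) x))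

  rows : ∀ {b J} → ℕ → ℕ → Subset n → Vec (Sample b n) J → Vec (Subset n) J
  rows P P' U = Vec.map (row P P' U)

  unhitMass : ℕ → ℕ → ℕ → Subset n → Subset n → ℕ
  unhitMass N P P' U V = ∑ᶠ n (λ e → 𝟙 (lookup (U ∖ V) e) * spanProb N P P' U e)

  module _ {b J D P P' : ℕ} (U : Subset n) where

    private
      N = 2 ^ b
      Z = N ^ n
      ZJ = Z ^ J
      xs = samples b n
      Ω = vecs xs J

    big : Vec (Sample b n) J → Bool
    big ω = D ≤ᵇ size (removable P' U ω (rows P P' U ω))

    -- The size of the hit set bounds what is set aside, and the unhit mass bounds later detections.
    -- Adding them lets one application of Markov's inequality control both for the same repetition.
    score : Vec (Sample b n) J → ℕ
    score ω = Z * size (hits (rows P P' U ω)) + J * unhitMass N P P' U (hits (rows P P' U ω))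

    good : Vec (Sample b n) J → Bool
    good ω = score ω ≤ᵇ 8 * (suc D * Z)

    #outcomes : length Ω ≡ ZJ
    #outcomes = trans (length-vecs xs J) (cong (_^ J)
      (trans (length-vecs (bitStrings b) n) (cong (_^ n) (length-bitStrings b))))

    module _ (P≤N : P ≤ N) (P'≤N : P' ≤ N) (half : 2 * (J * P') ≤ N) where

      private
        #xs : length xs ≡ Z
        #xs = trans (length-vecs (bitStrings b) n) (cong (_^ n) (length-bitStrings b))

        module _ (e : Fin n) where

          p : Sample b n → Bool
          p x = lookup (row P P' U x) e

          q r : ℕ
          q = ∑[ x ∈ xs ] 𝟙 (p x)
          r = ∑[ x ∈ xs ] 𝟙 (not (p x))

          q+r≡Z : q + r ≡ Z
          q+r≡Z = trans (∑-not xs p) #xs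

          hit : Vec (Sample b n) J → Bool
          hit ω = lookup (hits (rows P P' U ω)) e

          hit≡ : ∀ ω → hit ω ≡ not (allᵇ (λ x → not (p x)) ω)
          hit≡ ω = trans (lookup∘tabulate _ e) (cong not (allᵇ-map (λ ρ → not (lookup ρ e)) (row P P' U) ω))

          H : ℕ
          H = ∑[ ω ∈ Ω ] 𝟙 (hit ω)

          H+ : H + r ^ J ≡ ZJ
          H+ = begin
            H + r ^ J
              ≡⟨ cong (H +_) (sym (∑-allᵇ xs (λ x → not (p x)) J)) ⟩
            H + ∑[ ω ∈ Ω ] 𝟙 (allᵇ (λ x → not (p x)) ω)
              ≡⟨ sym (∑-+ Ω _ _) ⟩
            ∑[ ω ∈ Ω ] (𝟙 (hit ω) + 𝟙 (allᵇ (λ x → not (p x)) ω))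
              ≡⟨ ∑-cong Ω (λ ω → trans (cong (λ h → 𝟙 h + 𝟙 (allᵇ (λ x → not (p x)) ω)) (hit≡ ω))
                   (trans (+-comm (𝟙 (not (allᵇ (λ x → not (p x)) ω))) _) (𝟙-not (allᵇ (λ x → not (p x)) ω)))) ⟩
            ∑[ ω ∈ Ω ] 1
              ≡⟨ trans (∑-const Ω 1) (trans (*-identityʳ _) #outcomes) ⟩
            ZJ ∎
            where open ≡-Reasoning

          -- Among J + 1 draws, the case that exactly draw i detects e counts `q * r ^ J`, whatever
          -- i is. The J cases with i before the last draw are disjoint and are all hits among the
          -- first J draws.
          mass≤ : J * (q * r ^ J) ≤ Z * H
          mass≤ = +-cancelʳ-≤ (Z * r ^ J) _ _ (begin
            J * (q * r ^ J) + Z * r ^ J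
              ≡⟨ cong₂ _+_ (sym (*-assoc J q (r ^ J))) (cong (_* r ^ J) (sym q+r≡Z)) ⟩
            J * q * r ^ J + (q + r) * r ^ J
              ≤⟨ fresh-hit q r J ⟩
            (q + r) * (q + r) ^ J
              ≡⟨ cong (λ z → z * z ^ J) q+r≡Z ⟩
            Z * ZJ
              ≡⟨ trans (cong (Z *_) (sym H+)) (*-distribˡ-+ Z H (r ^ J)) ⟩
            Z * H + Z * r ^ J ∎)
            where open ≤-Reasoning

          q≡ : q ≡ 𝟙 (lookup U e) * spanProb N P P' U e
          q≡ = begin
            ∑[ x ∈ xs ] 𝟙 (p x)
              ≡⟨ ∑-cong xs (λ x → trans (cong 𝟙 (lookup∘tabulate _ e)) (𝟙-∧ (lookup U e) _)) ⟩
            ∑[ x ∈ xs ] (𝟙 (lookup U e) * 𝟙 (spans e (pick (chain P P' U e) x)))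
              ≡⟨ ∑-*ˡ xs (𝟙 (lookup U e)) _ ⟩
            𝟙 (lookup U e) * ∑[ x ∈ xs ] 𝟙 (spans e (pick (chain P P' U e) x))
              ≡⟨ cong (𝟙 (lookup U e) *_) (∑-pick b (chain-≤ P≤N P'≤N U e) (λ S → 𝟙 (spans e S))) ⟩
            𝟙 (lookup U e) * spanProb N P P' U e ∎
            where open ≡-Reasoning

          unhit : ∑[ ω ∈ Ω ] (𝟙 (lookup (U ∖ hits (rows P P' U ω)) e) * spanProb N P P' U e) ≡ q * r ^ J
          unhit = begin
            ∑[ ω ∈ Ω ] (𝟙 (lookup (U ∖ hits (rows P P' U ω)) e) * spanProb N P P' U e)
              ≡⟨ ∑-cong Ω per ⟩
            ∑[ ω ∈ Ω ] (q * 𝟙 (allᵇ (λ x → not (p x)) ω))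
              ≡⟨ trans (∑-*ˡ Ω q _) (cong (q *_) (∑-allᵇ xs (λ x → not (p x)) J)) ⟩
            q * r ^ J ∎
            where
            open ≡-Reasoning
            not² : ∀ c → not (not c) ≡ c
            not² true  = refl
            not² false = refl
            swap : ∀ x y z → x * y * z ≡ x * z * y
            swap = solve-∀
            per : ∀ ω → 𝟙 (lookup (U ∖ hits (rows P P' U ω)) e) * spanProb N P P' U e
                      ≡ q * 𝟙 (allᵇ (λ x → not (p x)) ω)
            per ω = begin
              𝟙 (lookup (U ∖ hits (rows P P' U ω)) e) * spanProb N P P' U e
                ≡⟨ cong (λ c → 𝟙 c * spanProb N P P' U e) (trans (lookup-∖ U (hits (rows P P' U ω)) e)
                     (cong (λ c → lookup U e ∧ c) (trans (cong not (hit≡ ω)) (not² _)))) ⟩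
              𝟙 (lookup U e ∧ allᵇ (λ x → not (p x)) ω) * spanProb N P P' U e
                ≡⟨ cong (_* spanProb N P P' U e) (𝟙-∧ (lookup U e) _) ⟩
              𝟙 (lookup U e) * 𝟙 (allᵇ (λ x → not (p x)) ω) * spanProb N P P' U e
                ≡⟨ swap (𝟙 (lookup U e)) _ _ ⟩
              𝟙 (lookup U e) * spanProb N P P' U e * 𝟙 (allᵇ (λ x → not (p x)) ω)
                ≡⟨ cong (_* 𝟙 (allᵇ (λ x → not (p x)) ω)) (sym q≡) ⟩
              q * 𝟙 (allᵇ (λ x → not (p x)) ω) ∎

          removed : Vec (Sample b n) J → Bool
          removed ω = lookup (removable P' U ω (rows P P' U ω)) e

          Δ : ℕ
          Δ = ∑[ ω ∈ Ω ] 𝟙 (removed ω)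

          -- Detection of e does not look at the coordinate e of the sample, so a detected element is
          -- untouched by all samples with probability (1 - P'/N) ^ J ≥ 1/2.
          H≤2Δ : lookup U e ≡ true → H ≤ 2 * Δ
          H≤2Δ eU = cancelˡ _ _ (pow-pos {N} J (pow-pos {2} b (s≤s z≤n))) (begin
            N ^ J * H
              ≤⟨ *-monoˡ-≤ H (bernoulli-half N P' J (pow-pos {2} b (s≤s z≤n)) P'≤N half) ⟩
            2 * c ^ J * H
              ≡⟨ r₀ (c ^ J) H ⟩
            2 * (c ^ J * H)
              ≤⟨ *-monoʳ-≤ 2 transfer ⟩
            2 * (N ^ J * Δ)
              ≡⟨ r₁ (N ^ J) Δ ⟩
            N ^ J * (2 * Δ) ∎)
            where
            open ≤-Reasoning
            c = N ∸ P'
            r₀ : ∀ x y → 2 * x * y ≡ 2 * (x * y)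
            r₀ = solve-∀
            r₁ : ∀ x y → 2 * (x * y) ≡ x * (2 * y)
            r₁ = solve-∀
            t = hybrid (toℕ e) (on U (const P)) (on U (const P'))
            fr : Vec Bool b → ℕ
            fr v = 𝟙 (not (num v <ᵇ P'))
            ∑fr : ∑ (bitStrings b) fr ≡ c
            ∑fr = trans (∑-threshold b P'≤N (𝟙 ∘ not)) (trans (cong (_+ c * 1) (*-zeroʳ P')) (*-identityʳ c))
            free : Sample b n → Bool
            free x = not (lookup (drawn P' U x) e)
            free≡ : ∀ x → free x ≡ not (num (lookup x e) <ᵇ P')
            free≡ x = cong not (trans (lookup-pick _ x e) (cong (λ u → num (lookup x e) <ᵇ (if u then P' else 0)) eU))
            u = ∑[ x ∈ xs ] 𝟙 (free x)
            u' = ∑[ x ∈ xs ] 𝟙 (free x ∧ not (p x))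
            Nu : N * u ≡ c * Z
            Nu = trans (cong (N *_) (∑-cong xs (λ x → trans (cong 𝟙 (free≡ x)) (sym (*-identityʳ _)))))
                (trans (∑-omit b e {t} fr (λ _ → 1))
                       (cong₂ _*_ ∑fr (trans (∑-const xs 1) (trans (*-identityʳ _) #xs))))
            p≡ : ∀ x → p x ≡ spans e (pick (omit e t) x)
            p≡ x = trans (lookup∘tabulate _ e) (cong (_∧ spans e (pick (omit e t) x)) eU)
            Nu' : N * u' ≡ c * r
            Nu' = trans (cong (N *_) (∑-cong xs (λ x → trans (𝟙-∧ (free x) _)
                    (cong₂ _*_ (cong 𝟙 (free≡ x)) (cong (𝟙 ∘ not) (p≡ x))))))
                 (trans (∑-omit b e {t} fr (λ S → 𝟙 (not (spans e S))))
                        (cong₂ _*_ ∑fr (∑-cong xs (λ x → cong (𝟙 ∘ not) (sym (p≡ x))))))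
            Δ+ : Δ + u' ^ J ≡ u ^ J
            Δ+ = ≡-begin
              where
              none : Vec (Sample b n) J → Bool
              none = allᵇ (λ x → not (p x))
              per : ∀ ω → 𝟙 (removed ω) + 𝟙 (allᵇ (λ x → free x ∧ not (p x)) ω) ≡ 𝟙 (allᵇ free ω)
              per ω = trans (cong₂ (λ s t → 𝟙 s + 𝟙 t)
                  (trans (lookup∘tabulate _ e) (cong (_∧ untouched P' U ω e) (hit≡ ω)))
                  (allᵇ-∧ free (λ x → not (p x)) ω)) (cases (none ω) (allᵇ free ω))
                where
                cases : ∀ s t → 𝟙 (not s ∧ t) + 𝟙 (t ∧ s) ≡ 𝟙 t
                cases true  true  = refl
                cases true  false = refl
                cases false true  = refl
                cases false false = refl
              ≡-begin : Δ + u' ^ J ≡ u ^ J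
              ≡-begin = trans (cong (Δ +_) (sym (∑-allᵇ xs (λ x → free x ∧ not (p x)) J)))
                (trans (sym (∑-+ Ω _ _)) (trans (∑-cong Ω per) (∑-allᵇ xs free J)))
            -- In fact an equality: H and Δ are `Z ^ J - r ^ J` and `u ^ J - u' ^ J`, and
            -- independence of the coordinate e turns Z into u and r into `u'` by the same factor
            -- c/N.
            transfer : c ^ J * H ≤ N ^ J * Δ
            transfer = +-cancelʳ-≤ ((c * r) ^ J) _ _ (≤-reflexive (≡-begin))
              where
              ≡-begin : c ^ J * H + (c * r) ^ J ≡ N ^ J * Δ + (c * r) ^ J
              ≡-begin =
                trans (cong (c ^ J * H +_) (power-* c r J))
                (trans (sym (*-distribˡ-+ (c ^ J) H (r ^ J)))
                (trans (cong (c ^ J *_) H+)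
                (trans (sym (power-* c Z J))
                (trans (cong (_^ J) (sym Nu))
                (trans (power-* N u J)
                (trans (cong (N ^ J *_) (sym Δ+))
                (trans (*-distribˡ-+ (N ^ J) Δ (u' ^ J))
                       (cong (N ^ J * Δ +_) (trans (sym (power-* N u' J)) (cong (_^ J) Nu'))))))))))

          H≤2Δ' : H ≤ 2 * Δ
          H≤2Δ' with lookup U e in eU
          ... | true  = H≤2Δ eU
          ... | false = ≤-trans (≤-reflexive (trans (∑-cong Ω (λ ω → cong 𝟙 (never ω))) (∑-0 Ω))) z≤n
            where
            never : ∀ ω → hit ω ≡ false
            never ω = trans (hit≡ ω) (cong not (all-true ω))
              where
              all-true : ∀ {k} (v : Vec (Sample b n) k) → allᵇ (λ x → not (p x)) v ≡ true
              all-true []      = refl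
              all-true (x ∷ v) = cong₂ _∧_ (cong not (trans (lookup∘tabulate _ e) (cong (_∧ spans e (pick (chain P P' U e) x)) eU))) (all-true v)

        -- By `mass≤` the unhit part of the score sums to no more than the hit part, and a hit
        -- element is removable at least half of the time; hence 4 = 2 * 2.
        ∑score : ∑ Ω score ≤ 4 * (Z * ∑[ ω ∈ Ω ] size (removable P' U ω (rows P P' U ω)))
        ∑score = begin
          ∑ Ω score
            ≡⟨ trans (∑-+ Ω _ _) (cong₂ _+_
                 (trans (∑-*ˡ Ω Z _) (cong (Z *_) (∑-∑ᶠ-swap Ω n _)))
                 (trans (∑-*ˡ Ω J _) (cong (J *_) (trans (∑-∑ᶠ-swap Ω n _) (∑ᶠ-cong n unhit))))) ⟩
          Z * ∑ᶠ n H + J * ∑ᶠ n (λ e → q e * r e ^ J)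
            ≡⟨ cong (Z * ∑ᶠ n H +_) (sym (∑ᶠ-*ˡ n J _)) ⟩
          Z * ∑ᶠ n H + ∑ᶠ n (λ e → J * (q e * r e ^ J))
            ≤⟨ +-monoʳ-≤ (Z * ∑ᶠ n H) (≤-trans (∑ᶠ-mono n mass≤) (≤-reflexive (∑ᶠ-*ˡ n Z H))) ⟩
          Z * ∑ᶠ n H + Z * ∑ᶠ n H
            ≤⟨ +-mono-≤ twice twice ⟩
          Z * (2 * ∑ᶠ n Δ) + Z * (2 * ∑ᶠ n Δ)
            ≡⟨ s Z (∑ᶠ n Δ) ⟩
          4 * (Z * ∑ᶠ n Δ)
            ≡⟨ cong (λ w → 4 * (Z * w)) (sym (∑-∑ᶠ-swap Ω n _)) ⟩
          4 * (Z * ∑[ ω ∈ Ω ] size (removable P' U ω (rows P P' U ω))) ∎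
          where
          open ≤-Reasoning
          s : ∀ z d → z * (2 * d) + z * (2 * d) ≡ 4 * (z * d)
          s = solve-∀
          twice : Z * ∑ᶠ n H ≤ Z * (2 * ∑ᶠ n Δ)
          twice = *-monoʳ-≤ Z (≤-trans (∑ᶠ-mono n H≤2Δ') (≤-reflexive (∑ᶠ-*ˡ n 2 Δ)))

        size≤n : ∀ (S : Subset n) → size S ≤ n
        size≤n S = ≤-trans (∑ᶠ-mono n (λ e → 𝟙≤1 (lookup S e))) (≤-reflexive (trans (∑ᶠ-const n 1) (*-identityʳ n)))

        size≤ : ∀ ω → size (removable P' U ω (rows P P' U ω)) ≤ D + n * 𝟙 (big ω)
        size≤ ω with D ≤ᵇ size (removable P' U ω (rows P P' U ω)) in eq
        ... | true  = ≤-trans (size≤n (removable P' U ω (rows P P' U ω))) (≤-trans (≤-reflexive (sym (*-identityʳ n))) (m≤n+m _ D))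
        ... | false = ≤-trans (<⇒≤ (≰⇒> λ le → true≢false (≤ᵇ-complete le) eq)) (m≤m+n D _)

        bad-score : ∀ ω → 8 * (suc D * Z) * 𝟙 (not (good ω)) ≤ score ω
        bad-score ω with score ω ≤ᵇ 8 * (suc D * Z) in eq
        ... | true  = ≤-trans (≤-reflexive (*-zeroʳ (8 * (suc D * Z)))) z≤n
        ... | false = ≤-trans (≤-reflexive (*-identityʳ (8 * (suc D * Z))))
                        (<⇒≤ (≰⇒> λ le → true≢false (≤ᵇ-complete le) eq))

      -- If `big` has probability at most 1/n, the expected size of `removable` is at most D + n
      -- (1/n) = D + 1, so the expected score is at most 4 (D + 1) Z. The threshold in `good` is
      -- twice that, and Markov's inequality gives 1/2.
      good-or-big : n * ∑[ ω ∈ Ω ] 𝟙 (big ω) ≤ ZJ → 2 * ∑[ ω ∈ Ω ] 𝟙 (not (good ω)) ≤ ZJ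
      good-or-big rare = cancelˡ _ _ (*-mono-≤ {1} {4} {1} {suc D * Z} (s≤s z≤n) (*-mono-≤ {1} {suc D} (s≤s z≤n) (pow-pos {N} n (pow-pos {2} b (s≤s z≤n))))) (begin
        4 * (suc D * Z) * (2 * B)
          ≡⟨ r₁ (suc D * Z) B ⟩
        8 * (suc D * Z) * B
          ≡⟨ sym (∑-*ˡ Ω (8 * (suc D * Z)) _) ⟩
        ∑[ ω ∈ Ω ] (8 * (suc D * Z) * 𝟙 (not (good ω)))
          ≤⟨ ∑-mono Ω bad-score ⟩
        ∑ Ω score
          ≤⟨ ∑score ⟩
        4 * (Z * ∑[ ω ∈ Ω ] size (removable P' U ω (rows P P' U ω)))
          ≤⟨ *-monoʳ-≤ 4 (*-monoʳ-≤ Z (≤-trans (∑-mono Ω size≤) total)) ⟩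
        4 * (Z * (suc D * ZJ))
          ≡⟨ r₂ Z (suc D) ZJ ⟩
        4 * (suc D * Z) * ZJ ∎)
        where
        open ≤-Reasoning
        B = ∑[ ω ∈ Ω ] 𝟙 (not (good ω))
        r₁ : ∀ x y → 4 * x * (2 * y) ≡ 8 * x * y
        r₁ = solve-∀
        r₂ : ∀ z d j → 4 * (z * (d * j)) ≡ 4 * (d * z) * j
        r₂ = solve-∀
        total : ∑[ ω ∈ Ω ] (D + n * 𝟙 (big ω)) ≤ suc D * ZJ
        total = begin
          ∑[ ω ∈ Ω ] (D + n * 𝟙 (big ω))
            ≡⟨ trans (∑-+ Ω _ _) (cong₂ _+_ (∑-const Ω D) (∑-*ˡ Ω n _)) ⟩
          length Ω * D + n * ∑[ ω ∈ Ω ] 𝟙 (big ω)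
            ≤⟨ +-mono-≤ (≤-reflexive (trans (cong (_* D) #outcomes) (*-comm ZJ D))) rare ⟩
          D * ZJ + ZJ
            ≡⟨ +-comm (D * ZJ) ZJ ⟩
          suc D * ZJ ∎

      -- Either one repetition in n deletes D elements, or half of the repetitions have a low score.
      both-miss : ∀ k → 1 ≤ n →
        2 ^ k * ∑[ u ∈ vecs Ω (n * k) ] ∑[ v ∈ vecs Ω k ] 𝟙 (allᵇ (not ∘ big) u ∧ allᵇ (not ∘ good) v)
          ≤ ZJ ^ (n * k) * ZJ ^ k
      both-miss k n>0 = ≤-trans (≤-reflexive factor) bound
        where
        open ≤-Reasoning
        B = ∑[ ω ∈ Ω ] 𝟙 (not (big ω))
        G = ∑[ ω ∈ Ω ] 𝟙 (not (good ω))
        factor : 2 ^ k * ∑[ u ∈ vecs Ω (n * k) ] ∑[ v ∈ vecs Ω k ] 𝟙 (allᵇ (not ∘ big) u ∧ allᵇ (not ∘ good) v)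
                 ≡ 2 ^ k * (B ^ (n * k) * G ^ k)
        factor = cong (2 ^ k *_) (trans
          (∑-cong (vecs Ω (n * k)) (λ u → trans
             (∑-cong (vecs Ω k) (λ v → 𝟙-∧ (allᵇ (not ∘ big) u) (allᵇ (not ∘ good) v)))
             (trans (∑-*ˡ (vecs Ω k) (𝟙 (allᵇ (not ∘ big) u)) _) (cong (𝟙 (allᵇ (not ∘ big) u) *_) (∑-allᵇ Ω (not ∘ good) k)))))
          (trans (∑-*ʳ (vecs Ω (n * k)) (G ^ k) _) (cong (_* G ^ k) (∑-allᵇ Ω (not ∘ big) (n * k)))))
        B≤ : B ≤ ZJ
        B≤ = ≤-trans (m≤n+m B _) (≤-reflexive (trans (∑-not Ω big) #outcomes))
        G≤ : G ≤ ZJ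
        G≤ = ≤-trans (m≤n+m G _) (≤-reflexive (trans (∑-not Ω good) #outcomes))
        reorder : ∀ x y z → x * (y * z) ≡ y * (x * z)
        reorder = solve-∀
        bound : 2 ^ k * (B ^ (n * k) * G ^ k) ≤ ZJ ^ (n * k) * ZJ ^ k
        bound with ≤-total (n * ∑[ ω ∈ Ω ] 𝟙 (big ω)) ZJ
        ... | inj₁ rare = begin
          2 ^ k * (B ^ (n * k) * G ^ k)    ≡⟨ reorder (2 ^ k) (B ^ (n * k)) (G ^ k) ⟩
          B ^ (n * k) * (2 ^ k * G ^ k)    ≤⟨ *-mono-≤ (^-monoˡ-≤ (n * k) B≤) (miss-half {G} k (good-or-big rare)) ⟩
          ZJ ^ (n * k) * ZJ ^ k ∎
        ... | inj₂ often = begin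
          2 ^ k * (B ^ (n * k) * G ^ k)    ≡⟨ sym (*-assoc (2 ^ k) _ _) ⟩
          2 ^ k * B ^ (n * k) * G ^ k      ≤⟨ *-mono-≤ (miss-rare {B} n k n>0 (trans (∑-not Ω big) #outcomes) often) (^-monoˡ-≤ k G≤) ⟩
          ZJ ^ (n * k) * ZJ ^ k ∎

-- Lower tail and matroid rank

size-split : ∀ {n} (U S : Subset n) → size U ≤ size S + size (U ∖ S)
size-split {n} U S = ≤-trans (∑ᶠ-mono n per) (≤-reflexive (∑ᶠ-+ n _ _))
  where
  per : ∀ e → 𝟙 (lookup U e) ≤ 𝟙 (lookup S e) + 𝟙 (lookup (U ∖ S) e)
  per e rewrite lookup-∖ U S e with lookup U e | lookup S e
  ... | true  | true  = ≤-refl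
  ... | true  | false = ≤-refl
  ... | false | _     = z≤n

-- The exponential moment of the number of missed elements: the expectation of 2 to this number is
-- (2 - P/N) to the power `size U`. Base 2 keeps it integral.
Wt-missed : ∀ {n N P} (U : Subset n) → P ≤ N →
  N ^ size U * Wt N (on U (const P)) (λ S → 2 ^ size (U ∖ S)) ≡ (N + (N ∸ P)) ^ size U * N ^ n
Wt-missed [] le = refl
Wt-missed {suc n} {N} {P} (true ∷ U) le = begin
  N * c * (P * w + (N ∸ P) * Wt N (on U (const P)) (λ S → 2 * 2 ^ size (U ∖ S)))
    ≡⟨ cong (λ z → N * c * (P * w + (N ∸ P) * z)) double ⟩
  N * c * (P * w + (N ∸ P) * (2 * w))
    ≡⟨ r N c P (N ∸ P) w ⟩
  N * (P + (N ∸ P) + (N ∸ P)) * (c * w)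
    ≡⟨ cong₂ (λ a b → N * (a + (N ∸ P)) * b) (m+[n∸m]≡n le) (Wt-missed U le) ⟩
  N * (N + (N ∸ P)) * ((N + (N ∸ P)) ^ size U * N ^ n)
    ≡⟨ r' N (N + (N ∸ P)) ((N + (N ∸ P)) ^ size U) (N ^ n) ⟩
  (N + (N ∸ P)) * (N + (N ∸ P)) ^ size U * (N * N ^ n) ∎
  where
  open ≡-Reasoning
  c = N ^ size U
  w = Wt N (on U (const P)) (λ S → 2 ^ size (U ∖ S))
  double : Wt N (on U (const P)) (λ S → 2 * 2 ^ size (U ∖ S)) ≡ 2 * w
  double = trans (W-cong n (λ _ → refl) (λ _ → refl) (λ S → cong (2 ^ size (U ∖ S) +_) (+-identityʳ _)))
    (trans (W-+ n _ _ _ _) (cong (w +_) (sym (+-identityʳ w))))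
  r : ∀ N c P q w → N * c * (P * w + q * (2 * w)) ≡ N * (P + q + q) * (c * w)
  r = solve-∀
  r' : ∀ a b c d → a * b * (c * d) ≡ b * c * (a * d)
  r' = solve-∀
Wt-missed {suc n} {N} {P} (false ∷ U) le = trans (r (N ^ size U) N w)
  (trans (cong (N *_) (Wt-missed U le)) (r' N ((N + (N ∸ P)) ^ size U) (N ^ n)))
  where
  w = Wt N (on U (const P)) (λ S → 2 ^ size (U ∖ S))
  r : ∀ c N w → c * (N * w) ≡ N * (c * w)
  r = solve-∀
  r' : ∀ a b c → a * (b * c) ≡ b * (a * c)
  r' = solve-∀

-- By `halving-power` each block of m + 1 factors m/(m + 1) contributes at most 1/2, and u holds k
-- such blocks; the remaining factors are at most 1.
decay : ∀ m k u → suc m * k ≤ u → 2 ^ k * m ^ u ≤ suc m ^ u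
decay m k u le = begin
  2 ^ k * m ^ u
    ≡⟨ cong (λ z → 2 ^ k * m ^ z) (sym (m+[n∸m]≡n le)) ⟩
  2 ^ k * m ^ (suc m * k + (u ∸ suc m * k))
    ≡⟨ cong (2 ^ k *_) (^-distribˡ-+-* m (suc m * k) _) ⟩
  2 ^ k * (m ^ (suc m * k) * m ^ (u ∸ suc m * k))
    ≡⟨ sym (*-assoc (2 ^ k) _ _) ⟩
  2 ^ k * m ^ (suc m * k) * m ^ (u ∸ suc m * k)
    ≡⟨ cong (λ z → 2 ^ k * z * m ^ (u ∸ suc m * k)) (sym (^-*-assoc m (suc m) k)) ⟩
  2 ^ k * (m ^ suc m) ^ k * m ^ (u ∸ suc m * k)
    ≤⟨ *-mono-≤ (miss-half {m ^ suc m} k (halving-power m)) (^-monoˡ-≤ (u ∸ suc m * k) (n≤1+n m)) ⟩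
  (suc m ^ suc m) ^ k * suc m ^ (u ∸ suc m * k)
    ≡⟨ cong (_* suc m ^ (u ∸ suc m * k)) (^-*-assoc (suc m) (suc m) k) ⟩
  suc m ^ (suc m * k) * suc m ^ (u ∸ suc m * k)
    ≡⟨ sym (^-distribˡ-+-* (suc m) (suc m * k) _) ⟩
  suc m ^ (suc m * k + (u ∸ suc m * k))
    ≡⟨ cong (suc m ^_) (m+[n∸m]≡n le) ⟩
  suc m ^ u ∎
  where open ≤-Reasoning

-- The random set has density P / N = 2 / (m + 1) in U.
small-set : ∀ {n N P m} c (U : Subset n) → 1 ≤ P → P ≤ N → 2 * N ≡ suc m * P → suc m * (2 + c) ≤ size U →
  4 * Wt N (on U (const P)) (λ S → 𝟙 (size S <ᵇ c)) ≤ N ^ n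
small-set {n} {N} {P} {m} c U P>0 P≤N density large = cancelˡ _ _ (pow-pos u (≤-trans P>0 (≤-trans P≤N (m≤m+n N _)))) (begin
  (2 * N) ^ u * (4 * w)
    ≡⟨ trans (cong (_* (4 * w)) (power-* 2 N u)) (r₁ (2 ^ u) (N ^ u) w) ⟩
  4 * (N ^ u * (w * 2 ^ u))
    ≤⟨ *-monoʳ-≤ 4 (*-monoʳ-≤ (N ^ u) markov) ⟩
  4 * (N ^ u * (2 ^ c * Wt N (on U (const P)) (λ S → 2 ^ size (U ∖ S))))
    ≡⟨ r₂ (N ^ u) (2 ^ c) _ ⟩
  2 ^ (2 + c) * (N ^ u * Wt N (on U (const P)) (λ S → 2 ^ size (U ∖ S)))
    ≡⟨ cong (2 ^ (2 + c) *_) (Wt-missed U P≤N) ⟩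
  2 ^ (2 + c) * ((N + (N ∸ P)) ^ u * N ^ n)
    ≡⟨ cong (λ z → 2 ^ (2 + c) * (z ^ u * N ^ n)) rest ⟩
  2 ^ (2 + c) * ((m * P) ^ u * N ^ n)
    ≡⟨ trans (cong (λ z → 2 ^ (2 + c) * (z * N ^ n)) (power-* m P u)) (r₃ (2 ^ (2 + c)) (m ^ u) (P ^ u) (N ^ n)) ⟩
  2 ^ (2 + c) * m ^ u * P ^ u * N ^ n
    ≤⟨ *-monoˡ-≤ (N ^ n) (*-monoˡ-≤ (P ^ u) (decay m (2 + c) u large)) ⟩
  suc m ^ u * P ^ u * N ^ n
    ≡⟨ cong (_* N ^ n) (trans (sym (power-* (suc m) P u)) (cong (_^ u) (sym density))) ⟩
  (2 * N) ^ u * N ^ n ∎)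
  where
  open ≤-Reasoning
  u = size U
  w = Wt N (on U (const P)) (λ S → 𝟙 (size S <ᵇ c))
  r₁ : ∀ a b w → a * b * (4 * w) ≡ 4 * (b * (w * a))
  r₁ = solve-∀
  r₂ : ∀ a b w → 4 * (a * (b * w)) ≡ 2 * (2 * b) * (a * w)
  r₂ = solve-∀
  r₃ : ∀ a b c d → a * (b * c * d) ≡ a * b * c * d
  r₃ = solve-∀
  rest : N + (N ∸ P) ≡ m * P
  rest = trans (sym (+-∸-assoc N P≤N)) (trans (cong (λ z → N + z ∸ P) (sym (+-identityʳ N)))
         (trans (cong (_∸ P) density) (m+n∸m≡n P (m * P))))
  W-scale : ∀ k (a b : Fin k → ℕ) f x → W k a b (λ S → x * f S) ≡ x * W k a b f
  W-scale zero    a b f x = refl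
  W-scale (suc k) a b f x = trans
    (cong₂ (λ y z → a zero * y + b zero * z) (W-scale k (a ∘ suc) (b ∘ suc) (f ∘ (true ∷_)) x)
                                             (W-scale k (a ∘ suc) (b ∘ suc) (f ∘ (false ∷_)) x))
    (s (a zero) (b zero) x _ _)
    where
    s : ∀ a b x y z → a * (x * y) + b * (x * z) ≡ x * (a * y + b * z)
    s = solve-∀
  -- Fewer than c drawn elements leave at least `size U` minus c missed ones. Against the
  -- exponential moment this costs 2^c, and the 4 of the conclusion turns it into 2^(2+c), the
  -- source of `2 + c` in the size condition.
  markov : w * 2 ^ u ≤ 2 ^ c * Wt N (on U (const P)) (λ S → 2 ^ size (U ∖ S))
  markov = begin
    w * 2 ^ u
      ≡⟨ *-comm w (2 ^ u) ⟩
    2 ^ u * w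
      ≡⟨ sym (W-scale n _ _ _ (2 ^ u)) ⟩
    Wt N (on U (const P)) (λ S → 2 ^ u * 𝟙 (size S <ᵇ c))
      ≤⟨ W-mono n per ⟩
    Wt N (on U (const P)) (λ S → 2 ^ c * 2 ^ size (U ∖ S))
      ≡⟨ W-scale n _ _ _ (2 ^ c) ⟩
    2 ^ c * Wt N (on U (const P)) (λ S → 2 ^ size (U ∖ S)) ∎
    where
    per : ∀ S → 2 ^ u * 𝟙 (size S <ᵇ c) ≤ 2 ^ c * 2 ^ size (U ∖ S)
    per S with size S <ᵇ c in eq
    ... | false = ≤-trans (≤-reflexive (*-zeroʳ (2 ^ u))) z≤n
    ... | true  = begin
      2 ^ u * 1                     ≡⟨ *-identityʳ (2 ^ u) ⟩
      2 ^ u                         ≤⟨ ^-monoʳ-≤ 2 (≤-trans (size-split U S) (+-monoˡ-≤ (size (U ∖ S)) (<⇒≤ (<ᵇ-sound {size S} {c} eq)))) ⟩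
      2 ^ (c + size (U ∖ S))        ≡⟨ ^-distribˡ-+-* 2 c _ ⟩
      2 ^ c * 2 ^ size (U ∖ S) ∎

⊑⇒⊆ : ∀ {n} {S T : Subset n} → S ⊑ T → S ⊆ T
⊑⇒⊆ {S = S} {T} le {x} x∈S = lookup⇒[]= x T (le x ([]=⇒lookup x∈S))

-- Maximal independent subsets and full rank

module _ {n : ℕ} (M : Matroid n) where

  Indep : Subset n → Set
  Indep S = indep M S ≡ true

  Maximal : Subset n → Subset n → Set
  Maximal G B = B ⊆ G × Indep B × (∀ x → x ∈ G → x ∉ B → ¬ Indep (B ∪ ⁅ x ⁆))

  private
    addable : ∀ G B → Dec (∃ λ x → x ∈ G × x ∉ B × Indep (B ∪ ⁅ x ⁆))
    addable G B = any? λ x → (x ∈? G) ×-dec (¬? (x ∈? B) ×-dec (indep M (B ∪ ⁅ x ⁆) Bool.≟ true))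

    ∣∪⁅⁆∣ : ∀ {B : Subset n} {x} → x ∉ B → ∣ B ∣ < ∣ B ∪ ⁅ x ⁆ ∣
    ∣∪⁅⁆∣ {B} {x} x∉B = p⊂q⇒∣p∣<∣q∣ (p⊆p∪q ⁅ x ⁆ , x , x∈p∪q⁺ (inj₂ (x∈⁅x⁆ x)) , x∉B)

    ∪⁅⁆⊆ : ∀ {B G : Subset n} {x} → B ⊆ G → x ∈ G → B ∪ ⁅ x ⁆ ⊆ G
    ∪⁅⁆⊆ {B} {G} {x} B⊆G x∈G {y} y∈ with x∈p∪q⁻ B ⁅ x ⁆ y∈
    ... | inj₁ y∈B = B⊆G y∈B
    ... | inj₂ y∈x = subst (_∈ G) (sym (x∈⁅y⁆⇒x≡y x y∈x)) x∈G

    extend′ : ∀ fuel {G Q} → n ≤ ∣ Q ∣ + fuel → Q ⊆ G → Indep Q → ∃ λ B → Q ⊆ B × Maximal G B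
    extend′ fuel {G} {Q} le Q⊆G iQ with addable G Q
    ... | no none = Q , ⊆-refl , Q⊆G , iQ , λ x x∈G x∉Q i → none (x , x∈G , x∉Q , i)
    extend′ zero {G} {Q} le Q⊆G iQ | yes (x , x∈G , x∉Q , i) =
      ⊥-elim (<-irrefl refl (<-≤-trans (≤-<-trans (≤-trans le (≤-reflexive (+-identityʳ _))) (∣∪⁅⁆∣ x∉Q)) (∣p∣≤n (Q ∪ ⁅ x ⁆))))
    extend′ (suc fuel) {G} {Q} le Q⊆G iQ | yes (x , x∈G , x∉Q , i)
      with extend′ fuel {G} {Q ∪ ⁅ x ⁆} (≤-trans le (≤-trans (≤-reflexive (+-suc ∣ Q ∣ fuel)) (+-monoˡ-≤ fuel (∣∪⁅⁆∣ x∉Q)))) (∪⁅⁆⊆ Q⊆G x∈G) i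
    ... | B , Q'⊆B , max = B , (λ p → Q'⊆B (p⊆p∪q ⁅ x ⁆ p)) , max

  extend : ∀ {G Q} → Q ⊆ G → Indep Q → ∃ λ B → Q ⊆ B × Maximal G B
  extend {G} {Q} = extend′ n (m≤n+m n ∣ Q ∣)

  maximal-largest : ∀ {G B C} → Maximal G B → C ⊆ G → Indep C → ∣ C ∣ ≤ ∣ B ∣
  maximal-largest {G} {B} {C} (B⊆G , iB , max) C⊆G iC with ∣ C ∣ ≤? ∣ B ∣
  ... | yes le = le
  ... | no ¬le with exchange M iB iC (≰⇒> ¬le)
  ...   | x , x∈C , x∉B , i = ⊥-elim (max x (C⊆G x∈C) x∉B i)

  -- Expresses through cardinalities that G spans the matroid, so that neither a rank function nor a
  -- closure operator has to be built.
  FullRank : Subset n → Set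
  FullRank G = ∀ A → Indep A → ∃ λ B → B ⊆ G × Indep B × ∣ A ∣ ≤ ∣ B ∣

  -- All spanning sets Q lie in G', so deleted elements never lean on each other. Let B be maximal
  -- in G'. If C is larger, exchange yields x outside G' with B + x independent. Extend the spanning
  -- set Q of x to a maximal Q' in G'; it is smaller than B + x, and by maximality the exchanged
  -- element can only be x. But then Q + x would be independent.
  delete-spanned : ∀ {G G'} → FullRank G →
    (∀ e → e ∈ G → e ∉ G' → ∃ λ Q → Q ⊆ G' × Indep Q × ¬ Indep (Q ∪ ⁅ e ⁆)) → FullRank G'
  delete-spanned {G} {G'} full spanned A iA with full A iA | extend {G'} {⊥} (⊆-min _) (indep-∅ M)
  ... | C , C⊆G , iC , A≤C | B , _ , maxB@(B⊆G' , iB , noB) = B , B⊆G' , iB , ≤-trans A≤C C≤B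
    where
    C≤B : ∣ C ∣ ≤ ∣ B ∣
    C≤B with ∣ C ∣ ≤? ∣ B ∣
    ... | yes le = le
    ... | no ¬le with exchange M iB iC (≰⇒> ¬le)
    ...   | x , x∈C , x∉B , iBx with x ∈? G'
    ...     | yes x∈G' = ⊥-elim (noB x x∈G' x∉B iBx)
    ...     | no x∉G' with spanned x (C⊆G x∈C) x∉G'
    ...       | Q , Q⊆G' , iQ , depQx with extend Q⊆G' iQ
    ...         | Q' , Q⊆Q' , maxQ@(Q'⊆G' , iQ' , noQ)
                with exchange M iQ' iBx (≤-<-trans (maximal-largest maxB Q'⊆G' iQ') (∣∪⁅⁆∣ x∉B))
    ...           | z , z∈Bx , z∉Q' , iQz with x∈p∪q⁻ B ⁅ x ⁆ z∈Bx
    ...             | inj₁ z∈B = ⊥-elim (noQ z (B⊆G' z∈B) z∉Q' iQz)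
    ...             | inj₂ z∈x = ⊥-elim (depQx (indep-⊆ M (mono (x∈⁅y⁆⇒x≡y x z∈x)) iQz))
      where
      mono : z ≡ x → Q ∪ ⁅ x ⁆ ⊆ Q' ∪ ⁅ z ⁆
      mono refl p = x∈p∪q⁺ ([ (λ q → inj₁ (Q⊆Q' q)) , inj₂ ]′ (x∈p∪q⁻ Q ⁅ x ⁆ p))

  fullRank-basis : ∀ {I} → Indep I → FullRank I → IsBasis M I
  fullRank-basis {I} iI full = iI , λ S I⊆S iS → ⊆-antisym (S⊆I S I⊆S iS) I⊆S
    where
    S⊆I : ∀ S → I ⊆ S → Indep S → S ⊆ I
    S⊆I S I⊆S iS {x} x∈S with x ∈? I
    ... | yes x∈I = x∈I
    ... | no x∉I with full S iS
    ...   | B , B⊆I , _ , S≤B =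
      ⊥-elim (<-irrefl refl (<-≤-trans (p⊂q⇒∣p∣<∣q∣ (I⊆S , x , x∈S , x∉I)) (≤-trans S≤B (p⊆q⇒∣p∣≤∣q∣ B⊆I))))

-- Parallel queries and adaptive runs

-- The queries are fixed before any of their answers is known; read gets the answers in the same order.
record Par (n : ℕ) (A : Set) : Set where
  constructor par
  field
    queries : List (Subset n)
    read    : List Bool → A
open Par public

module _ {n : ℕ} where

  evaluate : ∀ {A : Set} → (Subset n → Bool) → Par n A → A
  evaluate o p = read p (map o (queries p))

  -- The default is never reached under `evaluate`, which supplies one answer per query; it only
  -- makes `read` total on arbitrary lists.
  headOr : List Bool → Bool
  headOr []      = false
  headOr (b ∷ _) = b

  ask₁ : Subset n → Par n Bool
  ask₁ S = par (S ∷ []) headOr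

  pureP : ∀ {A : Set} → A → Par n A
  pureP a = par [] (λ _ → a)

  zipP : ∀ {A B C : Set} → (A → B → C) → Par n A → Par n B → Par n C
  zipP f p q = par (queries p ++ queries q)
    (λ as → f (read p (take (length (queries p)) as)) (read q (drop (length (queries p)) as)))

  mapP : ∀ {A B : Set} → (A → B) → Par n A → Par n B
  mapP f p = par (queries p) (λ as → f (read p as))

  -- Joint queries for a whole vector: the computations are merged side by side, so any number of
  -- repetitions still takes one round.
  traverse : ∀ {A B : Set} {k} → (A → Par n B) → Vec A k → Par n (Vec B k)
  traverse g []      = pureP []
  traverse g (x ∷ v) = zipP _∷_ (g x) (traverse g v)

  tabP : ∀ {B : Set} k → (Fin k → Par n B) → Par n (Vec B k)
  tabP zero    g = pureP []
  tabP (suc k) g = zipP _∷_ (g zero) (tabP k (g ∘ suc))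

  evaluate-zip : ∀ {A B C : Set} o (f : A → B → C) p q →
                 evaluate o (zipP f p q) ≡ f (evaluate o p) (evaluate o q)
  evaluate-zip o f p q rewrite map-++ o (queries p) (queries q) =
    cong₂ (λ x y → f (read p x) (read q y)) (take-map (queries p) _) (drop-map (queries p) _)
    where
    take-map : ∀ qs ys → take (length qs) (map o qs ++ ys) ≡ map o qs
    take-map []       ys = refl
    take-map (x ∷ qs) ys = cong (o x ∷_) (take-map qs ys)
    drop-map : ∀ qs ys → drop (length qs) (map o qs ++ ys) ≡ ys
    drop-map []       ys = refl
    drop-map (x ∷ qs) ys = drop-map qs ys

  evaluate-traverse : ∀ {A B : Set} {k} o (g : A → Par n B) {h : A → B} → (∀ x → evaluate o (g x) ≡ h x) →
                      (v : Vec A k) → evaluate o (traverse g v) ≡ Vec.map h v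
  evaluate-traverse o g eq []      = refl
  evaluate-traverse o g eq (x ∷ v) =
    trans (evaluate-zip o _∷_ (g x) (traverse g v)) (cong₂ _∷_ (eq x) (evaluate-traverse o g eq v))

  evaluate-tab : ∀ {B : Set} k o (g : Fin k → Par n B) {h : Fin k → B} → (∀ i → evaluate o (g i) ≡ h i) →
                 evaluate o (tabP k g) ≡ tabulate h
  evaluate-tab zero    o g eq = refl
  evaluate-tab (suc k) o g eq =
    trans (evaluate-zip o _∷_ (g zero) (tabP k (g ∘ suc))) (cong₂ _∷_ (eq zero) (evaluate-tab k o (g ∘ suc) (eq ∘ suc)))

  #queries : ∀ {A : Set} → Par n A → ℕ
  #queries p = length (queries p)

  #zip : ∀ {A B C : Set} (f : A → B → C) p q → #queries (zipP f p q) ≡ #queries p + #queries q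
  #zip f p q = length-++ (queries p)

  #traverse : ∀ {A B : Set} {k} c (g : A → Par n B) → (∀ x → #queries (g x) ≤ c) →
              (v : Vec A k) → #queries (traverse g v) ≤ k * c
  #traverse c g le []      = z≤n
  #traverse c g le (x ∷ v) =
    ≤-trans (≤-reflexive (#zip {C = Vec _ _} _∷_ (g x) (traverse g v))) (+-mono-≤ (le x) (#traverse c g le v))

  #tab : ∀ {B : Set} k c (g : Fin k → Par n B) → (∀ i → #queries (g i) ≤ c) → #queries (tabP k g) ≤ k * c
  #tab zero    c g le = z≤n
  #tab (suc k) c g le =
    ≤-trans (≤-reflexive (#zip {C = Vec _ _} _∷_ (g zero) (tabP k (g ∘ suc)))) (+-mono-≤ (le zero) (#tab k c (g ∘ suc) (le ∘ suc)))

-- Decision trees of query rounds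

data Tree (n : ℕ) : Set where
  leaf : Subset n → Tree n
  node : List (Subset n) → (List Bool → Tree n) → Tree n

module _ {n : ℕ} where

  -- Each step of a `run` sees the whole history, so the position in the tree is recovered by
  -- replaying the recorded answers from the root.
  follow : Tree n → History n → Step n
  follow (leaf B)    h        = output B
  follow (node qs k) []       = query qs
  follow (node qs k) (rd ∷ h) = follow (k (map proj₂ rd)) h

  descend : Matroid n → ℕ → Tree n → Maybe (Subset n)
  descend M R       (leaf B)    = just B
  descend M zero    (node qs k) = nothing
  descend M (suc R) (node qs k) = descend M R (k (map (indep M) qs))

  run-shift : ∀ M R (st st' : History n → Step n) h₀ h →
              (∀ h' → st (h₀ ++ h') ≡ st' h') → run st M R (h₀ ++ h) ≡ run st' M R h
  run-shift M R st st' h₀ h eq with st (h₀ ++ h) | st' h | eq h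
  ... | output B | .(output B) | refl = refl
  ... | query qs | .(query qs) | refl with R
  ...   | zero  = refl
  ...   | suc R' = trans (cong (run st M R') (++-assoc h₀ h _)) (run-shift M R' st st' h₀ _ eq)

  run-follow : ∀ M R t → run (follow t) M R [] ≡ descend M R t
  run-follow M R       (leaf B)    = refl
  run-follow M zero    (node qs k) = refl
  run-follow M (suc R) (node qs k) =
    trans (run-shift M R (follow (node qs k)) (follow (k (map (indep M) qs))) (answer M qs ∷ []) []
             (λ h' → cong (λ as → follow (k as) h') (sym (map-∘ qs))))
          (run-follow M R (k (map (indep M) qs)))

  -- `PolyQueries` ranges over all histories, also those that no matroid produces; hence the
  -- subtrees are bounded for every list of answers.
  data Bounded (m : ℕ) : Tree n → Set where
    leaf : ∀ {B} → Bounded m (leaf B)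
    node : ∀ {qs k} → length qs ≤ m → (∀ as → Bounded m (k as)) → Bounded m (node qs k)

  follow-bounded : ∀ {m t} → Bounded m t → ∀ h qs → follow t h ≡ query qs → length qs ≤ m
  follow-bounded leaf         h        qs ()
  follow-bounded (node le bd) []       qs refl = le
  follow-bounded (node le bd) (rd ∷ h) qs eq   = follow-bounded (bd _) h qs eq

-- Union bound for a random process with decreasing rank

module Process {S C : Set} (step : S → C → S) (done : S → Bool) where

  success : ∀ f → S → Vec C f → Bool
  success zero    s []       = done s
  success (suc f) s (c ∷ cs) = done s ∨ success f (step s c) cs

  module _ (k : ℕ) (xs : List C) (Inv : S → Set) (rank : S → ℕ) (bad : S → C → Bool)
    (finished : ∀ {s} → Inv s → rank s ≡ 0 → done s ≡ true)
    (rare : ∀ {s} → Inv s → done s ≡ false → 2 ^ k * ∑[ c ∈ xs ] 𝟙 (bad s c) ≤ length xs)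
    (progress : ∀ {s} c → Inv s → done s ≡ false → bad s c ≡ false → Inv (step s c) × rank (step s c) < rank s)
    where

    -- A run that is not done after f steps, f at least the initial rank, has met a bad step. Coins
    -- are fresh in every step, so each step is bad with probability at most 2^-k whatever state was
    -- reached, and the f probabilities add up.
    failure-rare : ∀ f s → Inv s → rank s ≤ f →
      2 ^ k * ∑[ cs ∈ vecs xs f ] 𝟙 (not (success f s cs)) ≤ f * length xs ^ f
    failure-rare zero s inv le rewrite finished inv (n≤0⇒n≡0 le) = ≤-reflexive (*-zeroʳ (2 ^ k))
    failure-rare (suc f) s inv le with done s in d
    ... | true  = ≤-trans (≤-reflexive (trans (cong (2 ^ k *_) zero-sum) (*-zeroʳ (2 ^ k)))) z≤n
      where
      zero-sum : ∑[ cs ∈ vecs xs (suc f) ] 𝟙 (not (success (suc f) s cs)) ≡ 0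
      zero-sum = trans (∑-cong (vecs xs (suc f)) never) (∑-0 (vecs xs (suc f)))
        where
        never : ∀ cs → 𝟙 (not (success (suc f) s cs)) ≡ 0
        never (c ∷ cs) rewrite d = refl
    ... | false = begin
      2 ^ k * ∑[ cs ∈ vecs xs (suc f) ] 𝟙 (not (success (suc f) s cs))
        ≡⟨ cong (2 ^ k *_) (trans (∑-vecs-suc xs f _) (∑-cong xs (λ c → ∑-cong (vecs xs f) (λ cs → unfold c cs)))) ⟩
      2 ^ k * ∑[ c ∈ xs ] ∑[ cs ∈ vecs xs f ] 𝟙 (not (success f (step s c) cs))
        ≡⟨ sym (∑-*ˡ xs (2 ^ k) _) ⟩
      ∑[ c ∈ xs ] (2 ^ k * ∑[ cs ∈ vecs xs f ] 𝟙 (not (success f (step s c) cs)))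
        ≤⟨ ∑-mono xs each ⟩
      ∑[ c ∈ xs ] (2 ^ k * 𝟙 (bad s c) * z + f * z)
        ≡⟨ trans (∑-+ xs _ _) (cong₂ _+_ (trans (∑-*ʳ xs z _) (cong (_* z) (∑-*ˡ xs (2 ^ k) _))) (∑-const xs (f * z))) ⟩
      2 ^ k * ∑[ c ∈ xs ] 𝟙 (bad s c) * z + length xs * (f * z)
        ≤⟨ +-monoˡ-≤ (length xs * (f * z)) (*-monoˡ-≤ z (rare inv d)) ⟩
      length xs * z + length xs * (f * z)
        ≡⟨ r (length xs) z f ⟩
      suc f * length xs ^ suc f ∎
      where
      open ≤-Reasoning
      z = length xs ^ f
      r : ∀ l z f → l * z + l * (f * z) ≡ suc f * (l * z)
      r = solve-∀
      unfold : ∀ c cs → 𝟙 (not (success (suc f) s (c ∷ cs))) ≡ 𝟙 (not (success f (step s c) cs))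
      unfold c cs rewrite d = refl
      each : ∀ c → 2 ^ k * ∑[ cs ∈ vecs xs f ] 𝟙 (not (success f (step s c) cs)) ≤ 2 ^ k * 𝟙 (bad s c) * z + f * z
      each c with bad s c in b
      ... | true  = ≤-trans (*-monoʳ-≤ (2 ^ k) (≤-trans (∑-mono (vecs xs f) (λ cs → 𝟙≤1 _))
                      (≤-reflexive (trans (∑-const (vecs xs f) 1) (trans (*-identityʳ _) (length-vecs xs f))))))
                    (≤-trans (≤-reflexive (cong (_* z) (sym (*-identityʳ (2 ^ k))))) (m≤m+n _ (f * z)))
      ... | false with progress c inv d b
      ...   | inv' , lt = ≤-trans (failure-rare f (step s c) inv' (≤-pred (≤-trans lt le)))
                            (m≤n+m _ _)

-- The algorithm

-- Parameters for universes of about 2 ^ σ elements: densities are multiples of 2 ^ -b, level j raises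
-- the density by d j, a repetition draws J samples, a deletion removes at least D elements, a
-- contraction at least ct, and slack bounds 16 (D + 1) / J.
record Scale : Set where
  field
    large         : Bool
    b J D L ct slack : ℕ
    d             : ℕ → ℕ

  P : ℕ → ℕ
  P zero    = 0
  P (suc j) = P j + d j

  granularity : ℕ
  granularity = 2 ^ b

  setAside : ℕ → ℕ
  setAside k = k * (8 * suc D)

-- I is the contracted independent set, E the undecided elements, and U the elements of E not set
-- aside. `level` counts density windows and `layer` the layers within the current one.
record State (n : ℕ) : Set where
  constructor state
  field
    I E U       : Subset n
    level layer : ℕ

fresh : ∀ {n} → Subset n → Subset n → State n
fresh I E = state I E E 0 0

firstIn : ∀ {n} → Subset n → Maybe (Fin n)
firstIn []          = nothing
firstIn (true ∷ S)  = just zero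
firstIn (false ∷ S) with firstIn S
... | just e  = just (suc e)
... | nothing = nothing

module Finder {n b J : ℕ} (D P' : ℕ) (U : Subset n) where

  find : ∀ {m} → Vec (Vec (Sample b n) J) m → Vec (Vec (Subset n) J) m → Maybe (Subset n)
  find []      []       = nothing
  find (ω ∷ u) (r ∷ rs) = if D ≤ᵇ size (removable P' U ω r) then just (removable P' U ω r) else find u rs

-- Whether a repetition has small unhit mass cannot be observed, only whether its hit set is small.
-- Removing all small hit sets surely removes that of a good repetition, at m times the cost.
prune : ∀ {n J m} → ℕ → Subset n → Vec (Vec (Subset n) J) m → Subset n
prune c U []       = U
prune c U (r ∷ rs) = prune c (if size (hits r) ≤ᵇ c then U ∖ hits r else U) rs

module Algo (n k : ℕ) (sc : ℕ → Scale) where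

  open Scale
  open State

  Repeated : Scale → ℕ → Set
  Repeated p m = Vec (Vec (Sample (b p) n) (J p)) m

  sampleSampler : ∀ p → Sampler (Sample (b p) n)
  sampleSampler p = vecSampler (bitSampler (b p)) n

  repeatSampler : ∀ p m → Sampler (Repeated p m)
  repeatSampler p m = vecSampler (vecSampler (sampleSampler p) (J p)) m

  layerSampler : ∀ p → Sampler (Repeated p (n * k) × Repeated p k)
  layerSampler p = pairSampler _,_ (repeatSampler p (n * k)) (repeatSampler p k)

  contractSampler : ∀ p → Sampler (Vec (Sample (b p) n) k)
  contractSampler p = vecSampler (sampleSampler p) k

  scaleOf : State n → ℕ
  scaleOf s = ⌊log₂ size (E s) ⌋

  done : State n → Bool
  done s = size (E s) ≡ᵇ 0

  smallStep : State n → Par n (State n)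
  smallStep s with firstIn (E s)
  ... | nothing = pureP s
  ... | just e  = mapP (λ i → fresh (if i then I s ∪ ⁅ e ⁆ else I s) (E s ∖ ⁅ e ⁆)) (ask₁ (I s ∪ ⁅ e ⁆))

  -- Inserting elements one at a time looks sequential, but the set present at the turn of e depends
  -- on the sample alone and on no answer. So all 2 n queries of a row go out in a single round.
  rowP : ∀ {b} → Subset n → ℕ → ℕ → Subset n → Sample b n → Par n (Subset n)
  rowP I P P' U x = tabP n λ e → let S = pick (chain P P' U e) x in
    zipP (λ a a' → lookup U e ∧ (not (not a) ∧ not a')) (ask₁ (I ∪ S)) (ask₁ (I ∪ (S [ e ]≔ true)))

  -- The parameters depend on the scale, so a change of scale restarts at level 0 with nothing set
  -- aside. Otherwise level and layer survive, because deleting elements of U only lowers the risk.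
  afterDelete : State n → Subset n → State n
  afterDelete s Δ = if ⌊log₂ size (E s ∖ Δ) ⌋ ≡ᵇ scaleOf s
    then state (I s) (E s ∖ Δ) (U s ∖ Δ) (level s) (layer s)
    else fresh (I s) (E s ∖ Δ)

  afterPrune : State n → Subset n → State n
  afterPrune s U' = if suc (layer s) ≡ᵇ k
    then state (I s) (E s) U' (suc (level s)) 0
    else state (I s) (E s) U' (level s) (suc (layer s))

  after : State n → Subset n → Maybe (Subset n) → State n
  after s U' (just Δ) = afterDelete s Δ
  after s U' nothing  = afterPrune s U'

  layerStep : (s : State n) (p : Scale) → Repeated p (n * k) × Repeated p k → Par n (State n)
  layerStep s p (u , w) = zipP
    (λ ru rw → after s (prune (8 * suc (D p)) (U s) rw) (Finder.find (D p) (P p (suc (level s))) (U s) u ru))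
    (traverse (traverse (rowP (I s) (P p (level s)) (P p (suc (level s))) (U s))) u)
    (traverse (traverse (rowP (I s) (P p (level s)) (P p (suc (level s))) (U s))) w)

  select : ∀ {m} (s : State n) (p : Scale) → Vec (Sample (b p) n) m → Vec Bool m → State n
  select s p []      []       = s
  select s p (x ∷ w) (a ∷ as) = let S = drawn (P p (L p)) (U s) x in
    if a ∧ (ct p ≤ᵇ size S) then fresh (I s ∪ S) (E s ∖ S) else select s p w as

  contractStep : (s : State n) (p : Scale) → Vec (Sample (b p) n) k → Par n (State n)
  contractStep s p w = mapP (select s p w) (traverse (λ x → ask₁ (I s ∪ drawn (P p (L p)) (U s) x)) w)

  #rowP : ∀ {b} I P P' U (x : Sample b n) → #queries (rowP I P P' U x) ≤ n * 2
  #rowP I P P' U x = #tab n 2 _ (λ e → ≤-refl)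

  #layerStep : ∀ s p c → #queries (layerStep s p c) ≤ (n * k + k) * (J p * (n * 2))
  #layerStep s p (u , v) = ≤-trans (≤-reflexive (#zip (λ ru rv → after s (prune (8 * suc (D p)) (U s) rv) (Finder.find (D p) (P p (suc (level s))) (U s) u ru)) (rowsOf u) (rowsOf v)))
    (≤-trans (+-mono-≤ (count u) (count v)) (≤-reflexive (sym (*-distribʳ-+ (J p * (n * 2)) (n * k) k))))
    where
    rowOf : Sample (b p) n → Par n (Subset n)
    rowOf = rowP (I s) (P p (level s)) (P p (suc (level s))) (U s)
    rowsOf : ∀ {m} → Repeated p m → Par n (Vec (Vec (Subset n) (J p)) m)
    rowsOf = traverse (traverse rowOf)
    count : ∀ {m} (v : Repeated p m) → #queries (rowsOf v) ≤ m * (J p * (n * 2))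
    count = #traverse (J p * (n * 2)) (traverse rowOf)
      (#traverse (n * 2) rowOf (#rowP (I s) (P p (level s)) (P p (suc (level s))) (U s)))

  #contractStep : ∀ s p c → #queries (contractStep s p c) ≤ k * 1
  #contractStep s p = #traverse 1 (λ x → ask₁ (I s ∪ drawn (P p (L p)) (U s) x)) (λ x → ≤-refl)

  #smallStep : ∀ s → #queries (smallStep s) ≤ 1
  #smallStep s with firstIn (E s)
  ... | nothing = z≤n
  ... | just e  = ≤-refl

  #if : ∀ {A m} c {p q : Par n A} → #queries p ≤ m → #queries q ≤ m → #queries (if c then p else q) ≤ m
  #if true  le le' = le
  #if false le le' = le'

  bounded-if : ∀ {m B} c {t : Tree n} → Bounded m t → Bounded m (if c then leaf B else t)
  bounded-if true  bd = leaf
  bounded-if false bd = bd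

  module Run (B : ℕ) (fitL : ∀ σ → bits (layerSampler (sc σ)) ≤ B) (fitC : ∀ σ → bits (contractSampler (sc σ)) ≤ B) where

    next : State n → Vec Bool B → Par n (State n)
    next s c =
      if large (sc (scaleOf s))
      then (if level s <ᵇ L (sc (scaleOf s))
            then layerStep s (sc (scaleOf s)) (padSampler (layerSampler (sc (scaleOf s))) (fitL (scaleOf s)) c)
            else contractStep s (sc (scaleOf s)) (padSampler (contractSampler (sc (scaleOf s))) (fitC (scaleOf s)) c))
      else smallStep s

    build : ∀ f → State n → Vec (Vec Bool B) f → Tree n
    build zero    s []       = leaf (I s)
    build (suc f) s (c ∷ cs) = if done s then leaf (I s)
      else node (queries (next s c)) (λ as → build f (read (next s c) as) cs)

    build-bounded : ∀ {m} → (∀ s c → #queries (next s c) ≤ m) → ∀ f s cs → Bounded m (build f s cs)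
    build-bounded le zero    s []       = leaf
    build-bounded le (suc f) s (c ∷ cs) =
      bounded-if (done s) (node (le s c) (λ as → build-bounded le f (read (next s c) as) cs))

    #next : ∀ {m} → (∀ σ → (n * k + k) * (J (sc σ) * (n * 2)) ≤ m) → k * 1 ≤ m → 1 ≤ m →
            ∀ s c → #queries (next s c) ≤ m
    #next le k≤m 1≤m s c = #if (large p)
      (#if (level s <ᵇ L p)
        (≤-trans (#layerStep s p (padSampler (layerSampler p) (fitL (scaleOf s)) c)) (le (scaleOf s)))
        (≤-trans (#contractStep s p (padSampler (contractSampler p) (fitC (scaleOf s)) c)) k≤m))
      (≤-trans (#smallStep s) 1≤m)
      where p = sc (scaleOf s)

-- Correctness

if-elim : ∀ {A : Set} (Q : A → Set) c {x y : A} → (c ≡ true → Q x) → (c ≡ false → Q y) → Q (if c then x else y)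
if-elim Q true  t f = t refl
if-elim Q false t f = f refl

evaluate-if : ∀ {n} {A : Set} o c (p q : Par n A) →
              evaluate o (if c then p else q) ≡ (if c then evaluate o p else evaluate o q)
evaluate-if o true  p q = refl
evaluate-if o false p q = refl

allᵇ-lookup : ∀ {A : Set} {k} (p : A → Bool) (v : Vec A k) → allᵇ p v ≡ true → ∀ i → p (lookup v i) ≡ true
allᵇ-lookup p (x ∷ v) eq zero with p x | eq
... | true | _ = refl
allᵇ-lookup p (x ∷ v) eq (suc i) with p x | eq
... | true | eq' = allᵇ-lookup p v eq' i

allᵇ-fails : ∀ {A : Set} {k} (p : A → Bool) (v : Vec A k) → allᵇ (not ∘ p) v ≡ false → ∃ λ i → p (lookup v i) ≡ true
allᵇ-fails p (x ∷ v) eq with p x in px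
... | true  = zero , px
... | false with allᵇ-fails p v eq
...   | i , pi = suc i , pi

∧-true : ∀ {a b} → (a ∧ b) ≡ true → a ≡ true × b ≡ true
∧-true {true} {true} _ = refl , refl

not-true : ∀ {a} → not a ≡ true → a ≡ false
not-true {false} _ = refl

∖-⊑ : ∀ {n} (U V : Subset n) → (U ∖ V) ⊑ U
∖-⊑ U V e p = proj₁ (∧-true (trans (sym (lookup-∖ U V e)) p))

∖-out : ∀ {n} (U V : Subset n) e → lookup (U ∖ V) e ≡ true → lookup V e ≡ false
∖-out U V e p = not-true (proj₂ (∧-true (trans (sym (lookup-∖ U V e)) p)))

∖-mono : ∀ {n} {U U' : Subset n} V → U ⊑ U' → (U ∖ V) ⊑ (U' ∖ V)
∖-mono {U = U} {U'} V le e p = trans (lookup-∖ U' V e)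
  (cong₂ (λ a b → a ∧ not b) (le e (∖-⊑ U V e p)) (∖-out U V e p))

∈⇒lookup : ∀ {n} {S : Subset n} {e} → e ∈ S → lookup S e ≡ true
∈⇒lookup = []=⇒lookup

lookup⇒∈ : ∀ {n} {S : Subset n} {e} → lookup S e ≡ true → e ∈ S
lookup⇒∈ {S = S} {e} = lookup⇒[]= e S

prune-⊑ : ∀ {n J m} c (U : Subset n) (rs : Vec (Vec (Subset n) J) m) → prune c U rs ⊑ U
prune-⊑ c U []       = ⊑-refl {S = U}
prune-⊑ c U (r ∷ rs) with size (hits r) ≤ᵇ c
... | true  = λ e p → ∖-⊑ U (hits r) e (prune-⊑ c (U ∖ hits r) rs e p)
... | false = prune-⊑ c U rs

module Semantics (n k : ℕ) (sc : ℕ → Scale) (M : Matroid n) where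

  open Scale
  open State
  open Algo n k sc

  dep : Subset n → Subset n → Bool
  dep I S = not (indep M (I ∪ S))

  dep-mono : ∀ I {S T} → S ⊑ T → dep I S ≡ true → dep I T ≡ true
  dep-mono I {S} {T} le d with indep M (I ∪ T) in i
  ... | false = refl
  ... | true  = trans (cong not (sym (indep-⊆ M sub i))) d
    where
    sub : I ∪ S ⊆ I ∪ T
    sub p = x∈p∪q⁺ ([ inj₁ , (λ q → inj₂ (⊑⇒⊆ le q)) ]′ (x∈p∪q⁻ I S p))

  realRows : (s : State n) (p : Scale) → Vec (Sample (b p) n) (J p) → Vec (Subset n) (J p)
  realRows s p = Repetition.rows (dep (I s)) (dep-mono (I s)) (P p (level s)) (P p (suc (level s))) (U s)

  found : (s : State n) (p : Scale) → ∀ {m} → Repeated p m → Maybe (Subset n)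
  found s p u = Finder.find (D p) (P p (suc (level s))) (U s) u (Vec.map (realRows s p) u)

  pruned : (s : State n) (p : Scale) → ∀ {m} → Repeated p m → Subset n
  pruned s p v = prune (8 * suc (D p)) (U s) (Vec.map (realRows s p) v)

  evaluate-layer : ∀ s p c → evaluate (indep M) (layerStep s p c)
                   ≡ after s (pruned s p (proj₂ c)) (found s p (proj₁ c))
  evaluate-layer s p (u , v) = trans
    (evaluate-zip (indep M) (λ ru rv → after s (prune (8 * suc (D p)) (U s) rv) (Finder.find (D p) (P p (suc (level s))) (U s) u ru))
       (rowsOf u) (rowsOf v))
    (cong₂ (λ ru rv → after s (prune (8 * suc (D p)) (U s) rv) (Finder.find (D p) (P p (suc (level s))) (U s) u ru)) (eqs u) (eqs v))
    where
    rowOf : Sample (b p) n → Par n (Subset n)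
    rowOf = rowP (I s) (P p (level s)) (P p (suc (level s))) (U s)
    rowsOf : ∀ {m} → Repeated p m → Par n (Vec (Vec (Subset n) (J p)) m)
    rowsOf = traverse (traverse rowOf)
    eqs : ∀ {m} (v : Repeated p m) → evaluate (indep M) (rowsOf v) ≡ Vec.map (realRows s p) v
    eqs = evaluate-traverse (indep M) (traverse rowOf)
      (evaluate-traverse (indep M) rowOf (λ x → evaluate-tab n (indep M) _ (λ e → refl)))

  evaluate-contract : ∀ s p v → evaluate (indep M) (contractStep s p v)
    ≡ select s p v (Vec.map (λ x → indep M (I s ∪ drawn (P p (L p)) (U s) x)) v)
  evaluate-contract s p v = cong (select s p v)
    (evaluate-traverse (indep M) (λ x → ask₁ (I s ∪ drawn (P p (L p)) (U s) x)) (λ x → refl) v)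

  record Correct (s : State n) : Set where
    field
      I-indep : Indep M (I s)
      I∪E     : FullRank M (I s ∪ E s)
      U⊑E     : U s ⊑ E s
  open Correct

  fullRank-mono : ∀ {G G'} → G ⊆ G' → FullRank M G → FullRank M G'
  fullRank-mono le full A iA with full A iA
  ... | C , C⊆G , iC , A≤C = C , (λ p → le (C⊆G p)) , iC , A≤C

  correct-contract : ∀ {I₀ E₀ S} → Indep M (I₀ ∪ S) → FullRank M (I₀ ∪ E₀) → Correct (fresh (I₀ ∪ S) (E₀ ∖ S))
  correct-contract {I₀} {E₀} {S} i full = record
    { I-indep = i ; I∪E = fullRank-mono cover full ; U⊑E = ⊑-refl {S = E₀ ∖ S} }
    where
    cover : I₀ ∪ E₀ ⊆ (I₀ ∪ S) ∪ (E₀ ∖ S)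
    cover {x} p with x∈p∪q⁻ I₀ E₀ p | lookup S x in eq
    ... | inj₁ q | _     = x∈p∪q⁺ (inj₁ (x∈p∪q⁺ (inj₁ q)))
    ... | inj₂ q | true  = x∈p∪q⁺ (inj₁ (x∈p∪q⁺ (inj₂ (lookup⇒∈ eq))))
    ... | inj₂ q | false = x∈p∪q⁺ (inj₂ (lookup⇒∈ (trans (lookup-∖ E₀ S x) (cong₂ (λ a c → a ∧ not c) (∈⇒lookup q) eq))))

  Spanned : Subset n → Subset n → Set
  Spanned G Δ = ∀ e → lookup Δ e ≡ true → ∃ λ Q → Q ⊆ G × Indep M Q × ¬ Indep M (Q ∪ ⁅ e ⁆)

  fullRank-delete : ∀ {I₀ E₀ Δ} → Spanned (I₀ ∪ (E₀ ∖ Δ)) Δ → FullRank M (I₀ ∪ E₀) → FullRank M (I₀ ∪ (E₀ ∖ Δ))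
  fullRank-delete {I₀} {E₀} {Δ} sp full = delete-spanned M full λ e e∈ e∉ → sp e (removed e e∈ e∉)
    where
    removed : ∀ e → e ∈ I₀ ∪ E₀ → e ∉ I₀ ∪ (E₀ ∖ Δ) → lookup Δ e ≡ true
    removed e e∈ e∉ with lookup Δ e in eq | x∈p∪q⁻ I₀ E₀ e∈
    ... | true  | _ = refl
    ... | false | inj₁ q = ⊥-elim (e∉ (x∈p∪q⁺ (inj₁ q)))
    ... | false | inj₂ q = ⊥-elim (e∉ (x∈p∪q⁺ (inj₂ (lookup⇒∈ (trans (lookup-∖ E₀ Δ e)
                             (cong₂ (λ a c → a ∧ not c) (∈⇒lookup q) eq))))))

  -- If some sample detects e, take for Q the set present at its turn together with I. Each drawn y
  -- in it is below its `chain` threshold, hence below the one for `P'`, hence drawn in that sample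
  -- at the higher density and not untouched. So Q contains no element of Δ that could be deleted
  -- from under it.
  removable-spanned : ∀ s p → Correct s → (ω : Vec (Sample (b p) n) (J p)) →
    let Δ = removable (P p (suc (level s))) (U s) ω (realRows s p ω) in Spanned (I s ∪ (E s ∖ Δ)) Δ
  removable-spanned s p cor ω e e∈Δ = I s ∪ S , inside , ind , ¬ind
    where
    j = level s
    P₀ = P p j
    P' = P p (suc j)
    Δ = removable P' (U s) ω (realRows s p ω)
    parts : lookup (hits (realRows s p ω)) e ≡ true × untouched P' (U s) ω e ≡ true
    parts = ∧-true (trans (sym (lookup∘tabulate _ e)) e∈Δ)
    hitBy : ∃ λ i → lookup (lookup (realRows s p ω) i) e ≡ true
    hitBy = allᵇ-fails (λ ρ → lookup ρ e) (realRows s p ω) (not-true (trans (sym (lookup∘tabulate _ e)) (proj₁ parts)))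
    i = proj₁ hitBy
    x = lookup ω i
    S = pick (chain P₀ P' (U s) e) x
    rowEq : lookup (lookup (realRows s p ω) i) e ≡ (lookup (U s) e ∧ (not (dep (I s) S) ∧ dep (I s) (S [ e ]≔ true)))
    rowEq = trans (cong (λ ρ → lookup ρ e) (lookup-map i _ ω)) (lookup∘tabulate _ e)
    spanned : not (dep (I s) S) ≡ true × dep (I s) (S [ e ]≔ true) ≡ true
    spanned = ∧-true (proj₂ (∧-true {lookup (U s) e} (trans (sym rowEq) (proj₂ hitBy))))
    ind : Indep M (I s ∪ S)
    ind with indep M (I s ∪ S) | proj₁ spanned
    ... | true | _ = refl
    ¬ind : ¬ Indep M ((I s ∪ S) ∪ ⁅ e ⁆)
    ¬ind h = true≢false (indep-⊆ M sub h) (not-true (proj₂ spanned))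
      where
      sub : I s ∪ (S [ e ]≔ true) ⊆ (I s ∪ S) ∪ ⁅ e ⁆
      sub {y} q with x∈p∪q⁻ (I s) _ q | y ≟ e
      ... | inj₁ y∈I | _ = x∈p∪q⁺ (inj₁ (x∈p∪q⁺ (inj₁ y∈I)))
      ... | inj₂ y∈S | yes refl = x∈p∪q⁺ (inj₂ (x∈⁅x⁆ y))
      ... | inj₂ y∈S | no y≢e = x∈p∪q⁺ (inj₁ (x∈p∪q⁺ (inj₂ (lookup⇒∈
              (trans (sym (lookup∘update′ y≢e S true)) (∈⇒lookup y∈S))))))
    inside : I s ∪ S ⊆ I s ∪ (E s ∖ Δ)
    inside {y} q with x∈p∪q⁻ (I s) S q
    ... | inj₁ y∈I = x∈p∪q⁺ (inj₁ y∈I)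
    ... | inj₂ y∈S = x∈p∪q⁺ (inj₂ (lookup⇒∈ (trans (lookup-∖ (E s) Δ y)
                       (cong₂ (λ a c → a ∧ not c) (U⊑E cor y y∈U) y∉Δ))))
      where
      below : num (lookup x y) < on (U s) (const P') y
      below = <-≤-trans (<ᵇ-sound {num (lookup x y)} (trans (sym (lookup-pick _ x y)) (∈⇒lookup y∈S)))
                (≤-trans (omit-≤ e _ y) (raise (toℕ e)))
        where
        raise : ∀ j → hybrid j (on (U s) (const P₀)) (on (U s) (const P')) y ≤ on (U s) (const P') y
        raise j with toℕ y <ᵇ j
        ... | true  = ≤-refl
        ... | false with lookup (U s) y
        ...   | true  = m≤m+n P₀ _
        ...   | false = z≤n
      y∈U : lookup (U s) y ≡ true
      y∈U with lookup (U s) y | below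
      ... | true | _ = refl
      y∉Δ : lookup Δ y ≡ false
      y∉Δ with lookup Δ y in eq
      ... | false = refl
      ... | true  = true≢false (trans (lookup-pick _ x y) (<ᵇ-true below))
                      (not-true (allᵇ-lookup _ ω (proj₂ (∧-true (trans (sym (lookup∘tabulate _ y)) eq))) i))

  find-just : ∀ s p {m} (u : Repeated p m) {Δ} → found s p u ≡ just Δ →
    ∃ λ (ω : Vec (Sample (b p) n) (J p)) → (D p ≤ᵇ size Δ) ≡ true × Δ ≡ removable (P p (suc (level s))) (U s) ω (realRows s p ω)
  find-just s p (ω ∷ u) eq with D p ≤ᵇ size (removable (P p (suc (level s))) (U s) ω (realRows s p ω)) in big
  find-just s p (ω ∷ u) refl | true = ω , big , refl
  ... | false = find-just s p u eq

  correct-after : ∀ s p (c : Repeated p (n * k) × Repeated p k) → Correct s → Correct (after s (pruned s p (proj₂ c)) (found s p (proj₁ c)))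
  correct-after s p (u , v) cor with found s p u in eq
  ... | nothing = if-elim Correct (suc (layer s) ≡ᵇ k) (λ _ → smaller) (λ _ → smaller)
    where
    smaller : ∀ {j r} → Correct (state (I s) (E s) (pruned s p v) j r)
    smaller = record { I-indep = I-indep cor ; I∪E = I∪E cor
                     ; U⊑E = λ e q → U⊑E cor e (prune-⊑ (8 * suc (D p)) (U s) (Vec.map (realRows s p) v) e q) }
  ... | just Δ with find-just s p u eq
  ...   | ω , _ , refl = if-elim Correct (⌊log₂ size (E s ∖ Δ) ⌋ ≡ᵇ scaleOf s)
      (λ _ → record { I-indep = I-indep cor ; I∪E = full ; U⊑E = ∖-mono {U = U s} {E s} Δ (U⊑E cor) })
      (λ _ → record { I-indep = I-indep cor ; I∪E = full ; U⊑E = ⊑-refl {S = E s ∖ Δ} })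
    where
    full : FullRank M (I s ∪ (E s ∖ Δ))
    full = fullRank-delete {I s} {E s} {Δ} (removable-spanned s p cor ω) (I∪E cor)

  select-cases : ∀ s p {m} (v : Vec (Sample (b p) n) m) →
    let as = Vec.map (λ x → indep M (I s ∪ drawn (P p (L p)) (U s) x)) v in
    (select s p v as ≡ s × allᵇ (λ (x : Sample (b p) n) → not (indep M (I s ∪ drawn (P p (L p)) (U s) x) ∧ (ct p ≤ᵇ size (drawn (P p (L p)) (U s) x)))) v ≡ true)
    ⊎ (∃ λ (x : Sample (b p) n) → let S = drawn (P p (L p)) (U s) x in
         select s p v as ≡ fresh (I s ∪ S) (E s ∖ S) × Indep M (I s ∪ S) × (ct p ≤ᵇ size S) ≡ true)
  select-cases s p [] = inj₁ (refl , refl)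
  select-cases s p (x ∷ v) with indep M (I s ∪ drawn (P p (L p)) (U s) x) in i | ct p ≤ᵇ size (drawn (P p (L p)) (U s) x) in c
  ... | true  | true  = inj₂ (x , refl , i , c)
  ... | true  | false = select-cases s p v
  ... | false | _     = select-cases s p v

  correct-select : ∀ s p v → Correct s → Correct (select s p v (Vec.map (λ x → indep M (I s ∪ drawn (P p (L p)) (U s) x)) v))
  correct-select s p v cor with select-cases s p {k} v
  ... | inj₁ (eq , _)         = subst Correct (sym eq) cor
  ... | inj₂ (x , eq , i , _) = subst Correct (sym eq) (correct-contract {S = drawn (P p (L p)) (U s) x} i (I∪E cor))

  small : State n → State n
  small s = evaluate (indep M) (smallStep s)

  firstIn-just : ∀ {m} (S : Subset m) {e} → firstIn S ≡ just e → lookup S e ≡ true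
  firstIn-just (true ∷ S) refl = refl
  firstIn-just (false ∷ S) eq with firstIn S in f | eq
  ... | just e | refl = firstIn-just S f

  small-cases : ∀ s → Correct s → (firstIn (E s) ≡ nothing × small s ≡ s) ⊎
    (∃ λ e → lookup (E s) e ≡ true × Correct (small s) × (∃ λ I' → small s ≡ fresh I' (E s ∖ ⁅ e ⁆)))
  small-cases s cor with firstIn (E s) in f
  ... | nothing = inj₁ (refl , refl)
  ... | just e with indep M (I s ∪ ⁅ e ⁆) in i
  ...   | true  = inj₂ (e , firstIn-just (E s) f , correct-contract {S = ⁅ e ⁆} i (I∪E cor) , I s ∪ ⁅ e ⁆ , refl)
  ...   | false = inj₂ (e , firstIn-just (E s) f , record
          { I-indep = I-indep cor
          ; I∪E = fullRank-delete {I s} {E s} {⁅ e ⁆} sp (I∪E cor)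
          ; U⊑E = ⊑-refl {S = E s ∖ ⁅ e ⁆} } , I s , refl)
    where
    sp : Spanned (I s ∪ (E s ∖ ⁅ e ⁆)) ⁅ e ⁆
    sp y y∈ rewrite x∈⁅y⁆⇒x≡y e (lookup⇒∈ {S = ⁅ e ⁆} {y} y∈) = I s , p⊆p∪q (E s ∖ ⁅ e ⁆) , I-indep cor , λ h → true≢false h i

  correct-small : ∀ s → Correct s → Correct (small s)
  correct-small s cor with small-cases s cor
  ... | inj₁ (_ , eq)        = subst Correct (sym eq) cor
  ... | inj₂ (_ , _ , c , _) = c

  module Steps (B : ℕ) (fitL : ∀ σ → bits (layerSampler (sc σ)) ≤ B) (fitC : ∀ σ → bits (contractSampler (sc σ)) ≤ B) where

    open Run B fitL fitC

    layerDraw : (s : State n) → Vec Bool B → Repeated (sc (scaleOf s)) (n * k) × Repeated (sc (scaleOf s)) k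
    layerDraw s c = padSampler (layerSampler (sc (scaleOf s))) (fitL (scaleOf s)) c

    contractDraw : (s : State n) → Vec Bool B → Vec (Sample (b (sc (scaleOf s))) n) k
    contractDraw s c = padSampler (contractSampler (sc (scaleOf s))) (fitC (scaleOf s)) c

    layerResult : State n → Vec Bool B → State n
    layerResult s c = after s (pruned s (sc (scaleOf s)) (proj₂ (layerDraw s c))) (found s (sc (scaleOf s)) (proj₁ (layerDraw s c)))

    contractResult : State n → Vec Bool B → State n
    contractResult s c = select s p (contractDraw s c) (Vec.map (λ x → indep M (I s ∪ drawn (P p (L p)) (U s) x)) (contractDraw s c))
      where p = sc (scaleOf s)

    result : State n → Vec Bool B → State n
    result s c = evaluate (indep M) (next s c)

    result-cases : ∀ s c → result s c ≡ (if large (sc (scaleOf s))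
      then (if level s <ᵇ L (sc (scaleOf s)) then layerResult s c else contractResult s c) else small s)
    result-cases s c = trans (evaluate-if (indep M) (large p) _ (smallStep s))
      (cong (λ t → if large p then t else small s)
        (trans (evaluate-if (indep M) (level s <ᵇ L p) (layerStep s p (layerDraw s c)) (contractStep s p (contractDraw s c)))
          (cong₂ (λ t t' → if level s <ᵇ L p then t else t')
            (evaluate-layer s p (layerDraw s c)) (evaluate-contract s p (contractDraw s c)))))
      where p = sc (scaleOf s)

    correct-result : ∀ s c → Correct s → Correct (result s c)
    correct-result s c cor = subst Correct (sym (result-cases s c))
      (if-elim Correct (large p)
        (λ _ → if-elim Correct (level s <ᵇ L p) (λ _ → correct-after s p (layerDraw s c) cor)
                                                (λ _ → correct-select s p (contractDraw s c) cor))
        (λ _ → correct-small s cor))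
      where p = sc (scaleOf s)

    open Process result done using (success)

    ≡ᵇ0 : ∀ {m} → (m ≡ᵇ 0) ≡ true → m ≡ 0
    ≡ᵇ0 {zero} _ = refl

    empty-lookup : ∀ {m} (S : Subset m) → size S ≡ 0 → ∀ e → lookup S e ≡ false
    empty-lookup (false ∷ S) eq zero    = refl
    empty-lookup (false ∷ S) eq (suc e) = empty-lookup S eq e

    done-basis : ∀ s → Correct s → done s ≡ true → IsBasis M (I s)
    done-basis s cor d = fullRank-basis M (I-indep cor) (fullRank-mono sub (I∪E cor))
      where
      sub : I s ∪ E s ⊆ I s
      sub {x} p with x∈p∪q⁻ (I s) (E s) p
      ... | inj₁ q = q
      ... | inj₂ q = true≢false (∈⇒lookup q) (empty-lookup (E s) (≡ᵇ0 d) x)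

    descend-if : ∀ f c S t {X} → (c ≡ true → just S ≡ X) → (c ≡ false → descend M f t ≡ X) →
                 descend M f (if c then leaf S else t) ≡ X
    descend-if zero    true  S t h h' = h refl
    descend-if (suc f) true  S t h h' = h refl
    descend-if f       false S t h h' = h' refl

    success-basis : ∀ f s cs → Correct s → success f s cs ≡ true →
                    ∃ λ S → descend M f (build f s cs) ≡ just S × IsBasis M S
    success-basis zero    s []       cor d = I s , refl , done-basis s cor d
    success-basis (suc f) s (c ∷ cs) cor ok = by-cases (done s) refl
      where
      Result : Set
      Result = ∃ λ S → descend M (suc f) (build (suc f) s (c ∷ cs)) ≡ just S × IsBasis M S
      by-cases : ∀ q → done s ≡ q → Result
      by-cases true  d = I s , descend-if (suc f) (done s) (I s) _ (λ _ → refl) (λ d′ → true≢false d d′) , done-basis s cor d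
      by-cases false d = later (success-basis f (result s c) cs (correct-result s c cor) (trans (cong (_∨ success f (result s c) cs) (sym d)) ok))
        where
        later : (∃ λ S → descend M f (build f (result s c) cs) ≡ just S × IsBasis M S) → Result
        later (S , eq , basis) = S , descend-if (suc f) (done s) (I s) _ (λ d' → true≢false d' d) (λ _ → eq) , basis

-- Risk and progress

private
  half-step : ∀ n → 2 ≤ n → ⌊ n /2⌋ < n × 1 ≤ ⌊ n /2⌋
  half-step (suc (suc n)) _ = s≤s (s≤s (⌊n/2⌋≤n n)) , s≤s z≤n
  half-step (suc zero) (s≤s ())

  2*⌊/2⌋ : ∀ n → 2 * ⌊ n /2⌋ ≤ n
  2*⌊/2⌋ n = ≤-trans (+-monoʳ-≤ ⌊ n /2⌋ (≤-trans (≤-reflexive (+-identityʳ _)) (⌊n/2⌋≤⌈n/2⌉ n)))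
                     (≤-reflexive (⌊n/2⌋+⌈n/2⌉≡n n))

2^log≤ : ∀ n → 1 ≤ n → 2 ^ ⌊log₂ n ⌋ ≤ n
2^log≤ = <-rec (λ n → 1 ≤ n → 2 ^ ⌊log₂ n ⌋ ≤ n) go
  where
  go : ∀ n → (∀ {m} → m < n → 1 ≤ m → 2 ^ ⌊log₂ m ⌋ ≤ m) → 1 ≤ n → 2 ^ ⌊log₂ n ⌋ ≤ n
  go (suc zero)      ih _ = ≤-refl
  go n@(suc (suc _)) ih _ = begin
    2 ^ ⌊log₂ n ⌋                       ≡⟨ cong (2 ^_) (sym (m+[n∸m]≡n (⌊log₂⌋-mono-≤ {2} {n} (s≤s (s≤s z≤n))))) ⟩
    2 ^ (1 + (⌊log₂ n ⌋ ∸ 1))           ≡⟨ cong (λ e → 2 ^ (1 + e)) (sym (⌊log₂⌊n/2⌋⌋≡⌊log₂n⌋∸1 n)) ⟩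
    2 * 2 ^ ⌊log₂ ⌊ n /2⌋ ⌋             ≤⟨ *-monoʳ-≤ 2 (ih (proj₁ hs) (proj₂ hs)) ⟩
    2 * ⌊ n /2⌋                         ≤⟨ 2*⌊/2⌋ n ⟩
    n ∎
    where
    open ≤-Reasoning
    hs = half-step n (s≤s (s≤s z≤n))

n<2^suc-log : ∀ n → n < 2 ^ suc ⌊log₂ n ⌋
n<2^suc-log n with n <? 2 ^ suc ⌊log₂ n ⌋
... | yes lt = lt
... | no ¬lt = ⊥-elim (<-irrefl refl (≤-trans (≤-reflexive (sym (⌊log₂[2^n]⌋≡n (suc ⌊log₂ n ⌋)))) (⌊log₂⌋-mono-≤ (≮⇒≥ ¬lt))))

-- Division made total at d = 0. As a potential it counts how many removals of at least d elements
-- are still possible.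
div : ℕ → ℕ → ℕ
div e d = e / suc (pred d)

div-mono : ∀ {e e'} d → e ≤ e' → div e d ≤ div e' d
div-mono d = /-monoˡ-≤ (suc (pred d))

div-drop : ∀ {e e'} d → 1 ≤ d → e' + d ≤ e → div e' d < div e d
div-drop {e} {e'} (suc d) _ le = ≤-trans (s≤s (/-monoˡ-≤ (suc d) (m+n≤o⇒m≤o∸n e' le)))
  (≤-reflexive (sym (m/n≡1+[m∸n]/n (≤-trans (m≤n+m (suc d) e') le))))

≡ᵇ-true : ∀ {m n} → (m ≡ᵇ n) ≡ true → m ≡ n
≡ᵇ-true {m} {n} eq = ≡ᵇ⇒≡ m n (subst T (sym eq) _)

≡ᵇ-false : ∀ {m n} → (m ≡ᵇ n) ≡ false → m ≢ n
≡ᵇ-false {m} {.m} eq refl with m ≡ᵇ m | ≡⇒≡ᵇ m m refl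
≡ᵇ-false {m} {.m} () refl | true | _

≤ᵇ-true : ∀ {m n} → (m ≤ᵇ n) ≡ true → m ≤ n
≤ᵇ-true {m} {n} eq = ≤ᵇ⇒≤ m n (subst T (sym eq) _)

<ᵇ-complete : ∀ {m n} → (m <ᵇ n) ≡ false → n ≤ m
<ᵇ-complete {m} {n} eq with n ≤? m
... | yes le = le
... | no ¬le = true≢false (<ᵇ-true (≰⇒> ¬le)) eq

size-∖ : ∀ {n} (U V : Subset n) → V ⊑ U → size (U ∖ V) + size V ≡ size U
size-∖ {n} U V le = trans (sym (∑ᶠ-+ n _ _)) (∑ᶠ-cong n per)
  where
  per : ∀ e → 𝟙 (lookup (U ∖ V) e) + 𝟙 (lookup V e) ≡ 𝟙 (lookup U e)
  per e rewrite lookup-∖ U V e with lookup V e in v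
  ... | true rewrite le e v = refl
  ... | false with lookup U e
  ...   | true  = refl
  ...   | false = refl

size≤n : ∀ {n} (S : Subset n) → size S ≤ n
size≤n {n} S = ≤-trans (∑ᶠ-mono n (λ e → 𝟙≤1 (lookup S e))) (≤-reflexive (trans (∑ᶠ-const n 1) (*-identityʳ n)))

prune-hit : ∀ {n J m} c (U : Subset n) (rs : Vec (Vec (Subset n) J) m) i →
            (size (hits (lookup rs i)) ≤ᵇ c) ≡ true → prune c U rs ⊑ (U ∖ hits (lookup rs i))
prune-hit c U (r ∷ rs) zero ok with size (hits r) ≤ᵇ c
... | true = prune-⊑ c (U ∖ hits r) rs
prune-hit c U (r ∷ rs) (suc i) ok with size (hits r) ≤ᵇ c
... | false = prune-hit c U rs i ok
... | true  = λ e p → ∖-mono {U = U ∖ hits r} {U} (hits (lookup rs i)) (∖-⊑ U (hits r)) e (prune-hit c (U ∖ hits r) rs i ok e p)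

prune-size : ∀ {n J m} c (U : Subset n) (rs : Vec (Vec (Subset n) J) m) → size U ≤ size (prune c U rs) + m * c
prune-size c U [] = ≤-reflexive (sym (+-identityʳ _))
prune-size {m = suc m} c U (r ∷ rs) with size (hits r) ≤ᵇ c in ok
... | false = ≤-trans (prune-size c U rs) (+-monoʳ-≤ (size (prune c U rs)) (m≤n+m (m * c) c))
... | true  = begin
  size U                                                  ≤⟨ size-split U (hits r) ⟩
  size (hits r) + size (U ∖ hits r)                       ≤⟨ +-mono-≤ (≤ᵇ-true ok) (prune-size c (U ∖ hits r) rs) ⟩
  c + (size (prune c (U ∖ hits r) rs) + m * c)            ≡⟨ swap c (size (prune c (U ∖ hits r) rs)) (m * c) ⟩
  size (prune c (U ∖ hits r) rs) + (c + m * c) ∎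
  where
  open ≤-Reasoning
  swap : ∀ a b c → a + (b + c) ≡ b + (a + c)
  swap = solve-∀

pad-rare : ∀ {A : Set} (s : Sampler A) {B} (le : bits s ≤ B) k (f : A → ℕ) →
  2 ^ k * ∑ (outcomes s) f ≤ length (outcomes s) → 2 ^ k * ∑[ c ∈ bitStrings B ] f (padSampler s le c) ≤ length (bitStrings B)
pad-rare s {B} le k f small = begin
  2 ^ k * ∑[ c ∈ bitStrings B ] f (padSampler s le c)
    ≡⟨ cong (2 ^ k *_) (padSampler-law s le f) ⟩
  2 ^ k * (x * ∑ (outcomes s) f)
    ≡⟨ swap (2 ^ k) x (∑ (outcomes s) f) ⟩
  x * (2 ^ k * ∑ (outcomes s) f)
    ≤⟨ *-monoʳ-≤ x small ⟩
  x * length (outcomes s)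
    ≡⟨ cong (x *_) (sym (trans (∑-const (outcomes s) 1) (*-identityʳ _))) ⟩
  x * ∑[ a ∈ outcomes s ] 1
    ≡⟨ sym (padSampler-law s le (λ _ → 1)) ⟩
  ∑[ c ∈ bitStrings B ] 1
    ≡⟨ trans (∑-const (bitStrings B) 1) (*-identityʳ _) ⟩
  length (bitStrings B) ∎
  where
  open ≤-Reasoning
  x = 2 ^ (B ∸ bits s + unused s)
  swap : ∀ a b c → a * (b * c) ≡ b * (a * c)
  swap = solve-∀

-- The excess w - s - u of the risk w at the new density over the risk u at the old one at least doubles
-- with every layer; R is 2 to the number of layers and G bounds the risk before the first of them.
excess-doubles : ∀ R w s u u' G → R * w + s + u ≤ w + R * (s + G) → w + u' ≤ 2 * u + s →
                 2 * R * w + s + u' ≤ w + 2 * R * (s + G)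
excess-doubles R w s u u' G h₁ h₂ = +-cancelʳ-≤ (w + s + 2 * u) _ _ (begin
  2 * R * w + s + u' + (w + s + 2 * u)            ≡⟨ r₁ R w s u u' ⟩
  2 * (R * w + s + u) + (w + u')                  ≤⟨ +-mono-≤ (*-monoʳ-≤ 2 h₁) h₂ ⟩
  2 * (w + R * (s + G)) + (2 * u + s)             ≡⟨ r₂ R w s u G ⟩
  w + 2 * R * (s + G) + (w + s + 2 * u) ∎)
  where
  open ≤-Reasoning
  r₁ : ∀ R w s u u' → 2 * R * w + s + u' + (w + s + 2 * u) ≡ 2 * (R * w + s + u) + (w + u')
  r₁ = solve-∀
  r₂ : ∀ R w s u G → 2 * (w + R * (s + G)) + (2 * u + s) ≡ w + 2 * R * (s + G) + (w + s + 2 * u)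
  r₂ = solve-∀

-- What each condition buys: `half` keeps a detected element untouched with probability 1/2; `first`
-- and `later` supply `layer-start` and `layer-raise`; `slack≥` bounds the mass of undetected
-- spanned elements; `final` makes the risk at the top at most 1/4; `dense` and `room` make a top
-- sample large; `budget` bounds the rounds spent at one scale.
record Fits (n k C σ : ℕ) (p : Scale) : Set where
  open Scale p
  field
    D>0    : 1 ≤ D
    ct>0   : 1 ≤ ct
    J>0    : 1 ≤ J
    top>0  : 1 ≤ P L
    slack≥ : 16 * suc D ≤ J * slack
    half   : 2 * (J * P L) ≤ granularity
    first  : 2 * (setAside k * P 1) ≤ granularity
    later  : ∀ j → 1 ≤ j → j < L → 1 ≤ P j × suc k * d j ≤ P j
             × 2 * setAside k * (suc k * d j * (suc k * d j)) ≤ P j * (granularity ∸ P j)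
    final  : 4 * (3 * granularity * L + (2 ^ k * slack + 2 * n) * P L) ≤ 2 ^ k * granularity
    m      : ℕ
    dense  : 2 * granularity ≡ suc m * P L
    room   : suc m * (2 + ct) + L * k * setAside k ≤ 2 ^ σ
    budget : ∀ e → e < 2 ^ suc σ → div e D + div e ct * suc (L * k) + L * k < C

  P-mono : ∀ {j j'} → j ≤ j' → P j ≤ P j'
  P-mono {j} {zero}   z≤n = ≤-refl
  P-mono {j} {suc j'} le with m≤n⇒m<n∨m≡n le
  ... | inj₁ (s≤s lt) = ≤-trans (P-mono lt) (m≤m+n (P j') (d j'))
  ... | inj₂ refl     = ≤-refl

  2top≤N : 2 * P L ≤ granularity
  2top≤N = ≤-trans (*-monoʳ-≤ 2 (≤-trans (≤-reflexive (sym (*-identityˡ _))) (*-monoˡ-≤ (P L) J>0))) half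

  top<N : P L < granularity
  top<N = ≤-trans (+-monoʳ-≤ 1 (≤-reflexive (sym (+-identityʳ _)))) (≤-trans (+-monoˡ-≤ (P L + 0) top>0) 2top≤N)

module Progress (n k C : ℕ) (sc : ℕ → Scale) (M : Matroid n) (n>0 : 1 ≤ n) (k>0 : 1 ≤ k)
  (fits : ∀ σ → σ ≤ ⌊log₂ n ⌋ → Scale.large (sc σ) ≡ true → Fits n k C σ (sc σ))
  (tiny : ∀ σ → σ ≤ ⌊log₂ n ⌋ → Scale.large (sc σ) ≡ false → 2 ^ suc σ ≤ C)
  (B : ℕ) (fitL : ∀ σ → bits (Algo.layerSampler n k sc (sc σ)) ≤ B) (fitC : ∀ σ → bits (Algo.contractSampler n k sc (sc σ)) ≤ B) where

  open Scale
  open State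
  open Algo n k sc
  open Semantics n k sc M
  open Correct
  open Steps B fitL fitC

  scaleOf≤ : ∀ s → scaleOf s ≤ ⌊log₂ n ⌋
  scaleOf≤ s = ⌊log₂⌋-mono-≤ (size≤n (E s))

  risk : Subset n → ℕ → ℕ → Subset n → ℕ
  risk I = Layer.risk (dep I) (dep-mono I)

  module Bounds (p : Scale) where

    N = granularity p
    Z = N ^ n
    X = setAside p k

    -- Risk in units where `2 ^ k * (N * Z)` is probability 1, so that `N * Z` is 2^-k. `inc` is the
    -- error of one layer and `G` the risk allowed before a level, in the same units.
    γ : Subset n → ℕ → Subset n → ℕ
    γ I Q V = 2 ^ k * (N * risk I N Q V)

    inc : ℕ → ℕ
    inc j = (2 * N + d p j * (2 ^ k * slack p + 2 * n)) * Z

    G : ℕ → ℕ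
    G j = (3 * N * j + (2 ^ k * slack p + 2 * n) * P p j) * Z

    G-suc : ∀ j → G (suc j) ≡ N * Z + (inc j + G j)
    G-suc j = r N j (2 ^ k * slack p + 2 * n) (P p j) (d p j) Z
      where
      r : ∀ N j a P d Z → (3 * N * suc j + a * (P + d)) * Z ≡ N * Z + ((2 * N + d * a) * Z + (3 * N * j + a * P) * Z)
      r = solve-∀

    -- `excess` is the doubling in additive form: after r layers, v - inc - γ(U) is at least 2^r (v
    -- - inc - G). It holds for every V inside U because the set on which the window will end is not
    -- known yet. `sizes` charges X elements to each layer since the last restart.
    record Sized (s : State n) : Set where
      field
        level≤ : level s ≤ L p
        layer< : layer s < k
        last   : level s ≡ L p → layer s ≡ 0
        sizes  : size (E s) ≤ size (U s) + (level s * k + layer s) * X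
        excess : ∀ V → V ⊑ U s → let v = γ (I s) (P p (suc (level s))) V in
                 2 ^ layer s * v + inc (level s) + γ (I s) (P p (level s)) (U s)
                   ≤ v + 2 ^ layer s * (inc (level s) + G (level s))

    γ-mono : ∀ I {Q V V'} → Q ≤ N → V ⊑ V' → γ I Q V ≤ γ I Q V'
    γ-mono I {V = V} {V'} Q≤N le = *-monoʳ-≤ (2 ^ k) (*-monoʳ-≤ N (Layer.risk-mono (dep I) (dep-mono I) {U = V} {V'} Q≤N le))

    γ≤ : ∀ I {Q} V → Q ≤ N → γ I Q V ≤ 2 ^ k * (N * Z)
    γ≤ I V Q≤N = *-monoʳ-≤ (2 ^ k) (*-monoʳ-≤ N (Wt≤ (on-≤ V (λ _ → Q≤N)) (λ S → 𝟙≤1 _)))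

    dep-∅ : ∀ I → Indep M I → dep I (Vec.replicate n false) ≡ false
    dep-∅ I i = cong not (indep-⊆ M sub i)
      where
      sub : I ∪ ⊥ ⊆ I
      sub {x} q with x∈p∪q⁻ I ⊥ q
      ... | inj₁ r = r
      ... | inj₂ r = ⊥-elim (∉⊥ r)

    γ-zero : ∀ I V → Indep M I → γ I 0 V ≡ 0
    γ-zero I V i = trans (cong (λ z → 2 ^ k * (N * z)) (Wt-0 _ zero-threshold (cong 𝟙 (dep-∅ I i))))
                         (trans (cong (2 ^ k *_) (*-zeroʳ N)) (*-zeroʳ (2 ^ k)))
      where
      zero-threshold : ∀ e → on V (const 0) e ≡ 0
      zero-threshold e with lookup V e
      ... | true  = refl
      ... | false = refl

    -- At layer 0 the factor is 1 and v cancels, so `excess` says no more than that the current risk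
    -- is at most `G`; `layer-zero⁻` is the converse.
    layer-zero : ∀ s → layer s ≡ 0 → γ (I s) (P p (level s)) (U s) ≤ G (level s) → ∀ V →
      let v = γ (I s) (P p (suc (level s))) V in
      2 ^ layer s * v + inc (level s) + γ (I s) (P p (level s)) (U s) ≤ v + 2 ^ layer s * (inc (level s) + G (level s))
    layer-zero s refl le V = ≤-trans (+-monoʳ-≤ (1 * v + inc (level s)) le)
      (≤-reflexive (r v (inc (level s)) (G (level s))))
      where
      v = γ (I s) (P p (suc (level s))) V
      r : ∀ v i g → 1 * v + i + g ≡ v + 1 * (i + g)
      r = solve-∀

    layer-zero⁻ : ∀ s → Sized s → layer s ≡ 0 → γ (I s) (P p (level s)) (U s) ≤ G (level s)
    layer-zero⁻ s sz refl = +-cancelˡ-≤ (1 * v + inc (level s)) _ _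
      (≤-trans (Sized.excess sz (U s) (⊑-refl {S = U s})) (≤-reflexive (r v (inc (level s)) (G (level s)))))
      where
      v = γ (I s) (P p (suc (level s))) (U s)
      r : ∀ v i g → v + 1 * (i + g) ≡ 1 * v + i + g
      r = solve-∀

    sized-fresh : ∀ I E → Indep M I → Sized (fresh I E)
    sized-fresh I E i = record
      { level≤ = z≤n ; layer< = k>0 ; last = λ _ → refl ; sizes = m≤m+n (size E) 0
      ; excess = λ V _ → layer-zero (fresh I E) refl (≤-trans (≤-reflexive (γ-zero I E i)) z≤n) V }

  Inv : State n → Set
  Inv s = Correct s × (large (sc (scaleOf s)) ≡ true → Bounds.Sized (sc (scaleOf s)) s)

  inv-fresh : ∀ {I E} → Correct (fresh I E) → Inv (fresh I E)
  inv-fresh {I} {E} cor = cor , λ _ → Bounds.sized-fresh (sc ⌊log₂ size E ⌋) I E (I-indep cor)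

  -- A deletion lowers the first term, a completed layer the last. A contraction resets the last
  -- term to at most `L p * k`, which the factor `suc (L p * k)` of the second term pays for.
  largePotential : Scale → State n → ℕ
  largePotential p s = div (size (E s)) (D p) + div (size (E s)) (ct p) * suc (L p * k) + (L p * k ∸ (level s * k + layer s))

  potential : Scale → State n → ℕ
  potential p s = if large p then largePotential p s else size (E s)

  if≡true : ∀ {A : Set} {c} {x y : A} → c ≡ true → (if c then x else y) ≡ x
  if≡true refl = refl

  if≡false : ∀ {A : Set} {c} {x y : A} → c ≡ false → (if c then x else y) ≡ y
  if≡false refl = refl

  -- Lexicographic order of scale and potential in base C: when the scale falls, the new potential
  -- may be anything below C. The value 0 is reserved for finished states.
  rank : State n → ℕ
  rank s = if done s then 0 else suc (scaleOf s * C + potential (sc (scaleOf s)) s)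

  potential<C : ∀ s → potential (sc (scaleOf s)) s < C
  potential<C s = if-elim (_< C) (large p)
    (λ lg → ≤-<-trans (+-monoʳ-≤ (div (size (E s)) (D p) + div (size (E s)) (ct p) * suc (L p * k))
                          (m∸n≤m (L p * k) (level s * k + layer s)))
                      (Fits.budget (fits (scaleOf s) (scaleOf≤ s) lg) (size (E s)) (n<2^suc-log (size (E s)))))
    (λ sm → <-≤-trans (n<2^suc-log (size (E s))) (tiny (scaleOf s) (scaleOf≤ s) sm))
    where p = sc (scaleOf s)

  rank≤ : ∀ s → rank s ≤ suc ⌊log₂ n ⌋ * C
  rank≤ s = if-elim (_≤ suc ⌊log₂ n ⌋ * C) (done s) (λ _ → z≤n) (λ _ → begin
    suc (scaleOf s * C + potential (sc (scaleOf s)) s)   ≡⟨ sym (+-suc (scaleOf s * C) _) ⟩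
    scaleOf s * C + suc (potential (sc (scaleOf s)) s)   ≤⟨ +-mono-≤ (*-monoˡ-≤ C (scaleOf≤ s)) (potential<C s) ⟩
    ⌊log₂ n ⌋ * C + C                                    ≡⟨ +-comm (⌊log₂ n ⌋ * C) C ⟩
    suc ⌊log₂ n ⌋ * C ∎)
    where open ≤-Reasoning

  rank-drop : ∀ s s' → done s ≡ false → size (E s') ≤ size (E s) →
    (scaleOf s' ≡ scaleOf s → potential (sc (scaleOf s)) s' < potential (sc (scaleOf s)) s) → rank s' < rank s
  rank-drop s s' nd le decrease = subst (rank s' <_) (sym (cong (λ t → if t then 0 else suc (scaleOf s * C + potential (sc (scaleOf s)) s)) nd))
    (if-elim (_< suc (scaleOf s * C + potential (sc (scaleOf s)) s)) (done s') (λ _ → s≤s z≤n) (λ _ → s≤s below))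
    where
    below : scaleOf s' * C + potential (sc (scaleOf s')) s' < scaleOf s * C + potential (sc (scaleOf s)) s
    below with m≤n⇒m<n∨m≡n (⌊log₂⌋-mono-≤ le)
    ... | inj₂ eq = subst (λ σ → σ * C + potential (sc σ) s' < scaleOf s * C + potential (sc (scaleOf s)) s) (sym eq)
                      (+-monoʳ-< (scaleOf s * C) (decrease eq))
    ... | inj₁ lt = begin-strict
      scaleOf s' * C + potential (sc (scaleOf s')) s'   <⟨ +-monoʳ-< (scaleOf s' * C) (potential<C s') ⟩
      scaleOf s' * C + C                                ≡⟨ +-comm (scaleOf s' * C) C ⟩
      suc (scaleOf s') * C                              ≤⟨ *-monoˡ-≤ C lt ⟩
      scaleOf s * C                                     ≤⟨ m≤m+n (scaleOf s * C) _ ⟩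
      scaleOf s * C + potential (sc (scaleOf s)) s ∎
      where open ≤-Reasoning

  finished : ∀ {s} → Inv s → rank s ≡ 0 → done s ≡ true
  finished {s} _ = by-cases (done s) refl
    where
    by-cases : ∀ q → done s ≡ q → rank s ≡ 0 → done s ≡ true
    by-cases true  d _ = d
    by-cases false d z = case trans (sym (cong (λ t → if t then 0 else suc (scaleOf s * C + potential (sc (scaleOf s)) s)) d)) z of λ ()

  nonempty : ∀ s → done s ≡ false → 1 ≤ size (E s)
  nonempty s nd = n≢0⇒n>0 (≡ᵇ-false nd)

  Next : State n → State n → Set
  Next s s' = Inv s' × rank s' < rank s

  small-next : ∀ s → Inv s → done s ≡ false → large (sc (scaleOf s)) ≡ false → Next s (small s)
  small-next s (cor , _) nd sm with small-cases s cor
  ... | inj₁ (none , _) = ⊥-elim (<-irrefl (sym (firstIn-nothing (E s) none)) (nonempty s nd))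
    where
    firstIn-nothing : ∀ {m} (S : Subset m) → firstIn S ≡ nothing → size S ≡ 0
    firstIn-nothing []          _ = refl
    firstIn-nothing (false ∷ S) eq with firstIn S in f
    ... | nothing = firstIn-nothing S f
  ... | inj₂ (e , e∈E , cor' , I' , eq) = subst (Next s) (sym eq)
      (inv-fresh (subst Correct eq cor') , rank-drop s s' nd (<⇒≤ smaller)
        (λ _ → subst₂ _<_ (sym (if≡false {x = largePotential (sc (scaleOf s)) s'} sm)) (sym (if≡false {x = largePotential (sc (scaleOf s)) s} sm)) smaller))
    where
    s' = fresh I' (E s ∖ ⁅ e ⁆)
    singleton : ∀ {m} (x : Fin m) → 1 ≤ size ⁅ x ⁆
    singleton zero    = s≤s z≤n
    singleton (suc x) = singleton x
    smaller : size (E s ∖ ⁅ e ⁆) < size (E s)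
    smaller = <-≤-trans (≤-trans (≤-reflexive (+-comm 1 _)) (+-monoʳ-≤ (size (E s ∖ ⁅ e ⁆)) (singleton e)))
      (≤-reflexive (size-∖ (E s) ⁅ e ⁆ (λ y y∈ → subst (λ z → lookup (E s) z ≡ true) (sym (x∈⁅y⁆⇒x≡y e (lookup⇒∈ {S = ⁅ e ⁆} {y} y∈))) e∈E)))

  realRows-⊑ : ∀ s p ω → hits (realRows s p ω) ⊑ U s
  realRows-⊑ s p ω e h = proj₁ (∧-true (trans (sym eq) (proj₂ hitBy)))
    where
    hitBy : ∃ λ i → lookup (lookup (realRows s p ω) i) e ≡ true
    hitBy = allᵇ-fails (λ ρ → lookup ρ e) (realRows s p ω) (not-true (trans (sym (lookup∘tabulate _ e)) h))
    i = proj₁ hitBy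
    eq : lookup (lookup (realRows s p ω) i) e ≡ (lookup (U s) e ∧ _)
    eq = trans (cong (λ ρ → lookup ρ e) (lookup-map i _ ω)) (lookup∘tabulate _ e)

  removable-⊑ : ∀ s p (ω : Vec (Sample (b p) n) (J p)) → removable (P p (suc (level s))) (U s) ω (realRows s p ω) ⊑ U s
  removable-⊑ s p ω e q = realRows-⊑ s p ω e (proj₁ (∧-true (trans (sym (lookup∘tabulate _ e)) q)))

  drawn-⊑ : ∀ {b} Q V (x : Sample b n) → drawn Q V x ⊑ V
  drawn-⊑ Q V x e q with lookup V e | trans (sym (lookup-pick (on V (const Q)) x e)) q
  ... | true | _ = refl

  big good : (s : State n) (p : Scale) → Vec (Sample (b p) n) (J p) → Bool
  big s p = Repetition.big (dep (I s)) (dep-mono (I s)) {D = D p} {P p (level s)} {P p (suc (level s))} (U s)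
  good s p = Repetition.good (dep (I s)) (dep-mono (I s)) {D = D p} {P p (level s)} {P p (suc (level s))} (U s)

  find-nothing : ∀ s p {m} (u : Repeated p m) → found s p u ≡ nothing → allᵇ (not ∘ big s p) u ≡ true
  find-nothing s p []      eq = refl
  find-nothing s p (ω ∷ u) eq with D p ≤ᵇ size (removable (P p (suc (level s))) (U s) ω (realRows s p ω))
  ... | false = find-nothing s p u eq

  module LargeStep (s : State n) (inv : Inv s) (nd : done s ≡ false) (lg : large (sc (scaleOf s)) ≡ true) where

    module Ly = Layer (dep (I s)) (dep-mono (I s))
    module Rp = Repetition (dep (I s)) (dep-mono (I s))

    p : Scale
    p = sc (scaleOf s)

    open Bounds p
    open Sized

    fit : Fits n k C (scaleOf s) p
    fit = fits (scaleOf s) (scaleOf≤ s) lg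

    cor : Correct s
    cor = proj₁ inv

    sz : Sized s
    sz = proj₂ inv lg

    j = level s
    P₀ = P p j
    P' = P p (suc j)
    pos = j * k + layer s

    P≤N : ∀ {i} → i ≤ L p → P p i ≤ N
    P≤N le = ≤-trans (Fits.P-mono fit le) (<⇒≤ (Fits.top<N fit))

    potential-drop : ∀ s' → largePotential p s' < largePotential p s → potential p s' < potential p s
    potential-drop s' = subst₂ _<_ (sym (if≡true {y = size (E s')} lg)) (sym (if≡true {y = size (E s)} lg))

    next-delete : ∀ Δ → D p ≤ size Δ → Δ ⊑ U s → Correct (afterDelete s Δ) → Next s (afterDelete s Δ)
    next-delete Δ D≤ Δ⊑U cor' = by-cases (⌊log₂ size (E s ∖ Δ) ⌋ ≡ᵇ scaleOf s) refl
      where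
      sizeE : size (E s ∖ Δ) + size Δ ≡ size (E s)
      sizeE = size-∖ (E s) Δ (⊑-trans {S = Δ} {U s} {E s} Δ⊑U (U⊑E cor))
      sizeU : size (U s ∖ Δ) + size Δ ≡ size (U s)
      sizeU = size-∖ (U s) Δ Δ⊑U
      smaller : size (E s ∖ Δ) ≤ size (E s)
      smaller = ≤-trans (m≤m+n _ (size Δ)) (≤-reflexive sizeE)
      s' = state (I s) (E s ∖ Δ) (U s ∖ Δ) (level s) (layer s)
      decrease : ∀ {i r} → pos ≤ i * k + r ⊎ (i ≡ j × r ≡ layer s) → ∀ V → largePotential p (state (I s) (E s ∖ Δ) V i r) < largePotential p s
      decrease {i} {r} h V = +-mono-<-≤ (+-mono-<-≤ (div-drop (D p) (Fits.D>0 fit) (≤-trans (+-monoʳ-≤ (size (E s ∖ Δ)) D≤) (≤-reflexive sizeE)))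
          (*-monoˡ-≤ (suc (L p * k)) (div-mono (ct p) smaller)))
        (∸-monoʳ-≤ (L p * k) ([ (λ q → q) , (λ { (refl , refl) → ≤-refl }) ]′ h))
      sized' : Sized s'
      sized' = record
        { level≤ = level≤ sz ; layer< = layer< sz ; last = last sz
        ; sizes = +-cancelʳ-≤ (size Δ) _ _ (begin
            size (E s ∖ Δ) + size Δ               ≡⟨ sizeE ⟩
            size (E s)                            ≤⟨ sizes sz ⟩
            size (U s) + pos * X                  ≡⟨ cong (_+ pos * X) (sym sizeU) ⟩
            size (U s ∖ Δ) + size Δ + pos * X     ≡⟨ r (size (U s ∖ Δ)) (size Δ) (pos * X) ⟩
            size (U s ∖ Δ) + pos * X + size Δ ∎)
        -- Deletion shrinks U, which only lowers the old risk on the left; the targets V become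
        -- fewer.
        ; excess = λ V V⊑ → ≤-trans (+-monoʳ-≤ (2 ^ layer s * γ (I s) P' V + inc j)
                     (γ-mono (I s) {V = U s ∖ Δ} {U s} (P≤N (level≤ sz)) (∖-⊑ (U s) Δ)))
                     (excess sz V (⊑-trans {S = V} {U s ∖ Δ} {U s} V⊑ (∖-⊑ (U s) Δ))) }
        where
        open ≤-Reasoning
        r : ∀ a b c → a + b + c ≡ a + c + b
        r = solve-∀
      by-cases : ∀ q → (⌊log₂ size (E s ∖ Δ) ⌋ ≡ᵇ scaleOf s) ≡ q → Next s (afterDelete s Δ)
      by-cases true eq = subst (Next s) (sym (if≡true eq))
        ( (subst Correct (if≡true eq) cor' , λ _ → subst (λ σ → Bounds.Sized (sc σ) s') (sym (≡ᵇ-true eq)) sized')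
        , rank-drop s s' nd smaller (λ _ → potential-drop s' (decrease (inj₂ (refl , refl)) (U s ∖ Δ))))
      by-cases false eq = subst (Next s) (sym (if≡false eq))
        ( inv-fresh (subst Correct (if≡false eq) cor')
        , rank-drop s (fresh (I s) (E s ∖ Δ)) nd smaller (λ same → ⊥-elim (≡ᵇ-false eq same)))

    module _ (j<L : j < L p) where

      P'≤N : P' ≤ N
      P'≤N = P≤N j<L

      pos<V : pos < L p * k
      pos<V = begin-strict
        j * k + layer s    <⟨ +-monoʳ-< (j * k) (layer< sz) ⟩
        j * k + k          ≡⟨ +-comm (j * k) k ⟩
        suc j * k          ≤⟨ *-monoˡ-≤ k j<L ⟩
        L p * k ∎
        where open ≤-Reasoning

      module _ (U' : Subset n) (U'⊑U : U' ⊑ U s) (near : size (U s) ≤ size U' + X)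
               (light : J p * Rp.unhitMass N P₀ P' (U s) (U s ∖ U') ≤ 8 * (suc (D p) * Z)) where

        private
          S₀ = spanMass
            where
            spanMass : ℕ
            spanMass = ∑ᶠ n (λ e → 𝟙 (lookup U' e) * Ly.spanProb N P₀ P' (U s) e)

          same-mass : Rp.unhitMass N P₀ P' (U s) (U s ∖ U') ≡ S₀
          same-mass = ∑ᶠ-cong n (λ e → cong (λ c → 𝟙 c * Ly.spanProb N P₀ P' (U s) e) (same e))
            where
            same : ∀ e → lookup (U s ∖ (U s ∖ U')) e ≡ lookup U' e
            same e rewrite lookup-∖ (U s) (U s ∖ U') e | lookup-∖ (U s) U' e with lookup U' e in u'
            ... | true rewrite U'⊑U e u' = refl
            ... | false with lookup (U s) e
            ...   | true  = refl
            ...   | false = refl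

          2mass≤ : 2 * S₀ ≤ slack p * Z
          2mass≤ = cancelˡ {J p} _ _ (Fits.J>0 fit) (begin
            J p * (2 * S₀)             ≡⟨ r₁ (J p) S₀ ⟩
            2 * (J p * S₀)             ≤⟨ *-monoʳ-≤ 2 (subst (λ t → J p * t ≤ 8 * (suc (D p) * Z)) same-mass light) ⟩
            2 * (8 * (suc (D p) * Z))  ≡⟨ r₂ (suc (D p)) Z ⟩
            16 * suc (D p) * Z         ≤⟨ *-monoˡ-≤ Z (Fits.slack≥ fit) ⟩
            J p * slack p * Z          ≡⟨ *-assoc (J p) (slack p) Z ⟩
            J p * (slack p * Z) ∎)
            where
            open ≤-Reasoning
            r₁ : ∀ a b → a * (2 * b) ≡ 2 * (a * b)
            r₁ = solve-∀
            r₂ : ∀ d z → 2 * (8 * (d * z)) ≡ 16 * d * z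
            r₂ = solve-∀

          N>0 : 1 ≤ N
          N>0 = pow-pos {2} (b p) (s≤s z≤n)

          X>0 : 1 ≤ X
          X>0 = *-mono-≤ {1} {k} {1} {8 * suc (D p)} k>0 (s≤s z≤n)

          sizeA : size (U s ∖ U') ≤ X
          sizeA = +-cancelʳ-≤ (size U') _ _ (≤-trans (≤-reflexive (size-∖ (U s) U' U'⊑U)) (≤-trans near (≤-reflexive (+-comm (size U') X))))

          bound : Ly.LayerBound k {N} {P₀} {d p j} (U s) U' U'⊑U P'≤N
          bound with j ≟ℕ 0
          ... | yes j≡0 = Ly.layer-start k (U s) U' U'⊑U P'≤N
                  (cong (P p) j≡0) (dep-∅ (I s) (I-indep cor)) N>0
                  (≤-trans (*-monoʳ-≤ 2 (*-mono-≤ sizeA (≤-reflexive (cong (λ i → P p (suc i)) j≡0)))) (Fits.first fit))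
          ... | no j≢0 with Fits.later fit j (n≢0⇒n>0 j≢0) j<L
          ...   | P>0 , small , window = Ly.layer-raise k (U s) U' U'⊑U P'≤N
                  {2 * X} P>0 (≤-<-trans (Fits.P-mono fit (<⇒≤ j<L)) (Fits.top<N fit)) small
                  (≤-trans X>0 (m≤m+n X _)) (*-monoʳ-≤ 2 sizeA) window

          layered : ∀ V → V ⊑ U' → γ (I s) P' V + γ (I s) P₀ U' ≤ 2 * γ (I s) P₀ (U s) + inc j
          layered V V⊑ = begin
            γ (I s) P' V + γ (I s) P₀ U'
              ≤⟨ +-monoˡ-≤ _ (γ-mono (I s) {V = V} {U'} P'≤N V⊑) ⟩
            γ (I s) P' U' + γ (I s) P₀ U'
              ≡⟨ trans (sym (*-distribˡ-+ (2 ^ k) (N * g₁) (N * g₂))) (cong (2 ^ k *_) (sym (*-distribˡ-+ N g₁ g₂))) ⟩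
            2 ^ k * (N * (g₁ + g₂))
              ≤⟨ bound ⟩
            2 ^ suc k * (N * risk (I s) N P₀ (U s)) + (2 * N * Z + d p j * (2 ^ suc k * S₀ + 2 * n * Z))
              ≡⟨ cong (λ t → 2 ^ suc k * (N * risk (I s) N P₀ (U s)) + (2 * N * Z + d p j * (t + 2 * n * Z))) (r₁ (2 ^ k) S₀) ⟩
            2 ^ suc k * (N * risk (I s) N P₀ (U s)) + (2 * N * Z + d p j * (2 ^ k * (2 * S₀) + 2 * n * Z))
              ≤⟨ +-monoʳ-≤ (2 ^ suc k * (N * risk (I s) N P₀ (U s))) (+-monoʳ-≤ (2 * N * Z) (*-monoʳ-≤ (d p j) (+-monoˡ-≤ (2 * n * Z) (*-monoʳ-≤ (2 ^ k) 2mass≤)))) ⟩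
            2 ^ suc k * (N * risk (I s) N P₀ (U s)) + (2 * N * Z + d p j * (2 ^ k * (slack p * Z) + 2 * n * Z))
              ≡⟨ r₂ (2 ^ k) (N * risk (I s) N P₀ (U s)) N Z (d p j) (slack p) n ⟩
            2 * γ (I s) P₀ (U s) + inc j ∎
            where
            open ≤-Reasoning
            g₁ = risk (I s) N P' U'
            g₂ = risk (I s) N P₀ U'
            r₁ : ∀ x t → 2 * x * t ≡ x * (2 * t)
            r₁ = solve-∀
            r₂ : ∀ x g N Z d w n → 2 * x * g + (2 * N * Z + d * (x * (w * Z) + 2 * n * Z))
                 ≡ 2 * (x * g) + (2 * N + d * (x * w + 2 * n)) * Z
            r₂ = solve-∀

          doubled : ∀ V → V ⊑ U' → 2 ^ suc (layer s) * γ (I s) P' V + inc j + γ (I s) P₀ U'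
                                   ≤ γ (I s) P' V + 2 ^ suc (layer s) * (inc j + G j)
          doubled V V⊑ = excess-doubles (2 ^ layer s) (γ (I s) P' V) (inc j) (γ (I s) P₀ (U s)) (γ (I s) P₀ U') (G j)
            (excess sz V (⊑-trans {S = V} {U'} {U s} V⊑ U'⊑U)) (layered V V⊑)

          sizes' : size (E s) ≤ size U' + suc pos * X
          sizes' = ≤-trans (sizes sz) (≤-trans (+-monoˡ-≤ (pos * X) near) (≤-reflexive (+-assoc (size U') X (pos * X))))

        next-prune : Correct (afterPrune s U') → Next s (afterPrune s U')
        next-prune cor' = by-cases (suc (layer s) ≡ᵇ k) refl
          where
          decrease : ∀ {i r} → i * k + r ≡ suc pos → largePotential p (state (I s) (E s) U' i r) < largePotential p s
          decrease {i} {r} eq = +-monoʳ-< (div (size (E s)) (D p) + div (size (E s)) (ct p) * suc (L p * k))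
            (subst (λ t → L p * k ∸ t < L p * k ∸ pos) (sym eq) (∸-monoʳ-< {L p * k} {suc pos} {pos} (n<1+n pos) pos<V))
          by-cases : ∀ q → (suc (layer s) ≡ᵇ k) ≡ q → Next s (afterPrune s U')
          by-cases false eq = subst (Next s) (sym (if≡false eq))
            ( (subst Correct (if≡false eq) cor' , λ _ → record
                { level≤ = level≤ sz ; layer< = ≤∧≢⇒< (layer< sz) (≡ᵇ-false eq)
                ; last = λ e → ⊥-elim (<-irrefl e j<L)
                ; sizes = subst (λ t → size (E s) ≤ size U' + t * X) (sym (+-suc (j * k) (layer s))) sizes'
                ; excess = doubled })
            , rank-drop s s″ nd ≤-refl (λ _ → potential-drop s″ (decrease {j} {suc (layer s)} (+-suc (j * k) (layer s)))))
            where
            s″ = state (I s) (E s) U' j (suc (layer s))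
          by-cases true eq = subst (Next s) (sym (if≡true eq))
            ( (subst Correct (if≡true eq) cor' , λ _ → record
                { level≤ = j<L ; layer< = k>0 ; last = λ _ → refl
                ; sizes = subst (λ t → size (E s) ≤ size U' + t * X) (sym pos') sizes'
                ; excess = λ V _ → layer-zero s' refl complete V })
            , rank-drop s s' nd ≤-refl (λ _ → potential-drop s' (decrease {suc j} {0} pos')))
            where
            s' = state (I s) (E s) U' (suc j) 0
            full : suc (layer s) ≡ k
            full = ≡ᵇ-true eq
            pos' : suc j * k + 0 ≡ suc pos
            pos' = trans (+-identityʳ (suc j * k)) (trans (+-comm k (j * k)) (trans (cong (j * k +_) (sym full)) (+-suc (j * k) (layer s))))
            -- After k layers the excess has grown by 2^k but is still at most `2 ^ k * (N * Z)`.
            -- Dividing by 2^k leaves a risk of at most N Z + inc + G, which is `G (suc j)`.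
            complete : γ (I s) P' U' ≤ G (suc j)
            complete = cancelˡ _ _ (pow-pos {2} k (s≤s z≤n)) (begin
              2 ^ k * v
                ≤⟨ ≤-trans (m≤m+n (2 ^ k * v) (inc j)) (m≤m+n _ (γ (I s) P₀ U')) ⟩
              2 ^ k * v + inc j + γ (I s) P₀ U'
                ≤⟨ subst (λ t → 2 ^ t * v + inc j + γ (I s) P₀ U' ≤ v + 2 ^ t * (inc j + G j)) full (doubled U' (⊑-refl {S = U'})) ⟩
              v + 2 ^ k * (inc j + G j)
                ≤⟨ +-monoˡ-≤ _ (γ≤ (I s) U' P'≤N) ⟩
              2 ^ k * (N * Z) + 2 ^ k * (inc j + G j)
                ≡⟨ trans (sym (*-distribˡ-+ (2 ^ k) (N * Z) (inc j + G j))) (cong (2 ^ k *_) (sym (G-suc j))) ⟩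
              2 ^ k * G (suc j) ∎)
              where
              open ≤-Reasoning
              v = γ (I s) P' U'

      next-after : ∀ U' f → Correct (after s U' f) →
        (∀ Δ → f ≡ just Δ → Correct (afterDelete s Δ) → Next s (afterDelete s Δ)) →
        (f ≡ nothing → Correct (afterPrune s U') → Next s (afterPrune s U')) → Next s (after s U' f)
      next-after U' (just Δ) cor' h h' = h Δ refl cor'
      next-after U' nothing  cor' h h' = h' refl cor'

      good-hits : ∀ ω → good s p ω ≡ true → size (hits (realRows s p ω)) ≤ 8 * suc (D p)
        × J p * Rp.unhitMass N P₀ P' (U s) (hits (realRows s p ω)) ≤ 8 * (suc (D p) * Z)
      good-hits ω ok = split (Z * size H) (J p * unhit) (≤ᵇ-true ok) ≤-refl ≤-refl
        where
        H = hits (realRows s p ω)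
        unhit = Rp.unhitMass N P₀ P' (U s) H
        split : ∀ a c → a + c ≤ 8 * (suc (D p) * Z) → Z * size H ≤ a → J p * unhit ≤ c →
                size H ≤ 8 * suc (D p) × J p * unhit ≤ 8 * (suc (D p) * Z)
        split a c le ha hc =
          cancelˡ _ _ (pow-pos {N} n (pow-pos {2} (b p) (s≤s z≤n))) (≤-trans ha (≤-trans (m+n≤o⇒m≤o a le) (≤-reflexive (r (suc (D p)) Z))))
          , ≤-trans hc (m+n≤o⇒n≤o a le)
          where
          r : ∀ a z → 8 * (a * z) ≡ z * (8 * a)
          r = solve-∀

      -- Unhit mass is a sum over the elements left in U, so setting aside further hit sets beside H
      -- can only lower it.
      unhit-mono : ∀ H U' → U' ⊑ (U s ∖ H) →
        Rp.unhitMass N P₀ P' (U s) (U s ∖ U') ≤ Rp.unhitMass N P₀ P' (U s) H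
      unhit-mono H U' U'⊑ = ∑ᶠ-mono n (λ e → *-monoˡ-≤ (Ly.spanProb N P₀ P' (U s) e) (below e))
        where
        below : ∀ e → 𝟙 (lookup (U s ∖ (U s ∖ U')) e) ≤ 𝟙 (lookup (U s ∖ H) e)
        below e rewrite lookup-∖ (U s) (U s ∖ U') e | lookup-∖ (U s) U' e with lookup U' e in u'
        ... | true rewrite U'⊑ e u' = 𝟙≤1 _
        ... | false with lookup (U s) e
        ...   | true  = z≤n
        ...   | false = z≤n

      prune-good : ∀ {m} (v : Repeated p m) i → size (hits (realRows s p (lookup v i))) ≤ 8 * suc (D p) →
                   pruned s p v ⊑ (U s ∖ hits (realRows s p (lookup v i)))
      prune-good v i le = subst (λ ρ → pruned s p v ⊑ (U s ∖ hits ρ)) rowsEq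
        (prune-hit (8 * suc (D p)) (U s) (Vec.map (realRows s p) v) i
          (subst (λ ρ → (size (hits ρ) ≤ᵇ 8 * suc (D p)) ≡ true) (sym rowsEq) (≤ᵇ-complete le)))
        where
        rowsEq : lookup (Vec.map (realRows s p) v) i ≡ realRows s p (lookup v i)
        rowsEq = lookup-map i (realRows s p) v

      light-prune : ∀ {m} (v : Repeated p m) i → good s p (lookup v i) ≡ true →
        J p * Rp.unhitMass N P₀ P' (U s) (U s ∖ pruned s p v) ≤ 8 * (suc (D p) * Z)
      light-prune v i g = ≤-trans (*-monoʳ-≤ (J p)
          (unhit-mono (hits (realRows s p (lookup v i))) (pruned s p v) (prune-good v i (proj₁ (good-hits (lookup v i) g)))))
        (proj₂ (good-hits (lookup v i) g))

      next-layer : ∀ c → (allᵇ (not ∘ big s p) (proj₁ c) ∧ allᵇ (not ∘ good s p) (proj₂ c)) ≡ false →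
                   Next s (after s (pruned s p (proj₂ c)) (found s p (proj₁ c)))
      next-layer (u , v) ok = next-after (pruned s p v) (found s p u) (correct-after s p (u , v) cor) delete keep
        where
        delete : ∀ Δ → found s p u ≡ just Δ → Correct (afterDelete s Δ) → Next s (afterDelete s Δ)
        delete Δ eq cor' = finish (find-just s p u eq)
          where
          finish : (∃ λ (ω : Vec (Sample (b p) n) (J p)) → (D p ≤ᵇ size Δ) ≡ true × Δ ≡ removable P' (U s) ω (realRows s p ω)) → Next s (afterDelete s Δ)
          finish (ω , D≤ , Δ≡) = next-delete Δ (≤ᵇ-true D≤) (subst (_⊑ U s) (sym Δ≡) (removable-⊑ s p ω)) cor'
        some-good : found s p u ≡ nothing → ∃ λ i → good s p (lookup v i) ≡ true
        some-good eq = allᵇ-fails (good s p) v (trans (cong (_∧ allᵇ (not ∘ good s p) v) (sym (find-nothing s p u eq))) ok)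
        keep : found s p u ≡ nothing → Correct (afterPrune s (pruned s p v)) → Next s (afterPrune s (pruned s p v))
        keep eq = next-prune (pruned s p v) (prune-⊑ (8 * suc (D p)) (U s) (Vec.map (realRows s p) v))
          (prune-size (8 * suc (D p)) (U s) (Vec.map (realRows s p) v)) (light-prune v (proj₁ (some-good eq)) (proj₂ (some-good eq)))

      rare-layer : 2 ^ k * ∑[ c ∈ outcomes (layerSampler p) ] 𝟙 (allᵇ (not ∘ big s p) (proj₁ c) ∧ allᵇ (not ∘ good s p) (proj₂ c))
                   ≤ length (outcomes (layerSampler p))
      rare-layer = begin
        2 ^ k * ∑[ c ∈ outcomes (layerSampler p) ] f c
          ≡⟨ cong (2 ^ k *_) (∑-prod _,_ (outcomes (repeatSampler p (n * k))) (outcomes (repeatSampler p k)) f) ⟩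
        2 ^ k * ∑[ u ∈ outcomes (repeatSampler p (n * k)) ] ∑[ v ∈ outcomes (repeatSampler p k) ] f (u , v)
          ≡⟨ cong₂ (λ xs ys → 2 ^ k * ∑[ u ∈ xs ] ∑[ v ∈ ys ] f (u , v)) (outcomesR (n * k)) (outcomesR k) ⟩
        2 ^ k * ∑[ u ∈ vecs Ω (n * k) ] ∑[ v ∈ vecs Ω k ] f (u , v)
          ≤⟨ Rp.both-miss {D = D p} (U s) (P≤N (level≤ sz)) P'≤N
               (≤-trans (*-monoʳ-≤ 2 (*-monoʳ-≤ (J p) (Fits.P-mono fit j<L))) (Fits.half fit)) k n>0 ⟩
        (Z ^ J p) ^ (n * k) * (Z ^ J p) ^ k
          ≡⟨ sym (trans (length-prod _,_ (outcomes (repeatSampler p (n * k))) (outcomes (repeatSampler p k)))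
               (cong₂ _*_ (lengthR (n * k)) (lengthR k))) ⟩
        length (outcomes (layerSampler p)) ∎
        where
        open ≤-Reasoning
        Ω = vecs (samples (b p) n) (J p)
        f : Repeated p (n * k) × Repeated p k → ℕ
        f c = 𝟙 (allᵇ (not ∘ big s p) (proj₁ c) ∧ allᵇ (not ∘ good s p) (proj₂ c))
        outcomesR : ∀ m → outcomes (repeatSampler p m) ≡ vecs Ω m
        outcomesR m = trans (outcomes-vec (vecSampler (sampleSampler p) (J p)) m)
          (cong (λ xs → vecs xs m) (trans (outcomes-vec (sampleSampler p) (J p))
            (cong (λ xs → vecs xs (J p)) (outcomes-vec (bitSampler (b p)) n))))
        lengthR : ∀ m → length (outcomes (repeatSampler p m)) ≡ (Z ^ J p) ^ m
        lengthR m = trans (cong length (outcomesR m)) (trans (length-vecs Ω m) (cong (_^ m)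
          (Rp.#outcomes {b p} {J p} {D p} {P₀} {P'} (U s))))

    module _ (j≡L : j ≡ L p) where

      ok : Sample (b p) n → Bool
      ok x = indep M (I s ∪ drawn (P p (L p)) (U s) x) ∧ (ct p ≤ᵇ size (drawn (P p (L p)) (U s) x))

      pos≡ : pos ≡ L p * k
      pos≡ = trans (cong₂ (λ a c → a * k + c) j≡L (last sz j≡L)) (+-identityʳ _)

      next-contract : ∀ v → allᵇ (not ∘ ok) v ≡ false →
        Next s (select s p v (Vec.map (λ x → indep M (I s ∪ drawn (P p (L p)) (U s) x)) v))
      next-contract v some with select-cases s p {k} v
      ... | inj₁ (_ , none) = true≢false none some
      ... | inj₂ (x , eq , i , c) = subst (Next s) (sym eq)
          ( inv-fresh (correct-contract {S = S} i (I∪E cor))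
          , rank-drop s s' nd (≤-trans (m≤m+n _ (size S)) (≤-reflexive sizeE)) (λ _ → potential-drop s' decrease))
        where
        S = drawn (P p (L p)) (U s) x
        s' = fresh (I s ∪ S) (E s ∖ S)
        sizeE : size (E s ∖ S) + size S ≡ size (E s)
        sizeE = size-∖ (E s) S (⊑-trans {S = S} {U s} {E s} (drawn-⊑ (P p (L p)) (U s) x) (U⊑E cor))
        e' = size (E s ∖ S)
        V = L p * k
        decrease : div e' (D p) + div e' (ct p) * suc V + V < largePotential p s
        decrease = begin-strict
          div e' (D p) + div e' (ct p) * suc V + V
            <⟨ ≤-reflexive (r (div e' (D p)) (div e' (ct p)) V) ⟩
          div e' (D p) + suc (div e' (ct p)) * suc V
            ≤⟨ +-mono-≤ (div-mono (D p) (≤-trans (m≤m+n e' (size S)) (≤-reflexive sizeE)))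
                        (*-monoˡ-≤ (suc V) (div-drop (ct p) (Fits.ct>0 fit) (≤-trans (+-monoʳ-≤ e' (≤ᵇ-true c)) (≤-reflexive sizeE)))) ⟩
          div (size (E s)) (D p) + div (size (E s)) (ct p) * suc V
            ≤⟨ m≤m+n _ (V ∸ pos) ⟩
          largePotential p s ∎
          where
          open ≤-Reasoning
          r : ∀ a c V → suc (a + c * suc V + V) ≡ a + suc c * suc V
          r = solve-∀

      -- A draw fails by being dependent, with probability at most 1/4 by `final` and the risk bound
      -- at the top, or by being too small, at most 1/4 by `small-set`. All k draws fail with
      -- probability at most 2^-k.
      rare-contract : 2 ^ k * ∑[ v ∈ outcomes (contractSampler p) ] 𝟙 (allᵇ (not ∘ ok) v) ≤ length (outcomes (contractSampler p))
      rare-contract = begin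
        2 ^ k * ∑[ v ∈ outcomes (contractSampler p) ] 𝟙 (allᵇ (not ∘ ok) v)
          ≡⟨ cong (λ vs → 2 ^ k * ∑[ v ∈ vs ] 𝟙 (allᵇ (not ∘ ok) v)) outcomesC ⟩
        2 ^ k * ∑[ v ∈ vecs xs k ] 𝟙 (allᵇ (not ∘ ok) v)
          ≡⟨ cong (2 ^ k *_) (∑-allᵇ xs (not ∘ ok) k) ⟩
        2 ^ k * (∑[ x ∈ xs ] 𝟙 (not (ok x))) ^ k
          ≤⟨ miss-half k half-miss ⟩
        Z ^ k
          ≡⟨ sym (trans (cong length outcomesC) (trans (length-vecs xs k) (cong (_^ k) #xs))) ⟩
        length (outcomes (contractSampler p)) ∎
        where
        open ≤-Reasoning
        xs = samples (b p) n
        Q = P p (L p)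
        Q≤N : Q ≤ N
        Q≤N = P≤N ≤-refl
        outcomesC : outcomes (contractSampler p) ≡ vecs xs k
        outcomesC = trans (outcomes-vec (sampleSampler p) k) (cong (λ ys → vecs ys k) (outcomes-vec (bitSampler (b p)) n))
        #xs : length xs ≡ Z
        #xs = trans (length-vecs (bitStrings (b p)) n) (cong (_^ n) (length-bitStrings (b p)))
        dependent few : Subset n → ℕ
        dependent S = 𝟙 (dep (I s) S)
        few S = 𝟙 (size S <ᵇ ct p)
        per : ∀ x → 𝟙 (not (ok x)) ≤ dependent (drawn Q (U s) x) + few (drawn Q (U s) x)
        per x with indep M (I s ∪ drawn Q (U s) x) | ct p ≤ᵇ size (drawn Q (U s) x) in c
        ... | false | _     = s≤s z≤n
        ... | true  | true  = z≤n
        ... | true  | false = ≤-reflexive (sym (cong 𝟙 (<ᵇ-true {size (drawn Q (U s) x)} {ct p} (≰⇒> λ le → true≢false (≤ᵇ-complete le) c))))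
        4risk≤ : 4 * risk (I s) N Q (U s) ≤ Z
        4risk≤ = cancelˡ _ _ (*-mono-≤ (pow-pos {2} k (s≤s z≤n)) (pow-pos {2} (b p) (s≤s z≤n))) (begin
          2 ^ k * N * (4 * risk (I s) N Q (U s))
            ≡⟨ r₁ (2 ^ k) N (risk (I s) N Q (U s)) ⟩
          4 * γ (I s) Q (U s)
            ≤⟨ *-monoʳ-≤ 4 (subst (λ i → γ (I s) (P p i) (U s) ≤ G i) j≡L (layer-zero⁻ s sz (last sz j≡L))) ⟩
          4 * G (L p)
            ≡⟨ sym (*-assoc 4 (3 * N * L p + (2 ^ k * slack p + 2 * n) * Q) Z) ⟩
          4 * (3 * N * L p + (2 ^ k * slack p + 2 * n) * Q) * Z
            ≤⟨ *-monoˡ-≤ Z (Fits.final fit) ⟩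
          2 ^ k * N * Z ∎)
          where
          r₁ : ∀ x N g → x * N * (4 * g) ≡ 4 * (x * (N * g))
          r₁ = solve-∀
        big-enough : suc (Fits.m fit) * (2 + ct p) ≤ size (U s)
        big-enough = +-cancelʳ-≤ (L p * k * X) _ _ (begin
          suc (Fits.m fit) * (2 + ct p) + L p * k * X   ≤⟨ Fits.room fit ⟩
          2 ^ scaleOf s                                 ≤⟨ 2^log≤ (size (E s)) (nonempty s nd) ⟩
          size (E s)                                    ≤⟨ sizes sz ⟩
          size (U s) + pos * X                          ≡⟨ cong (λ t → size (U s) + t * X) pos≡ ⟩
          size (U s) + L p * k * X ∎)
        4few≤ : 4 * Wt N (on (U s) (const Q)) few ≤ Z
        4few≤ = small-set {m = Fits.m fit} (ct p) (U s) (Fits.top>0 fit) Q≤N (Fits.dense fit) big-enough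
        half-miss : 2 * ∑[ x ∈ xs ] 𝟙 (not (ok x)) ≤ Z
        half-miss = cancelˡ {2} _ _ (s≤s z≤n) (begin
          2 * (2 * ∑[ x ∈ xs ] 𝟙 (not (ok x)))
            ≤⟨ *-monoʳ-≤ 2 (*-monoʳ-≤ 2 (∑-mono xs per)) ⟩
          2 * (2 * ∑[ x ∈ xs ] (dependent (drawn Q (U s) x) + few (drawn Q (U s) x)))
            ≡⟨ cong (λ t → 2 * (2 * t)) (trans (∑-+ xs _ _) (cong₂ _+_ (∑-pick (b p) (on-≤ (U s) (λ _ → Q≤N)) dependent)
                                                                       (∑-pick (b p) (on-≤ (U s) (λ _ → Q≤N)) few))) ⟩
          2 * (2 * (risk (I s) N Q (U s) + Wt N (on (U s) (const Q)) few))
            ≡⟨ r₂ (risk (I s) N Q (U s)) (Wt N (on (U s) (const Q)) few) ⟩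
          4 * risk (I s) N Q (U s) + 4 * Wt N (on (U s) (const Q)) few
            ≤⟨ +-mono-≤ 4risk≤ 4few≤ ⟩
          Z + Z
            ≡⟨ cong (Z +_) (sym (+-identityʳ Z)) ⟩
          2 * Z ∎)
          where
          r₂ : ∀ a b → 2 * (2 * (a + b)) ≡ 4 * a + 4 * b
          r₂ = solve-∀

  badLayer badContract bad : State n → Vec Bool B → Bool
  badLayer s c = let p = sc (scaleOf s) in
    allᵇ (not ∘ big s p) (proj₁ (layerDraw s c)) ∧ allᵇ (not ∘ good s p) (proj₂ (layerDraw s c))
  badContract s c = let p = sc (scaleOf s) in
    allᵇ (λ x → not (indep M (I s ∪ drawn (P p (L p)) (U s) x) ∧ (ct p ≤ᵇ size (drawn (P p (L p)) (U s) x)))) (contractDraw s c)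
  bad s = if large (sc (scaleOf s))
    then (if level s <ᵇ L (sc (scaleOf s)) then badLayer s else badContract s)
    else (λ _ → false)

  at-top : ∀ s → Inv s → large (sc (scaleOf s)) ≡ true → (level s <ᵇ L (sc (scaleOf s))) ≡ false → level s ≡ L (sc (scaleOf s))
  at-top s inv lg ge = ≤-antisym (Bounds.Sized.level≤ (proj₂ inv lg)) (<ᵇ-complete ge)

  rare : ∀ {s} → Inv s → done s ≡ false → 2 ^ k * ∑[ c ∈ bitStrings B ] 𝟙 (bad s c) ≤ length (bitStrings B)
  rare {s} inv nd = if-elim Q (large p)
      (λ lg → if-elim Q (level s <ᵇ L p)
        (λ lt → pad-rare (layerSampler p) (fitL (scaleOf s)) k
                  (λ c → 𝟙 (allᵇ (not ∘ big s p) (proj₁ c) ∧ allᵇ (not ∘ good s p) (proj₂ c)))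
                  (LargeStep.rare-layer s inv nd lg (<ᵇ-sound lt)))
        (λ ge → pad-rare (contractSampler p) (fitC (scaleOf s)) k
                  (λ v → 𝟙 (allᵇ (λ x → not (indep M (I s ∪ drawn (P p (L p)) (U s) x) ∧ (ct p ≤ᵇ size (drawn (P p (L p)) (U s) x)))) v))
                  (LargeStep.rare-contract s inv nd lg (at-top s inv lg ge))))
      (λ _ → ≤-trans (≤-reflexive (trans (cong (2 ^ k *_) (∑-0 (bitStrings B))) (*-zeroʳ (2 ^ k)))) z≤n)
    where
    p = sc (scaleOf s)
    Q : (Vec Bool B → Bool) → Set
    Q h = 2 ^ k * ∑[ c ∈ bitStrings B ] 𝟙 (h c) ≤ length (bitStrings B)

  progress : ∀ {s} c → Inv s → done s ≡ false → bad s c ≡ false → Next s (result s c)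
  progress {s} c inv nd ok = subst (Next s) (sym (result-cases s c)) (by-large (large p) refl)
    where
    p = sc (scaleOf s)
    by-level : large p ≡ true → ∀ q → (level s <ᵇ L p) ≡ q →
      Next s (if level s <ᵇ L p then layerResult s c else contractResult s c)
    by-level lg true lt = subst (Next s) (sym (if≡true lt)) (LargeStep.next-layer s inv nd lg (<ᵇ-sound lt) (layerDraw s c)
      (trans (sym (trans (cong (λ h → h c) (if≡true {x = if level s <ᵇ L p then badLayer s else badContract s} lg))
                         (cong (λ h → h c) (if≡true {x = badLayer s} lt)))) ok))
    by-level lg false ge = subst (Next s) (sym (if≡false ge)) (LargeStep.next-contract s inv nd lg (at-top s inv lg ge) (contractDraw s c)
      (trans (sym (trans (cong (λ h → h c) (if≡true {x = if level s <ᵇ L p then badLayer s else badContract s} lg))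
                         (cong (λ h → h c) (if≡false {x = badLayer s} {badContract s} ge)))) ok))
    by-large : ∀ q → large p ≡ q → Next s (if large p
      then (if level s <ᵇ L p then layerResult s c else contractResult s c) else small s)
    by-large true  lg = subst (Next s) (sym (if≡true lg)) (by-level lg (level s <ᵇ L p) refl)
    by-large false sm = subst (Next s) (sym (if≡false sm)) (small-next s inv nd sm)

-- Choice of the parameters

≥-* : ∀ {m n} → 1 ≤ m → 1 ≤ n → 1 ≤ m * n
≥-* = *-mono-≤

div-≤ : ∀ {e d} q → 1 ≤ d → e ≤ q * d → div e d ≤ q
div-≤ {e} {suc d} q _ le = ≤-trans (/-monoˡ-≤ (suc d) le) (≤-reflexive (m*n/n≡m q (suc d)))

n<2^n : ∀ n → n < 2 ^ n
n<2^n zero    = s≤s z≤n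
n<2^n (suc n) = ≤-trans (+-mono-≤ (pow-pos {2} n (s≤s z≤n)) (n<2^n n)) (≤-reflexive (cong (2 ^ n +_) (sym (+-identityʳ (2 ^ n)))))

-- k is polylogarithmic in n and v is about the seventh root of the size of the universe; the density
-- after j + 1 levels is (8 k + j) ^ 2 / 2 ^ b, which ends at 1 / (64 v ^ 2).
concrete : ℕ → ℕ → Scale
concrete a τ = record
  -- `2 ^ b` is 4096 k^4 v^4 = 64 v^2 Q^2, where Q = 8 k^2 v is the last square root. So J times the
  -- top density is 1/2. A universe of about v^7 elements allows about v^3 deletions and v^2
  -- contractions. The test k^2 ≤ v makes the up to 128 k^4 v^5 elements set aside fit within 128
  -- v^7.
  { large = k * k ≤ᵇ v ; b = 12 + a * 4 + τ * 4 ; J = 32 * (v * v) ; D = v * v * (v * v)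
  ; L = suc (8 * (k * k * v) ∸ 8 * k) ; ct = v * v * (v * v) * v ; slack = v * v
  -- Differences of consecutive squares. Starting from the root 8 k makes the later steps satisfy (k
  -- + 1) d ≤ P.
  ; d = λ { zero → 8 * k * (8 * k) ; (suc j) → suc (2 * (8 * k + j)) } }
  where
  k = 2 ^ a
  v = 2 ^ τ

-- In sixteenths of `E * N`, the accumulated likelihood tails take 4 and the other two terms 1 each.
-- The middle term is slack times top density, w q/N = 1/64.
final-arith : ∀ N L E w n q → 48 * L ≤ E → 2 * n ≤ E → N ≡ 64 * w * q → 1 ≤ w →
              4 * (3 * N * L + (E * w + 2 * n) * q) ≤ E * N
final-arith N L E w n q L≤ n≤ N≡ w>0 = cancelˡ {16} _ _ (s≤s z≤n) (begin
  16 * (4 * (3 * N * L + (E * w + 2 * n) * q))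
    ≡⟨ r₁ N L E w n q ⟩
  4 * (N * (48 * L)) + E * (64 * w * q) + 64 * (2 * n) * q
    ≤⟨ +-mono-≤ (+-mono-≤ (*-monoʳ-≤ 4 (*-monoʳ-≤ N L≤)) (*-monoʳ-≤ E (≤-reflexive (sym N≡))))
                (≤-trans (*-monoˡ-≤ q (*-monoʳ-≤ 64 n≤)) light) ⟩
  4 * (N * E) + E * N + E * N
    ≤⟨ m≤m+n _ (10 * (E * N)) ⟩
  4 * (N * E) + E * N + E * N + 10 * (E * N)
    ≡⟨ r₂ N E ⟩
  16 * (E * N) ∎)
  where
  open ≤-Reasoning
  light : 64 * E * q ≤ E * N
  light = ≤-trans (*-monoˡ-≤ q (*-monoʳ-≤ 64 (≤-trans (≤-reflexive (sym (*-identityʳ E))) (*-monoʳ-≤ E w>0))))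
    (≤-reflexive (trans (r E w q) (cong (E *_) (sym N≡))))
    where
    r : ∀ e w q → 64 * (e * w) * q ≡ e * (64 * w * q)
    r = solve-∀
  r₁ : ∀ N L E w n q → 16 * (4 * (3 * N * L + (E * w + 2 * n) * q))
       ≡ 4 * (N * (48 * L)) + E * (64 * w * q) + 64 * (2 * n) * q
  r₁ = solve-∀
  r₂ : ∀ N E → 4 * (N * E) + E * N + E * N + 10 * (E * N) ≡ 16 * (E * N)
  r₂ = solve-∀

module Concrete (n a τ σ C : ℕ) (k≤v : 2 ^ a * 2 ^ a ≤ 2 ^ τ) (n≤ : 2 * n ≤ 2 ^ (2 ^ a))
  (long : 384 * (2 ^ a * 2 ^ a * 2 ^ τ) ≤ 2 ^ (2 ^ a))
  (many : (2 ^ τ) ^ 7 * 2 ^ 14 ≤ 2 ^ σ) (few : 2 ^ suc σ ≤ (2 ^ τ) ^ 7 * 2 ^ 21)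
  (C≥ : 2 ^ a * 2 ^ a * 2 ^ a * (2 ^ τ * 2 ^ τ * 2 ^ τ) * 2 ^ 27 ≤ C) where

  private
    k v Q i₀ : ℕ
    k = 2 ^ a
    v = 2 ^ τ
    Q = 8 * (k * k * v)
    i₀ = 8 * k
    p = concrete a τ
  open Scale p

  private
    k>0 : 1 ≤ k
    k>0 = pow-pos {2} a (s≤s z≤n)

    v>0 : 1 ≤ v
    v>0 = pow-pos {2} τ (s≤s z≤n)

    k≤k : ∀ x → 1 ≤ x → k ≤ k * x
    k≤k x h = ≤-trans (≤-reflexive (sym (*-identityʳ k))) (*-monoʳ-≤ k h)

    i₀≤Q : i₀ ≤ Q
    i₀≤Q = *-monoʳ-≤ 8 (≤-trans (k≤k k k>0) (≤-trans (≤-reflexive (sym (*-identityʳ (k * k)))) (*-monoʳ-≤ (k * k) v>0)))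

    square : ∀ j → P (suc j) ≡ (i₀ + j) * (i₀ + j)
    square zero    = cong₂ _*_ (sym (+-identityʳ i₀)) (sym (+-identityʳ i₀))
    square (suc j) = trans (cong (_+ suc (2 * (i₀ + j))) (square j)) (trans (r (i₀ + j)) (cong (λ t → t * t) (sym (+-suc i₀ j))))
      where
      r : ∀ t → t * t + suc (2 * t) ≡ suc t * suc t
      r = solve-∀

    top : P L ≡ Q * Q
    top = trans (square (Q ∸ i₀)) (cong (λ t → t * t) (m+[n∸m]≡n i₀≤Q))

    N = granularity

    N≡ : N ≡ 64 * (v * v) * (Q * Q)
    N≡ = trans (trans (^-distribˡ-+-* 2 (12 + a * 4) (τ * 4))
                 (cong₂ _*_ (trans (^-distribˡ-+-* 2 12 (a * 4)) (cong (2 ^ 12 *_) (sym (^-*-assoc 2 a 4)))) (sym (^-*-assoc 2 τ 4))))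
               (r k v)
      where
      r : ∀ k v → 4096 * (k * (k * (k * (k * 1)))) * (v * (v * (v * (v * 1)))) ≡ 64 * (v * v) * (8 * (k * k * v) * (8 * (k * k * v)))
      r = solve-∀

    Q>0 : 1 ≤ Q
    Q>0 = ≤-trans (≥-* {8} {k} (s≤s z≤n) k>0) i₀≤Q

    X≤ : setAside k ≤ 16 * (k * D)
    X≤ = ≤-trans (*-monoʳ-≤ k (*-monoʳ-≤ 8 (+-monoˡ-≤ D D>0'))) (≤-reflexive (r k D))
      where
      D>0' : 1 ≤ D
      D>0' = ≥-* (≥-* v>0 v>0) (≥-* v>0 v>0)
      r : ∀ k d → k * (8 * (d + d)) ≡ 16 * (k * d)
      r = solve-∀

    L≤Q : L ≤ Q
    L≤Q = ≤-trans (s≤s (∸-monoʳ-≤ Q (≥-* {8} {k} (s≤s z≤n) k>0))) (≤-reflexive (m+[n∸m]≡n Q>0))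

    P≤½ : ∀ j → suc j ≤ L → 2 * P (suc j) ≤ N
    P≤½ j (s≤s le) = begin
      2 * P (suc j)                   ≡⟨ cong (2 *_) (square j) ⟩
      2 * ((i₀ + j) * (i₀ + j))       ≤⟨ *-monoʳ-≤ 2 (*-mono-≤ t≤Q t≤Q) ⟩
      2 * (Q * Q)                     ≤⟨ *-monoˡ-≤ (Q * Q) (≤-trans (s≤s (s≤s z≤n)) (*-monoʳ-≤ 64 (≥-* v>0 v>0))) ⟩
      64 * (v * v) * (Q * Q)          ≡⟨ sym N≡ ⟩
      N ∎
      where
      open ≤-Reasoning
      t≤Q : i₀ + j ≤ Q
      t≤Q = ≤-trans (+-monoʳ-≤ i₀ le) (≤-reflexive (m+[n∸m]≡n i₀≤Q))

    steps-later : ∀ j → 1 ≤ j → j < L → 1 ≤ P j × suc k * d j ≤ P j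
                  × 2 * setAside k * (suc k * d j * (suc k * d j)) ≤ P j * (N ∸ P j)
    steps-later (suc i) _ j<L = subst (1 ≤_) (sym (square i)) (≥-* t>0 t>0) , small , window
      where
      open ≤-Reasoning
      t = i₀ + i
      t>0 : 1 ≤ t
      t>0 = ≤-trans (≥-* {8} {k} (s≤s z≤n) k>0) (m≤m+n i₀ i)
      κd≤ : suc k * d (suc i) ≤ 6 * (k * t)
      κd≤ = ≤-trans (*-mono-≤ (+-monoˡ-≤ k k>0) (+-monoˡ-≤ (2 * t) t>0)) (≤-reflexive (r k t))
        where
        r : ∀ k t → (k + k) * (t + 2 * t) ≡ 6 * (k * t)
        r = solve-∀
      small : suc k * d (suc i) ≤ P (suc i)
      small = begin
        suc k * d (suc i)     ≤⟨ κd≤ ⟩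
        6 * (k * t)           ≤⟨ *-monoˡ-≤ (k * t) (m≤m+n 6 2) ⟩
        8 * (k * t)           ≡⟨ sym (*-assoc 8 k t) ⟩
        i₀ * t                ≤⟨ *-monoˡ-≤ t (m≤m+n i₀ i) ⟩
        t * t                 ≡⟨ sym (square i) ⟩
        P (suc i) ∎
      rest : N ≤ 2 * (N ∸ P (suc i))
      rest = begin
        N                           ≡⟨ sym (m+n∸n≡m N N) ⟩
        N + N ∸ N                   ≤⟨ ∸-monoʳ-≤ (N + N) (P≤½ i (<⇒≤ j<L)) ⟩
        N + N ∸ 2 * P (suc i)       ≡⟨ cong (λ z → N + z ∸ 2 * P (suc i)) (sym (+-identityʳ N)) ⟩
        2 * N ∸ 2 * P (suc i)       ≡⟨ sym (*-distribˡ-∸ 2 N (P (suc i))) ⟩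
        2 * (N ∸ P (suc i)) ∎
      window : 2 * setAside k * (suc k * d (suc i) * (suc k * d (suc i))) ≤ P (suc i) * (N ∸ P (suc i))
      window = cancelˡ {2} _ _ (s≤s z≤n) (begin
        2 * (2 * setAside k * (suc k * d (suc i) * (suc k * d (suc i))))
          ≤⟨ *-monoʳ-≤ 2 (*-mono-≤ (*-monoʳ-≤ 2 X≤) (*-mono-≤ κd≤ κd≤)) ⟩
        2 * (2 * (16 * (k * D)) * (6 * (k * t) * (6 * (k * t))))
          ≡⟨ r₁ k D t ⟩
        t * t * (D * (k * (k * k))) * 2304
          -- 2304 is 2 * 2 * 16 * 36: the outer 2 pays for N ≤ 2 (N - P), the inner one is the 2 in
          -- M, 16 comes from the set-aside bound and 36 from the squared step. It fits under the
          -- 4096 in `2 ^ b`, as k^3 does under k^4.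
          ≤⟨ *-monoʳ-≤ (t * t * (D * (k * (k * k)))) (m≤m+n 2304 1792) ⟩
        t * t * (D * (k * (k * k))) * 4096
          ≤⟨ *-monoˡ-≤ 4096 (*-monoʳ-≤ (t * t) (*-monoʳ-≤ D (*-monoˡ-≤ (k * k) (k≤k k k>0)))) ⟩
        t * t * (D * (k * k * (k * k))) * 4096
          ≡⟨ r₂ k v t ⟩
        t * t * (64 * (v * v) * (Q * Q))
          ≡⟨ cong₂ _*_ (sym (square i)) (sym N≡) ⟩
        P (suc i) * N
          ≤⟨ *-monoʳ-≤ (P (suc i)) rest ⟩
        P (suc i) * (2 * (N ∸ P (suc i)))
          ≡⟨ r₃ (P (suc i)) (N ∸ P (suc i)) ⟩
        2 * (P (suc i) * (N ∸ P (suc i))) ∎)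
        where
        r₁ : ∀ k d t → 2 * (2 * (16 * (k * d)) * (6 * (k * t) * (6 * (k * t)))) ≡ t * t * (d * (k * (k * k))) * 2304
        r₁ = solve-∀
        r₂ : ∀ k v t → t * t * (v * v * (v * v) * (k * k * (k * k))) * 4096
             ≡ t * t * (64 * (v * v) * (8 * (k * k * v) * (8 * (k * k * v))))
        r₂ = solve-∀
        r₃ : ∀ a b → a * (2 * b) ≡ 2 * (a * b)
        r₃ = solve-∀

    top-half : 2 * (J * P L) ≤ N
    top-half = ≤-reflexive (trans (cong (λ t → 2 * (J * t)) top) (trans (r (v * v) (Q * Q)) (sym N≡)))
      where
      r : ∀ w q → 2 * (32 * w * q) ≡ 64 * w * q
      r = solve-∀

    first-step : 2 * (setAside k * P 1) ≤ N
    first-step = begin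
      2 * (setAside k * (8 * k * (8 * k)))
        ≤⟨ *-monoʳ-≤ 2 (*-monoˡ-≤ (8 * k * (8 * k)) X≤) ⟩
      2 * (16 * (k * D) * (8 * k * (8 * k)))
        ≡⟨ r₁ k D ⟩
      D * (k * (k * k)) * 2048
        ≤⟨ *-mono-≤ (*-monoʳ-≤ D (*-monoˡ-≤ (k * k) (k≤k k k>0))) (m≤m+n 2048 2048) ⟩
      D * (k * k * (k * k)) * 4096
        ≡⟨ r₂ k v ⟩
      64 * (v * v) * (Q * Q)
        ≡⟨ sym N≡ ⟩
      N ∎
      where
      open ≤-Reasoning
      r₁ : ∀ k d → 2 * (16 * (k * d) * (8 * k * (8 * k))) ≡ d * (k * (k * k)) * 2048
      r₁ = solve-∀
      r₂ : ∀ k v → v * v * (v * v) * (k * k * (k * k)) * 4096 ≡ 64 * (v * v) * (8 * (k * k * v) * (8 * (k * k * v)))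
      r₂ = solve-∀

    E = 2 ^ k

    48L≤E : 48 * L ≤ E
    48L≤E = ≤-trans (*-monoʳ-≤ 48 L≤Q) (≤-trans (≤-reflexive (r (k * k * v))) long)
      where
      r : ∀ x → 48 * (8 * x) ≡ 384 * x
      r = solve-∀

    final-risk : 4 * (3 * N * L + (E * (v * v) + 2 * n) * P L) ≤ E * N
    final-risk = subst (λ q → 4 * (3 * N * L + (E * (v * v) + 2 * n) * q) ≤ E * N) (sym top)
      (final-arith N L E (v * v) n (Q * Q) 48L≤E n≤ N≡ (≥-* v>0 v>0))

    m+1 : suc (pred (128 * (v * v))) ≡ 128 * (v * v)
    m+1 = suc-pred′ (≥-* {128} (s≤s z≤n) (≥-* v>0 v>0))
      where
      suc-pred′ : ∀ {x} → 1 ≤ x → suc (pred x) ≡ x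
      suc-pred′ {suc x} _ = refl

    v⁷ : ℕ
    v⁷ = v * v * v * v * (v * v * v)

    v⁷≡ : v ^ 7 ≡ v⁷
    v⁷≡ = r v
      where
      r : ∀ v → v * (v * (v * (v * (v * (v * (v * 1)))))) ≡ v * v * v * v * (v * v * v)
      r = solve-∀

    -- The contraction takes 128 v^2 (2 + v^5) ≤ 384 v^7. The elements set aside number at most 128
    -- k^4 v^5, and k^2 ≤ v turns this into 128 v^7.
    enough-room : suc (pred (128 * (v * v))) * (2 + ct) + L * k * setAside k ≤ 2 ^ σ
    enough-room = begin
      suc (pred (128 * (v * v))) * (2 + ct) + L * k * setAside k
        ≡⟨ cong (λ t → t * (2 + ct) + L * k * setAside k) m+1 ⟩
      128 * (v * v) * (2 + ct) + L * k * setAside k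
        ≤⟨ +-mono-≤ first-part (*-mono-≤ (*-monoˡ-≤ k L≤Q) X≤) ⟩
      v⁷ * 384 + Q * k * (16 * (k * D))
        ≡⟨ cong (v⁷ * 384 +_) (r₂ k v) ⟩
      v⁷ * 384 + v * v * (v * v) * v * (k * k * (k * k)) * 128
        ≤⟨ +-monoʳ-≤ (v⁷ * 384) (*-monoˡ-≤ 128 (*-monoʳ-≤ (v * v * (v * v) * v) (*-mono-≤ k≤v k≤v))) ⟩
      v⁷ * 384 + v * v * (v * v) * v * (v * v) * 128
        ≡⟨ r₃ v ⟩
      v⁷ * 512
        ≤⟨ *-monoʳ-≤ v⁷ (m≤m+n 512 15872) ⟩
      v⁷ * 2 ^ 14
        ≡⟨ cong (_* 2 ^ 14) (sym v⁷≡) ⟩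
      v ^ 7 * 2 ^ 14
        ≤⟨ many ⟩
      2 ^ σ ∎
      where
      open ≤-Reasoning
      first-part : 128 * (v * v) * (2 + ct) ≤ v⁷ * 384
      first-part = ≤-trans (*-monoʳ-≤ (128 * (v * v)) (+-monoˡ-≤ ct (*-monoʳ-≤ 2 ct>0')))
        (≤-reflexive (r₁ v))
        where
        ct>0' : 1 ≤ ct
        ct>0' = ≥-* (≥-* (≥-* v>0 v>0) (≥-* v>0 v>0)) v>0
        r₁ : ∀ v → 128 * (v * v) * (2 * (v * v * (v * v) * v) + v * v * (v * v) * v) ≡ v * v * v * v * (v * v * v) * 384
        r₁ = solve-∀
      r₂ : ∀ k v → 8 * (k * k * v) * k * (16 * (k * (v * v * (v * v)))) ≡ v * v * (v * v) * v * (k * k * (k * k)) * 128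
      r₂ = solve-∀
      r₃ : ∀ v → v * v * v * v * (v * v * v) * 384 + v * v * (v * v) * v * (v * v) * 128 ≡ v * v * v * v * (v * v * v) * 512
      r₃ = solve-∀

    c₀ : ℕ
    c₀ = 2 ^ 21

    -- Three kinds of rounds cost at most t each: deletions, the layers before all contractions, and
    -- one unfinished sweep of layers. The fourth t pays for the strict inequality.
    cheap : ∀ e → e < 2 ^ suc σ → div e D + div e ct * suc (L * k) + L * k < C
    cheap e e< = <-≤-trans (begin-strict
      div e D + div e ct * suc (L * k) + L * k
        ≤⟨ +-mono-≤ (+-mono-≤ (div-≤ (v³ * c₀) D>0' (≤-trans e≤ (≤-reflexive (r₁ v c₀))))
                              (*-mono-≤ (div-≤ (v * v * c₀) ct>0' (≤-trans e≤ (≤-reflexive (r₂ v c₀)))) sucLk≤))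
                    (≤-trans (n≤1+n (L * k)) sucLk≤) ⟩
      v³ * c₀ + v * v * c₀ * (16 * (k³ * v)) + 16 * (k³ * v)
        ≤⟨ +-mono-≤ (+-mono-≤ t₁ (≤-reflexive (r₃ k v c₀))) t₃ ⟩
      t + t + t
        <⟨ ≤-trans (≤-reflexive (+-comm 1 (t + t + t))) (+-monoʳ-≤ (t + t + t) t>0) ⟩
      t + t + t + t
        ≡⟨ r₄ (k³ * v³) c₀ ⟩
      k³ * v³ * (64 * c₀) ∎) C≥
      where
      open ≤-Reasoning
      v³ = v * v * v
      k³ = k * k * k
      t = k³ * v³ * (16 * c₀)
      D>0' : 1 ≤ D
      D>0' = ≥-* (≥-* v>0 v>0) (≥-* v>0 v>0)
      ct>0' : 1 ≤ ct
      ct>0' = ≥-* D>0' v>0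
      k³>0 : 1 ≤ k³
      k³>0 = ≥-* (≥-* k>0 k>0) k>0
      v³>0 : 1 ≤ v³
      v³>0 = ≥-* (≥-* v>0 v>0) v>0
      c₀>0 : 1 ≤ c₀
      c₀>0 = pow-pos {2} 21 (s≤s z≤n)
      t>0 : 1 ≤ t
      t>0 = ≥-* (≥-* k³>0 v³>0) (≥-* {16} (s≤s z≤n) c₀>0)
      e≤ : e ≤ v⁷ * c₀
      e≤ = ≤-trans (<⇒≤ e<) (≤-trans few (≤-reflexive (cong (_* c₀) v⁷≡)))
      r₁ : ∀ v c → v * v * v * v * (v * v * v) * c ≡ v * v * v * c * (v * v * (v * v))
      r₁ = solve-∀
      r₂ : ∀ v c → v * v * v * v * (v * v * v) * c ≡ v * v * c * (v * v * (v * v) * v)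
      r₂ = solve-∀
      r₃ : ∀ k v c → v * v * c * (16 * (k * k * k * v)) ≡ k * k * k * (v * v * v) * (16 * c)
      r₃ = solve-∀
      r₄ : ∀ x c → x * (16 * c) + x * (16 * c) + x * (16 * c) + x * (16 * c) ≡ x * (64 * c)
      r₄ = solve-∀
      Lk≤ : L * k ≤ 8 * (k³ * v)
      Lk≤ = ≤-trans (*-monoˡ-≤ k L≤Q) (≤-reflexive (r k v))
        where
        r : ∀ k v → 8 * (k * k * v) * k ≡ 8 * (k * k * k * v)
        r = solve-∀
      sucLk≤ : suc (L * k) ≤ 16 * (k³ * v)
      sucLk≤ = ≤-trans (+-mono-≤ (≥-* {8} (s≤s z≤n) (≥-* k³>0 v>0)) Lk≤) (≤-reflexive (r (k³ * v)))
        where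
        r : ∀ x → 8 * x + 8 * x ≡ 16 * x
        r = solve-∀
      t₁ : v³ * c₀ ≤ t
      t₁ = *-mono-≤ (≤-trans (≤-reflexive (sym (*-identityˡ v³))) (*-monoˡ-≤ v³ k³>0)) (m≤m+n c₀ (15 * c₀))
      t₃ : 16 * (k³ * v) ≤ t
      t₃ = ≤-trans (≤-trans (≤-reflexive (*-comm 16 (k³ * v)))
             (*-mono-≤ (*-monoʳ-≤ k³ (≤-trans (≤-reflexive (sym (*-identityˡ v))) (*-monoˡ-≤ v (≥-* v>0 v>0))))
                       (≤-trans (≤-reflexive (sym (*-identityʳ 16))) (*-monoʳ-≤ 16 c₀>0)))) ≤-refl

  concrete-fits : Fits n k C σ (concrete a τ)
  concrete-fits = record
    { D>0 = ≥-* (≥-* v>0 v>0) (≥-* v>0 v>0)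
    ; ct>0 = ≥-* (≥-* (≥-* v>0 v>0) (≥-* v>0 v>0)) v>0
    ; J>0 = ≥-* {32} (s≤s z≤n) (≥-* v>0 v>0)
    ; top>0 = subst (1 ≤_) (sym top) (≥-* Q>0 Q>0)
    ; slack≥ = ≤-trans (*-monoʳ-≤ 16 (+-monoˡ-≤ (v * v * (v * v)) (≥-* (≥-* v>0 v>0) (≥-* v>0 v>0)))) (≤-reflexive (r v))
    ; half = top-half
    ; first = first-step
    ; later = steps-later
    ; final = final-risk
    ; m = pred (128 * (v * v))
    ; dense = trans (cong (2 *_) N≡) (trans (r' (v * v) (Q * Q)) (cong₂ _*_ (sym m+1) (sym top)))
    ; room = enough-room
    ; budget = cheap }
    where
    r : ∀ v → 16 * (v * v * (v * v) + v * v * (v * v)) ≡ 32 * (v * v) * (v * v)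
    r = solve-∀
    r' : ∀ w q → 2 * (64 * w * q) ≡ 128 * w * q
    r' = solve-∀

-- Assembling the algorithm and its success probability

bits-unique : ∀ k → Unique (bitStrings k)
bits-unique zero    = [] ∷ []
bits-unique (suc k) = cartesianProductWith⁺ _∷_ ∷-injective (((λ ()) ∷ []) ∷ [] ∷ []) (bits-unique k)

length-filter : ∀ {A : Set} (f : A → Bool) xs → length (filter (λ x → f x Bool.≟ true) xs) ≡ ∑[ x ∈ xs ] 𝟙 (f x)
length-filter f []       = refl
length-filter f (x ∷ xs) with f x
... | true  = cong suc (length-filter f xs)
... | false = length-filter f xs

module Assembly (n k C : ℕ) (f : ℕ → Scale) where

  lg R : ℕ
  lg = ⌊log₂ n ⌋
  R = suc lg * C

  -- Scales above log n do not occur; cutting them off makes the coin bound B hold for every σ.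
  scale : ℕ → Scale
  scale σ = f (σ ⊓ lg)

  open Algo n k scale using (layerSampler; contractSampler)

  sumTo : ℕ → (ℕ → ℕ) → ℕ
  sumTo zero    f = f 0
  sumTo (suc m) f = f (suc m) + sumTo m f

  ≤-sumTo : ∀ {i} m f → i ≤ m → f i ≤ sumTo m f
  ≤-sumTo zero    f z≤n = ≤-refl
  ≤-sumTo (suc m) f le with m≤n⇒m<n∨m≡n le
  ... | inj₁ (s≤s lt) = ≤-trans (≤-sumTo m f lt) (m≤n+m _ (f (suc m)))
  ... | inj₂ refl     = m≤m+n (f (suc m)) (sumTo m f)

  layerBits contractBits : ℕ → ℕ
  layerBits i = bits (layerSampler (f i))
  contractBits i = bits (contractSampler (f i))

  B : ℕ
  B = sumTo lg layerBits + sumTo lg contractBits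

  fitL : ∀ σ → bits (layerSampler (scale σ)) ≤ B
  fitL σ = ≤-trans (≤-sumTo lg layerBits (m⊓n≤n σ lg)) (m≤m+n (sumTo lg layerBits) (sumTo lg contractBits))

  fitC : ∀ σ → bits (contractSampler (scale σ)) ≤ B
  fitC σ = ≤-trans (≤-sumTo lg contractBits (m⊓n≤n σ lg)) (m≤n+m (sumTo lg contractBits) (sumTo lg layerBits))

  open Algo.Run n k scale B fitL fitC using (next; build; build-bounded; #next)

  initial : State n
  initial = fresh ⊥ ⊤

  coinSampler : Sampler (Vec (Vec Bool B) R)
  coinSampler = vecSampler (bitSampler B) R

  tree : Vec Bool (bits coinSampler) → Tree n
  tree r = build R initial (decode coinSampler r)

  tree-bounded : ∀ {m} → (∀ σ → (n * k + k) * (Scale.J (f (σ ⊓ lg)) * (n * 2)) ≤ m) → k * 1 ≤ m → 1 ≤ m → ∀ r → Bounded m (tree r)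
  tree-bounded le k≤m 1≤m r = build-bounded (#next le k≤m 1≤m) R initial (decode coinSampler r)

  module Success (k>0 : 1 ≤ k) (nR≤2^k : n * R ≤ 2 ^ k)
    (f-fits : ∀ σ → σ ≤ lg → Scale.large (f σ) ≡ true → Fits n k C σ (f σ))
    (f-tiny : ∀ σ → σ ≤ lg → Scale.large (f σ) ≡ false → 2 ^ suc σ ≤ C) (M : Matroid n) (n>0 : 1 ≤ n) where

    fits : ∀ σ → σ ≤ lg → Scale.large (scale σ) ≡ true → Fits n k C σ (scale σ)
    fits σ le = subst (λ i → Scale.large (f i) ≡ true → Fits n k C σ (f i)) (sym (m≤n⇒m⊓n≡m le)) (f-fits σ le)

    tiny : ∀ σ → σ ≤ lg → Scale.large (scale σ) ≡ false → 2 ^ suc σ ≤ C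
    tiny σ le = subst (λ i → Scale.large (f i) ≡ false → 2 ^ suc σ ≤ C) (sym (m≤n⇒m⊓n≡m le)) (f-tiny σ le)

    open Semantics n k scale M using (Correct; module Steps)
    open Steps B fitL fitC using (result; success-basis)
    open Progress n k C scale M n>0 k>0 fits tiny B fitL fitC using (Inv; inv-fresh; rank; rank≤; bad; finished; rare; progress)
    open Process result (Algo.done n k scale)

    initial-correct : Correct initial
    initial-correct = record
      { I-indep = indep-∅ M ; I∪E = λ A iA → A , (λ p → q⊆p∪q ⊥ ⊤ (⊆⊤ p)) , iA , ≤-refl ; U⊑E = ⊑-refl {S = ⊤} }

    ok : Vec Bool (bits coinSampler) → Bool
    ok r = success R initial (decode coinSampler r)

    ok-basis : ∀ r → ok r ≡ true → ∃ λ S → run (follow (tree r)) M R [] ≡ just S × IsBasis M S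
    ok-basis r q with success-basis R initial (decode coinSampler r) initial-correct q
    ... | S , eq , basis = S , trans (run-follow M R (tree r)) eq , basis

    -- `failure-rare` over R rounds gives failure probability at most R/2^k, and this is at most 1/n
    -- by the choice of k. The law of the sampler carries the count from outcomes to coin strings.
    failures : n * ∑[ r ∈ bitStrings (bits coinSampler) ] 𝟙 (not (ok r)) ≤ 2 ^ bits coinSampler
    failures = begin
      n * ∑[ r ∈ bitStrings (bits coinSampler) ] 𝟙 (not (ok r))
        ≡⟨ cong (n *_) (fair coinSampler fail) ⟩
      n * (x * ∑ (outcomes coinSampler) fail)
        ≡⟨ swap n x (∑ (outcomes coinSampler) fail) ⟩
      x * (n * ∑ (outcomes coinSampler) fail)
        ≤⟨ *-monoʳ-≤ x (cancelˡ _ _ (pow-pos {2} k (s≤s z≤n)) core) ⟩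
      x * length (outcomes coinSampler)
        ≡⟨ cong (x *_) (sym (trans (∑-const (outcomes coinSampler) 1) (*-identityʳ _))) ⟩
      x * ∑[ o ∈ outcomes coinSampler ] 1
        ≡⟨ sym (fair coinSampler (λ _ → 1)) ⟩
      ∑[ r ∈ bitStrings (bits coinSampler) ] 1
        ≡⟨ trans (∑-const (bitStrings (bits coinSampler)) 1) (trans (*-identityʳ _) (length-bitStrings (bits coinSampler))) ⟩
      2 ^ bits coinSampler ∎
      where
      open ≤-Reasoning
      x = 2 ^ unused coinSampler
      swap : ∀ a b c → a * (b * c) ≡ b * (a * c)
      swap = solve-∀
      fail : Vec (Vec Bool B) R → ℕ
      fail cs = 𝟙 (not (success R initial cs))
      Z = length (bitStrings B)
      outs : outcomes coinSampler ≡ vecs (bitStrings B) R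
      outs = outcomes-vec (bitSampler B) R
      core : 2 ^ k * (n * ∑ (outcomes coinSampler) fail) ≤ 2 ^ k * length (outcomes coinSampler)
      core = begin
        2 ^ k * (n * ∑ (outcomes coinSampler) fail)
          ≡⟨ swap (2 ^ k) n (∑ (outcomes coinSampler) fail) ⟩
        n * (2 ^ k * ∑ (outcomes coinSampler) fail)
          ≡⟨ cong (λ os → n * (2 ^ k * ∑ os fail)) outs ⟩
        n * (2 ^ k * ∑ (vecs (bitStrings B) R) fail)
          ≤⟨ *-monoʳ-≤ n (failure-rare k (bitStrings B) Inv rank bad (λ {s} → finished {s}) (λ {s} → rare {s}) (λ {s} → progress {s}) R initial
               (inv-fresh initial-correct) (rank≤ initial)) ⟩
        n * (R * Z ^ R)
          ≡⟨ sym (*-assoc n R (Z ^ R)) ⟩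
        n * R * Z ^ R
          ≤⟨ *-monoˡ-≤ (Z ^ R) nR≤2^k ⟩
        2 ^ k * Z ^ R
          ≡⟨ cong (2 ^ k *_) (sym (trans (cong length outs) (length-vecs (bitStrings B) R))) ⟩
        2 ^ k * length (outcomes coinSampler) ∎

    successes : (n ∸ 1) * 2 ^ bits coinSampler ≤ n * length (filter (λ r → ok r Bool.≟ true) (bitStrings (bits coinSampler)))
    successes = begin
      (n ∸ 1) * all                            ≡⟨ *-distribʳ-∸ all n 1 ⟩
      n * all ∸ 1 * all                          ≡⟨ cong₂ (λ p q → n * p ∸ q) (sym total) (*-identityˡ all) ⟩
      n * (good + fails) ∸ all                 ≡⟨ cong (_∸ all) (*-distribˡ-+ n good fails) ⟩
      n * good + n * fails ∸ all               ≤⟨ ∸-monoˡ-≤ all (+-monoʳ-≤ (n * good) failures) ⟩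
      n * good + all ∸ all                       ≡⟨ m+n∸n≡m (n * good) all ⟩
      n * good                               ≡⟨ cong (n *_) (sym (length-filter ok (bitStrings (bits coinSampler)))) ⟩
      n * length (filter (λ r → ok r Bool.≟ true) (bitStrings (bits coinSampler))) ∎
      where
      open ≤-Reasoning
      all = 2 ^ bits coinSampler
      good = ∑[ r ∈ bitStrings (bits coinSampler) ] 𝟙 (ok r)
      fails = ∑[ r ∈ bitStrings (bits coinSampler) ] 𝟙 (not (ok r))
      total : good + fails ≡ all
      total = trans (sym (∑-+ (bitStrings (bits coinSampler)) _ _)) (trans (∑-cong (bitStrings (bits coinSampler)) (λ r → 𝟙-not (ok r)))
        (trans (∑-const (bitStrings (bits coinSampler)) 1) (trans (*-identityʳ _) (length-bitStrings (bits coinSampler)))))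

-- Polylogarithmic precision and the round count

log≤ : ∀ n → ⌊log₂ n ⌋ ≤ n
log≤ zero    = z≤n
log≤ (suc m) = <⇒≤ (<-≤-trans (n<2^n ⌊log₂ suc m ⌋) (2^log≤ (suc m) (s≤s z≤n)))

2^log≤suc : ∀ n → 2 ^ ⌊log₂ n ⌋ ≤ suc n
2^log≤suc zero    = ≤-refl
2^log≤suc (suc m) = ≤-trans (2^log≤ (suc m) (s≤s z≤n)) (n≤1+n (suc m))

layer-queries : ∀ n k v m → suc n ≡ m → k ≤ 256 * m → v ≤ m → (n * k + k) * (32 * (v * v) * (n * 2)) ≤ m ^ 5 * 16384
layer-queries n k v m eq k≤ v≤ = begin
  (n * k + k) * (32 * (v * v) * (n * 2))
    ≤⟨ *-mono-≤ (≤-trans (≤-reflexive (trans (+-comm (n * k) k) (cong (_* k) eq))) (*-monoʳ-≤ m k≤))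
                (*-mono-≤ (*-monoʳ-≤ 32 (*-mono-≤ v≤ v≤)) (*-monoˡ-≤ 2 (≤-trans (n≤1+n n) (≤-reflexive eq)))) ⟩
  m * (256 * m) * (32 * (m * m) * (m * 2))
    ≡⟨ r m ⟩
  m ^ 5 * 16384 ∎
  where
  open ≤-Reasoning
  r : ∀ m → m * (256 * m) * (32 * (m * m) * (m * 2)) ≡ m * (m * (m * (m * (m * 1)))) * 16384
  r = solve-∀

draw-queries : ∀ k m → 1 ≤ m → k ≤ 256 * m → k * 1 ≤ m ^ 5 * 16384
draw-queries k m m>0 k≤ = begin
  k * 1               ≡⟨ *-identityʳ k ⟩
  k                   ≤⟨ k≤ ⟩
  256 * m             ≡⟨ trans (*-comm 256 m) (cong (_* 256) (sym (*-identityʳ m))) ⟩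
  m * 1 * 256         ≤⟨ *-mono-≤ (*-monoʳ-≤ m (pow-pos 4 m>0)) (m≤m+n 256 16128) ⟩
  m ^ 5 * 16384 ∎
  where open ≤-Reasoning

one-query : ∀ m → 1 ≤ m → 1 ≤ m ^ 5 * 16384
one-query m m>0 = *-mono-≤ {1} {m ^ 5} {1} {16384} (pow-pos 5 m>0) (s≤s z≤n)

module Precision (n : ℕ) where

  private
    ℓ c y : ℕ
    ℓ = suc ⌊log₂ n ⌋
    c = ⌊log₂ ℓ ⌋
    y = 2 ^ c

    ℓ≤2y : ℓ ≤ 2 * y
    ℓ≤2y = <⇒≤ (n<2^suc-log ℓ)

  abstract
    precision : ℕ
    precision = 8 + c

    k≡ : 2 ^ precision ≡ 256 * y
    k≡ = ^-distribˡ-+-* 2 8 c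

    2^precision≤ : 2 ^ precision ≤ 256 * ℓ
    2^precision≤ = ≤-trans (≤-reflexive k≡) (*-monoʳ-≤ 256 (2^log≤ ℓ (s≤s z≤n)))

    log≤2^precision : ℓ ≤ 2 ^ precision
    log≤2^precision = ≤-trans ℓ≤2y (≤-trans (*-monoˡ-≤ y (m≤m+n 2 254)) (≤-reflexive (sym k≡)))

    -- The left side is the exponent that the union bound over n and all rounds requires. In terms
    -- of the power of two y with y ≤ ℓ ≤ 2 y it is at most 147 + 19 y, and the factor 256 leaves
    -- room above that.
    precision-enough : 2 * ℓ + 27 + 15 * precision ≤ 2 ^ precision
    precision-enough = begin
      2 * ℓ + 27 + 15 * (8 + c)
        ≤⟨ +-mono-≤ (+-mono-≤ (*-monoʳ-≤ 2 ℓ≤2y) (≤-refl {27})) (*-monoʳ-≤ 15 (+-monoʳ-≤ 8 (<⇒≤ (n<2^n c)))) ⟩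
      2 * (2 * y) + 27 + 15 * (8 + y)
        ≡⟨ r₁ y ⟩
      147 * 1 + 19 * y
        ≤⟨ +-monoˡ-≤ (19 * y) (*-monoʳ-≤ 147 (pow-pos {2} c (s≤s z≤n))) ⟩
      147 * y + 19 * y
        ≤⟨ m≤m+n _ (90 * y) ⟩
      147 * y + 19 * y + 90 * y
        ≡⟨ r₂ y ⟩
      256 * y
        ≡⟨ sym k≡ ⟩
      2 ^ precision ∎
      where
      open ≤-Reasoning
      r₁ : ∀ y → 2 * (2 * y) + 27 + 15 * (8 + y) ≡ 147 * 1 + 19 * y
      r₁ = solve-∀
      r₂ : ∀ y → 147 * y + 19 * y + 90 * y ≡ 256 * y
      r₂ = solve-∀

module Sized (n a : ℕ) (k≤ : 2 ^ a ≤ 256 * suc ⌊log₂ n ⌋) (ℓ≤k : suc ⌊log₂ n ⌋ ≤ 2 ^ a)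
             (exponent : 2 * suc ⌊log₂ n ⌋ + 27 + 15 * a ≤ 2 ^ a) where

  lg ℓ k : ℕ
  lg = ⌊log₂ n ⌋
  ℓ = suc lg
  k = 2 ^ a

  -- Subtracting 2 makes v^7 smaller than 2^σ by the factor 2^14 assumed in `many`. Where the
  -- subtraction is cut off at 0 one has v = 1, and such scales fail k^2 ≤ v because k ≥ 2.
  τ : ℕ → ℕ
  τ σ = σ / 7 ∸ 2

  v̂ : ℕ
  v̂ = 2 ^ τ lg

  -- k^14 comes from the small scales: there v ≤ k^2, so at most v^7 2^21 ≤ k^14 2^21 elements are
  -- treated one per round. 2^27 is 64 * 2^21 from `cheap`, and v̂ is the v of the largest scale.
  C : ℕ
  C = k ^ 14 * (v̂ * v̂ * v̂) * 2 ^ 27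

  R : ℕ
  R = ℓ * C

  scales : ℕ → Scale
  scales σ = concrete a (τ σ)

  k>0 : 1 ≤ k
  k>0 = pow-pos {2} a (s≤s z≤n)

  below-2^k : ∀ e → e ≤ 2 * ℓ + 27 + 15 * a → 2 ^ e ≤ 2 ^ k
  below-2^k e le = ^-monoʳ-≤ 2 (≤-trans le exponent)

  n≤2^ℓ : n ≤ 2 ^ ℓ
  n≤2^ℓ = <⇒≤ (n<2^suc-log n)

  τ-mono : ∀ {σ σ'} → σ ≤ σ' → τ σ ≤ τ σ'
  τ-mono le = ∸-monoˡ-≤ 2 (/-monoˡ-≤ 7 le)

  τ*7≤ : ∀ σ → τ σ * 7 ≤ σ
  τ*7≤ σ = ≤-trans (*-monoˡ-≤ 7 (m∸n≤m (σ / 7) 2)) (m/n*n≤m σ 7)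

  v≤v̂ : ∀ {σ} → σ ≤ lg → 2 ^ τ σ ≤ v̂
  v≤v̂ le = ^-monoʳ-≤ 2 (τ-mono le)

  v̂≤2^ℓ : v̂ * v̂ * v̂ ≤ 2 ^ ℓ
  v̂≤2^ℓ = begin
    v̂ * v̂ * v̂               ≡⟨ r v̂ ⟩
    v̂ ^ 3                     ≡⟨ ^-*-assoc 2 (τ lg) 3 ⟩
    2 ^ (τ lg * 3)            ≤⟨ ^-monoʳ-≤ 2 (≤-trans (*-monoʳ-≤ (τ lg) (m≤m+n 3 4)) (≤-trans (τ*7≤ lg) (n≤1+n lg))) ⟩
    2 ^ ℓ ∎
    where
    open ≤-Reasoning
    r : ∀ v → v * v * v ≡ v * (v * (v * 1))
    r = solve-∀

  v̂>0 : 1 ≤ v̂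
  v̂>0 = pow-pos {2} (τ lg) (s≤s z≤n)

  -- Every factor is bounded by a power of two: n and v̂^3 by 2^ℓ, and ℓ by k, which gives k^15 =
  -- 2^(15 a). The exponents add up to the left side of `exponent`.
  nR≤2^k : n * R ≤ 2 ^ k
  nR≤2^k = begin
    n * (ℓ * (k ^ 14 * (v̂ * v̂ * v̂) * 2 ^ 27))
      ≤⟨ *-mono-≤ n≤2^ℓ (*-mono-≤ ℓ≤k (*-monoˡ-≤ (2 ^ 27) (*-monoʳ-≤ (k ^ 14) v̂≤2^ℓ))) ⟩
    2 ^ ℓ * (k * (k ^ 14 * 2 ^ ℓ * 2 ^ 27))
      ≡⟨ r (2 ^ ℓ) k (k ^ 14) (2 ^ 27) ⟩
    2 ^ ℓ * 2 ^ ℓ * 2 ^ 27 * (k * k ^ 14)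
      ≡⟨ cong₂ _*_ (trans (cong (_* 2 ^ 27) (sym (^-distribˡ-+-* 2 ℓ ℓ))) (sym (^-distribˡ-+-* 2 (ℓ + ℓ) 27)))
                   (^-*-assoc 2 a 15) ⟩
    2 ^ (ℓ + ℓ + 27) * 2 ^ (a * 15)
      ≡⟨ sym (^-distribˡ-+-* 2 (ℓ + ℓ + 27) (a * 15)) ⟩
    2 ^ (ℓ + ℓ + 27 + a * 15)
      ≤⟨ below-2^k _ (≤-reflexive (r' ℓ a)) ⟩
    2 ^ k ∎
    where
    open ≤-Reasoning
    r : ∀ l k p c → l * (k * (p * l * c)) ≡ l * l * c * (k * p)
    r = solve-∀
    r' : ∀ l a → l + l + 27 + a * 15 ≡ 2 * l + 27 + 15 * a
    r' = solve-∀

  2n≤2^k : 2 * n ≤ 2 ^ k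
  2n≤2^k = ≤-trans (*-monoʳ-≤ 2 n≤2^ℓ) (below-2^k (suc ℓ) (≤-trans (m≤m+n (suc ℓ) (lg + 27 + 15 * a)) (≤-reflexive (r lg (15 * a)))))
    where
    r : ∀ l x → suc (suc l) + (l + 27 + x) ≡ 2 * suc l + 27 + x
    r = solve-∀

  few : ∀ σ → 2 ^ suc σ ≤ (2 ^ τ σ) ^ 7 * 2 ^ 21
  few σ = begin
    2 ^ suc σ                 ≤⟨ ^-monoʳ-≤ 2 σ< ⟩
    2 ^ (τ σ * 7 + 21)        ≡⟨ ^-distribˡ-+-* 2 (τ σ * 7) 21 ⟩
    2 ^ (τ σ * 7) * 2 ^ 21    ≡⟨ cong (_* 2 ^ 21) (sym (^-*-assoc 2 (τ σ) 7)) ⟩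
    (2 ^ τ σ) ^ 7 * 2 ^ 21 ∎
    where
    open ≤-Reasoning
    σ< : suc σ ≤ τ σ * 7 + 21
    σ< = begin
      suc σ                        ≡⟨ cong suc (m≡m%n+[m/n]*n σ 7) ⟩
      suc (σ % 7) + σ / 7 * 7      ≤⟨ +-mono-≤ (m%n<n σ 7) (*-monoˡ-≤ 7 (m≤n+m∸n (σ / 7) 2)) ⟩
      7 + (2 + τ σ) * 7            ≡⟨ r (τ σ) ⟩
      τ σ * 7 + 21 ∎
      where
      r : ∀ t → 7 + (2 + t) * 7 ≡ t * 7 + 21
      r = solve-∀

  large-fits : ∀ σ → σ ≤ lg → Scale.large (concrete a (τ σ)) ≡ true → Fits n k C σ (concrete a (τ σ))
  large-fits σ σ≤ large = Concrete.concrete-fits n a (τ σ) σ C k²≤v 2n≤2^k long many (few σ) C≥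
    where
    open ≤-Reasoning
    v = 2 ^ τ σ
    k²≤v : k * k ≤ v
    k²≤v = ≤ᵇ-true large
    v≤2^ℓ : v ≤ 2 ^ ℓ
    v≤2^ℓ = ^-monoʳ-≤ 2 (≤-trans (≤-trans (m≤m*n (τ σ) 7) (τ*7≤ σ)) (≤-trans σ≤ (n≤1+n lg)))
    long : 384 * (k * k * v) ≤ 2 ^ k
    long = begin
      384 * (k * k * v)                      ≤⟨ *-mono-≤ (m≤m+n 384 128) (*-monoʳ-≤ (k * k) v≤2^ℓ) ⟩
      2 ^ 9 * (k * k * 2 ^ ℓ)                ≡⟨ cong (λ z → 2 ^ 9 * (z * 2 ^ ℓ)) (sym (^-distribˡ-+-* 2 a a)) ⟩
      2 ^ 9 * (2 ^ (a + a) * 2 ^ ℓ)          ≡⟨ trans (cong (2 ^ 9 *_) (sym (^-distribˡ-+-* 2 (a + a) ℓ))) (sym (^-distribˡ-+-* 2 9 (a + a + ℓ))) ⟩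
      2 ^ (9 + (a + a + ℓ))                  ≤⟨ below-2^k (9 + (a + a + ℓ)) (≤-trans (m≤m+n (9 + (a + a + ℓ)) (ℓ + 18 + 13 * a)) (≤-reflexive (r a ℓ))) ⟩
      2 ^ k ∎
      where
      r : ∀ a l → 9 + (a + a + l) + (l + 18 + 13 * a) ≡ 2 * l + 27 + 15 * a
      r = solve-∀
    k≥2 : 2 ≤ k
    k≥2 = ≤-trans (≤-trans (≤-trans {2} {27} (s≤s (s≤s z≤n)) (m≤n+m 27 (2 * ℓ))) (m≤m+n (2 * ℓ + 27) (15 * a))) exponent
    τ>0 : 1 ≤ τ σ
    τ>0 with τ σ | k²≤v
    ... | zero  | le = ⊥-elim (<-irrefl refl (≤-trans (*-mono-≤ k≥2 k>0) le))
    ... | suc t | _  = s≤s z≤n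
    many : v ^ 7 * 2 ^ 14 ≤ 2 ^ σ
    many = begin
      v ^ 7 * 2 ^ 14             ≡⟨ trans (cong (_* 2 ^ 14) (^-*-assoc 2 (τ σ) 7)) (sym (^-distribˡ-+-* 2 (τ σ * 7) 14)) ⟩
      2 ^ (τ σ * 7 + 14)         ≡⟨ cong (2 ^_) (sym (*-distribʳ-+ 7 (τ σ) 2)) ⟩
      2 ^ ((τ σ + 2) * 7)        ≡⟨ cong (λ z → 2 ^ (z * 7)) (m∸n+n≡m {σ / 7} {2} (<⇒≤ (m∸n≢0⇒n<m {σ / 7} {2} (λ z → <-irrefl (sym z) τ>0)))) ⟩
      2 ^ (σ / 7 * 7)            ≤⟨ ^-monoʳ-≤ 2 (m/n*n≤m σ 7) ⟩
      2 ^ σ ∎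
    C≥ : k * k * k * (v * v * v) * 2 ^ 27 ≤ C
    C≥ = *-monoˡ-≤ (2 ^ 27) (*-mono-≤ k³≤ (*-mono-≤ (*-mono-≤ (v≤v̂ σ≤) (v≤v̂ σ≤)) (v≤v̂ σ≤)))
      where
      k³≤ : k * k * k ≤ k ^ 14
      k³≤ = begin
        k * k * k       ≡⟨ r k ⟩
        k ^ 3           ≤⟨ ^-monoʳ-≤ k {{>-nonZero k>0}} (m≤m+n 3 11) ⟩
        k ^ 14 ∎
        where
        r : ∀ v → v * v * v ≡ v * (v * (v * 1))
        r = solve-∀

  small-tiny : ∀ σ → Scale.large (concrete a (τ σ)) ≡ false → 2 ^ suc σ ≤ C
  small-tiny σ small = begin
    2 ^ suc σ                     ≤⟨ few σ ⟩
    v ^ 7 * 2 ^ 21                ≤⟨ *-mono-≤ (^-monoˡ-≤ 7 v≤k²) (^-monoʳ-≤ 2 (m≤m+n 21 6)) ⟩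
    (k * k) ^ 7 * 2 ^ 27          ≡⟨ cong (_* 2 ^ 27) (trans (power-* k k 7) (sym (^-distribˡ-+-* k 7 7))) ⟩
    k ^ 14 * 2 ^ 27               ≤⟨ *-monoˡ-≤ (2 ^ 27) (≤-trans (≤-reflexive (sym (*-identityʳ (k ^ 14)))) (*-monoʳ-≤ (k ^ 14) (≥-* (≥-* v̂>0 v̂>0) v̂>0))) ⟩
    C ∎
    where
    open ≤-Reasoning
    v = 2 ^ τ σ
    v≤k² : v ≤ k * k
    v≤k² with v ≤? k * k
    ... | yes le = le
    ... | no ¬le = true≢false (≤ᵇ-complete (<⇒≤ (≰⇒> ¬le))) small

  few-queries : ∀ σ → (n * k + k) * (Scale.J (scales (σ ⊓ lg)) * (n * 2)) ≤ suc n ^ 5 * 16384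
  few-queries σ = layer-queries n k (2 ^ τ (σ ⊓ lg)) (suc n) refl
    (≤-trans k≤ (*-monoʳ-≤ 256 (s≤s (log≤ n))))
    (≤-trans (^-monoʳ-≤ 2 (≤-trans (m≤m*n (τ (σ ⊓ lg)) 7) (≤-trans (τ*7≤ (σ ⊓ lg)) (m⊓n≤n σ lg)))) (2^log≤suc n))

  few-draws : k * 1 ≤ suc n ^ 5 * 16384
  few-draws = draw-queries k (suc n) (s≤s z≤n) (≤-trans k≤ (*-monoʳ-≤ 256 (s≤s (log≤ n))))

  open Assembly n k C scales using (coinSampler; tree; tree-bounded; module Success) public
  open Success k>0 nR≤2^k large-fits (λ σ _ → small-tiny σ) public

  few-queries-total : ∀ r h qs → follow (tree r) h ≡ query qs → length qs ≤ 16384 * suc n ^ 5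
  few-queries-total r h qs eq = ≤-trans (follow-bounded (tree-bounded few-queries few-draws (one-query (suc n) (s≤s z≤n)) r) h qs eq)
    (≤-reflexive (*-comm (suc n ^ 5) 16384))

  -- From v̂^7 ≤ n one gets (v̂^3)^7 ≤ n^3. The factors ℓ and k^14 contribute 15 logarithms, and 15
  -- * 7 = 105.
  few-rounds : 2 ≤ n → R ^ 7 ≤ (2 * 2 ^ 126 * 2 ^ 27) ^ 7 * n ^ 3 * lg ^ 105
  few-rounds n≥2 = begin
    R ^ 7
      ≤⟨ ^-monoˡ-≤ 7 R≤ ⟩
    (c₁ * w * lg ^ 15) ^ 7
      ≡⟨ trans (power-* (c₁ * w) (lg ^ 15) 7) (cong₂ _*_ (power-* c₁ w 7) (^-*-assoc lg 15 7)) ⟩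
    c₁ ^ 7 * w ^ 7 * lg ^ 105
      ≤⟨ *-monoˡ-≤ (lg ^ 105) (*-monoʳ-≤ (c₁ ^ 7) w⁷≤) ⟩
    c₁ ^ 7 * n ^ 3 * lg ^ 105 ∎
    where
    open ≤-Reasoning
    c₁ = 2 * 2 ^ 126 * 2 ^ 27
    w = v̂ * v̂ * v̂
    lg>0 : 1 ≤ lg
    lg>0 = ⌊log₂⌋-mono-≤ {2} {n} n≥2
    ℓ≤2lg : ℓ ≤ 2 * lg
    ℓ≤2lg = ≤-trans (+-monoˡ-≤ lg lg>0) (≤-reflexive (cong (lg +_) (sym (+-identityʳ lg))))
    k≤lg : k ≤ 2 ^ 9 * lg
    k≤lg = ≤-trans k≤ (≤-trans (*-monoʳ-≤ 256 ℓ≤2lg) (≤-reflexive (sym (*-assoc 256 2 lg))))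
    R≤ : R ≤ c₁ * w * lg ^ 15
    R≤ = begin
      ℓ * (k ^ 14 * w * 2 ^ 27)
        ≤⟨ *-mono-≤ ℓ≤2lg (*-monoˡ-≤ (2 ^ 27) (*-monoˡ-≤ w (^-monoˡ-≤ 14 k≤lg))) ⟩
      2 * lg * ((2 ^ 9 * lg) ^ 14 * w * 2 ^ 27)
        ≡⟨ cong (λ z → 2 * lg * (z * w * 2 ^ 27)) (trans (power-* (2 ^ 9) lg 14) (cong (_* lg ^ 14) (^-*-assoc 2 9 14))) ⟩
      2 * lg * (2 ^ 126 * lg ^ 14 * w * 2 ^ 27)
        ≡⟨ r lg (2 ^ 126) (lg ^ 14) w (2 ^ 27) ⟩
      c₁ * w * (lg * lg ^ 14) ∎
      where
      r : ∀ g A G w B → 2 * g * (A * G * w * B) ≡ 2 * A * B * w * (g * G)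
      r = solve-∀
    w⁷≤ : w ^ 7 ≤ n ^ 3
    w⁷≤ = begin
      w ^ 7                     ≡⟨ cong (_^ 7) (r v̂) ⟩
      (v̂ ^ 3) ^ 7              ≡⟨ trans (^-*-assoc v̂ 3 7) (sym (^-*-assoc v̂ 7 3)) ⟩
      (v̂ ^ 7) ^ 3              ≤⟨ ^-monoˡ-≤ 3 v̂⁷≤ ⟩
      n ^ 3 ∎
      where
      r : ∀ v → v * v * v ≡ v * (v * (v * 1))
      r = solve-∀
      v̂⁷≤ : v̂ ^ 7 ≤ n
      v̂⁷≤ = ≤-trans (≤-reflexive (^-*-assoc 2 (τ lg) 7)) (≤-trans (^-monoʳ-≤ 2 (τ*7≤ lg)) (2^log≤ n (≤-trans (s≤s z≤n) n≥2)))

module Size (n : ℕ) where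
  open Precision n
  open Sized n precision 2^precision≤ log≤2^precision precision-enough public

algorithm : Algorithm
algorithm = record
  { randBits = λ n → bits (Size.coinSampler n)
  ; step = λ n r h → follow (Size.tree n r) h }

polyQueries : PolyQueries algorithm
polyQueries = 16384 , 5 , Size.few-queries-total

softO : SoftO-n3/7 Size.R
softO = (2 * 2 ^ 126 * 2 ^ 27) ^ 7 , 105 , Size.few-rounds

whp : ∀ n (M : Matroid n) → WHP algorithm M (Size.R n)
-- For n = 0 the required inequality is 0 ≤ 0, so the empty list of successful strings suffices.
whp zero      M = [] , [] , [] , z≤n
whp n@(suc _) M =
    filter (λ r → ok M (s≤s z≤n) r Bool.≟ true) rs
  , filter⁺ (λ r → ok M (s≤s z≤n) r Bool.≟ true) (bits-unique (bits coinSampler))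
  , All.map (λ {r} → ok-basis M (s≤s z≤n) r) (all-filter (λ r → ok M (s≤s z≤n) r Bool.≟ true) rs)
  , successes M (s≤s z≤n)
  where
  open Size n
  rs = bitStrings (bits coinSampler)

theorem1p1 : Σ Algorithm λ A → Σ (ℕ → ℕ) λ R →
    PolyQueries A × SoftO-n3/7 R × (∀ n (M : Matroid n) → WHP A M (R n))
theorem1p1 = algorithm , Size.R , polyQueries , softO , whp
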